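{- All the proof rules of the logic are sound. That is: the usual rules of first-order intuitionistic logic with equality, the proof rules 1–9 for Hoare triples, the axioms 10 for invariant extension, and the fixed-point induction rule 11 (all listed in the context) are sound, where a specification $\Delta\mid\Gamma\vdash\varphi$ is valid iff $(\rho,\eta_0,\eta_1,r)\models\varphi$ for all $(\rho,\eta_0,\eta_1,r)\in[\![\Delta]\!]\times[\![\Gamma]\!]^2\times\mathcal R$, and a proof rule is sound when it is a valid axiom or an inference rule that concludes a valid specification from valid premises.
   Context: **FM domain theory.** $\mathit{Loc}$ is a countably infinite set (locations). A permutation is a bijection $\pi$ of $\mathit{Loc}$ with $\pi(l)\neq l$ for only finitely many $l$; $\mathsf{perm}$ is the set of these. An FM-set is a set $A$ with an action $\cdot:\mathsf{perm}\times A\to A$ such that $\mathrm{id}\cdot a=a$, $\pi\cdot(\pi'\cdot a)=(\pi\circ\pi')\cdot a$, and every $a\in A$ is supported by some finite $L\subseteq\mathit{Loc}$, i.e. ($\forall l\in L.\ \pi(l)=l$) implies $\pi\cdot a=a$. The smallest supporting set is $\mathsf{supp}(a)$. An FM-poset is an FM-set with a partial order preserved by the action. A chain is finitely supported if one finite $L\subseteq\mathit{Loc}$ supports all its elements. An FM-cpo is an FM-poset in which every finitely supported $\omega$-chain has a least upper bound; morphisms are functions commuting with the action and preserving lubs of finitely supported chains. Products $A\times B$ are cartesian; the exponential $A\to B$ consists of the finitely supported (for $(\pi\cdot f)(a)=\pi\cdot f(\pi^{ -1}\cdot a)$) monotone functions preserving lubs of finitely supported chains, ordered pointwise. $A\rightharpoonup_{fin}B$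 is the set of finite partial functions, with $f\sqsubseteq g$ iff $\mathrm{dom}(f)=\mathrm{dom}(g)$ and $f(a)\sqsubseteq g(a)$ for all $a\in \mathrm{dom}(f)$, and $(\pi\cdot f)(a)=\pi\cdot f(\pi^{ -1}\cdot a)$ if $a\in\pi(\mathrm{dom} f)$, undefined otherwise. **Semantic domains.** $\mathit{Val}=\mathit{Loc}+\mathit{Int}+\{\mathit{default}\}$ (discrete; $\pi$ acts on locations only); $\mathit{O}=\{\mathit{normal},\mathit{err}\}_\bot$ (flat, trivial action); $\mathit{G}=\{\mathit{normal},\bot\}\subseteq \mathit O$; $\mathit{Heap}=\mathit{Loc}\rightharpoonup_{fin}\mathit{Val}\times\mathit{Val}$; $\mathit{Cont}=(\mathit{Heap}\to\mathit{O})$. For heaps, $h\#h'$ means disjoint domains, and $h\bullet h'$ is the union of disjoint heaps (undefined otherwise); $[]$ is the empty heap. **Language.** Types $\tau::=\mathsf{com}\mid\mathsf{val}\to\tau\mid\tau\to\tau$. Expressions $E::=i\mid 0\mid 1\mid -1\mid E+E\mid E-E$, with stack variables $i,j,\dots$. Terms $M::=x\mid\lambda i.M\mid M\,E\mid\lambda x{:}\tau.M\mid M\,M\mid\mathsf{fix}\,M\mid\mathsf{if}\,(E{=}E)\,\mathsf{then}\,M\,\mathsf{else}\,M\mid M;M\mid\mathsf{let}\ i{=}\mathsf{new}\ \mathsf{in}\ M\mid\mathsf{free}(E)\mid\mathsf{let}\ i{=}E.f\ \mathsf{in}\ M\mid E.f:=E$ with $f\in\{0,1\}$ and identifiers $x,y,\dots$.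 $\Delta$ is a finite set of stack variables and $\Gamma$ a finite type environment for identifiers. $\Delta\vdash E$ means all variables of $E$ are in $\Delta$. $\Delta\mid\Gamma\vdash M:\tau$ is simple typing: identifiers have their type in $\Gamma$; $\lambda i.M:\mathsf{val}\to\tau$ if $\Delta,i\mid\Gamma\vdash M:\tau$; $M\,E:\tau$ if $M:\mathsf{val}\to\tau$; $\lambda x{:}\tau.M:\tau\to\tau'$ if $\Delta\mid\Gamma,x{:}\tau\vdash M:\tau'$; $M\,N:\tau$ if $M:\tau'\to\tau$, $N:\tau'$; $\mathsf{fix}\,M:\tau$ if $M:\tau\to\tau$; the remaining constructs have type $\mathsf{com}$, with subterms of type $\mathsf{com}$ (and $\Delta$ extended by $i$ for the bodies of the two let forms). **Semantics of the language.** $[\![\mathsf{com}]\!]=(\mathit{Heap}\times\mathit{Cont}\to\mathit{O})$, $[\![\mathsf{val}\to\tau]\!]=\mathit{Val}\to[\![\tau]\!]$, $[\![\tau\to\tau']\!]=[\![\tau]\!]\to[\![\tau']\!]$, $[\![\Delta]\!]=\prod_{i\in\Delta}\mathit{Val}$, $[\![\Gamma]\!]=\prod_{x:\tau\in\Gamma}[\![\tau]\!]$. For $\rho\in[\![\Delta]\!]$: $[\![i]\!]_\rho=\rho(i)$, constants denote integers, $[\![E_1\pm E_2]\!]_\rho$ is the integer sum/difference if both values are integers and $\mathit{default}$ otherwise. For terms, $[\![M]\!]_{\rho,\eta}\in[\![\tau]\!]$: identifiers, abstractions, applications are interpreted in the standard way, $\mathsf{fix}$ is least fixed point, the conditional chooses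 a branch according to whether $[\![E]\!]_\rho=[\![F]\!]_\rho$, and - $[\![M;N]\!]_{\rho,\eta}(h,k)=[\![M]\!]_{\rho,\eta}(h,\lambda h'.[\![N]\!]_{\rho,\eta}(h',k))$; - $[\![\mathsf{let}\ i{=}\mathsf{new}\ \mathsf{in}\ M]\!]_{\rho,\eta}(h,k)=[\![M]\!]_{\rho[i\to l],\eta}(h\bullet[l\to 0,0],k)$ for any $l\in\mathit{Loc}\setminus\mathsf{supp}(h,\rho,\eta,k)$ (the result is independent of $l$); - $[\![\mathsf{free}(E)]\!]_{\rho,\eta}(h,k)=\mathit{err}$ if $[\![E]\!]_\rho\notin\mathrm{dom}(h)$, else $k(h')$ where $h'$ is $h$ with cell $[\![E]\!]_\rho$ removed; - $[\![\mathsf{let}\ i{=}E.f\ \mathsf{in}\ M]\!]_{\rho,\eta}(h,k)=\mathit{err}$ if $[\![E]\!]_\rho\notin\mathrm{dom}(h)$, else $[\![M]\!]_{\rho[i\to v],\eta}(h,k)$ with $v$ the $f$-th component of $h([\![E]\!]_\rho)$; - $[\![E.f:=F]\!]_{\rho,\eta}(h,k)=\mathit{err}$ if $[\![E]\!]_\rho\notin\mathrm{dom}(h)$, else $k(h')$ where $h'$ is $h$ with the $f$-th component of cell $[\![E]\!]_\rho$ replaced by $[\![F]\!]_\rho$. **Assertions.** $P::=E=E\mid E\le E\mid E\mapsto E,E\mid\mathsf{emp}\mid P*P\mid P\wedge P\mid\neg P\mid\exists i.P$ (other classical connectives are defined), depending only on stack variables, with the standard semantics $[\![P]\!]_\rho\subseteq\mathit{Heap}$: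 $E\mapsto E_0,E_1$ holds of the heap consisting of the single cell at location $[\![E]\!]_\rho$ with contents $([\![E_0]\!]_\rho,[\![E_1]\!]_\rho)$; $\mathsf{emp}$ holds only of $[]$; $P*Q$ holds of $h$ iff $h=h_1\bullet h_2$ with $h_1\in[\![P]\!]_\rho$, $h_2\in[\![Q]\!]_\rho$; $E\le F$ compares integer values; the rest is classical, with $\exists i$ ranging over $\mathit{Val}$. Abbreviations: $E\mapsto -$ is $\exists i,j.E\mapsto i,j$; $E\mapsto -,E_1$ is $\exists i.E\mapsto i,E_1$; $E\mapsto E_0,-$ is $\exists i.E\mapsto E_0,i$ (bound variables fresh). **Specifications.** $\varphi::=\{P\}M\{Q\}\mid\varphi\otimes P\mid E=E\mid M=M\mid\varphi\wedge\varphi\mid\varphi\vee\varphi\mid\varphi\Rightarrow\varphi\mid\forall x{:}\tau.\varphi\mid\exists x{:}\tau.\varphi\mid\forall i.\varphi\mid\exists i.\varphi$, typed by $\Delta\mid\Gamma\vdash\varphi:\mathsf{Specs}$ in the evident way ($M:\mathsf{com}$ in triples; both sides of $M=N$ of the same type). **Relations and quadruples.** $\mathcal R$ is the set of binary relations $r$ on $\mathit{Heap}$ that are finitely supported (there is a finite $L\subseteq\mathit{Loc}$ such that whenever $\pi$ fixes $L$ pointwise, $h_0[r]h_1\iff(\pi\cdot h_0)[r](\pi\cdot h_1)$). $h_0[r*s]h_1$ iff there are splittings $h_0=n_0\bullet m_0$, $h_1=n_1\bullet m_1$ with $n_0[r]n_1$ and $m_0[s]m_1$. For a subset $D_0$ of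 an FM-cpo, $\mathsf{eq}(D_0)=\{(d,d)\mid d\in D_0\}$. $k_0[r\to\mathsf{eq}(\mathit{G})]k_1$ means $k_0(h_0)[\mathsf{eq}(\mathit{G})]k_1(h_1)$ whenever $h_0[r]h_1$. For $c_0,c_1\in[\![\mathsf{com}]\!]$ and $r,s\in\mathcal R$, the semantic quadruple $[r](c_0,c_1)[s]$ holds iff for all $r'\in\mathcal R$, $h_0,h_1\in\mathit{Heap}$, $k_0,k_1\in\mathit{Cont}$: $h_0[r*r']h_1$ and $k_0[s*r'\to\mathsf{eq}(\mathit{G})]k_1$ imply $c_0(h_0,k_0)[\mathsf{eq}(\mathit{G})]c_1(h_1,k_1)$. **Satisfaction.** For $\rho\in[\![\Delta]\!]$, $\eta_0,\eta_1\in[\![\Gamma]\!]$, $r\in\mathcal R$: - $(\rho,\eta_0,\eta_1,r)\models\{P\}M\{Q\}$ iff $[\mathsf{eq}([\![P]\!]_\rho)*r]([\![M]\!]_{\rho,\eta_0},[\![M]\!]_{\rho,\eta_1})[\mathsf{eq}([\![Q]\!]_\rho)*r]$; - $(\rho,\eta_0,\eta_1,r)\models\varphi\otimes P$ iff $(\rho,\eta_0,\eta_1,r*\mathsf{eq}([\![P]\!]_\rho))\models\varphi$; - $\models E=F$ iff $[\![E]\!]_\rho=[\![F]\!]_\rho$; $\models M=N$ iff $[\![M]\!]_{\rho,\eta_j}=[\![N]\!]_{\rho,\eta_j}$ for $j=0,1$; - $(\rho,\eta_0,\eta_1,r)\models\varphi\Rightarrow\psi$ iff for all $s\in\mathcal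 R$, $(\rho,\eta_0,\eta_1,r*s)\models\varphi$ implies $(\rho,\eta_0,\eta_1,r*s)\models\psi$; - $\forall i$ / $\exists i$: for all / some $v\in\mathit{Val}$, $(\rho[i\to v],\eta_0,\eta_1,r)\models\varphi$; - $\forall x{:}\tau$ / $\exists x{:}\tau$: for all / some $m,n\in[\![\tau]\!]$, $(\rho,\eta_0[x\to m],\eta_1[x\to n],r)\models\varphi$; - $\wedge,\vee$ are interpreted pointwise as "and", "or". **The logic.** Its rules are all usual rules of first-order intuitionistic logic with equality (for formulas in contexts $\Delta\mid\Gamma$), together with the following (all well-typed instances; $\mathsf{fv}$ = free variables). Triples: 1. $(\forall i.\{P\}M\{Q\})\Rightarrow\{\exists i.P\}M\{\exists i.Q\}$, $i\notin\mathsf{fv}(M)$. 2. $(\{P\}M\{Q\}\wedge\{P'\}M\{Q'\})\Rightarrow\{P\vee P'\}M\{Q\vee Q'\}$. 3. $\{P\wedge E{=}F\}M\{Q\}\wedge\{P\wedge E{\neq}F\}N\{Q\}\Rightarrow\{P\}\mathsf{if}\,(E{=}F)\,\mathsf{then}\,M\,\mathsf{else}\,N\{Q\}$. 4. $\{P\}M\{P_0\}\wedge\{P_0\}N\{Q\}\Rightarrow\{P\}M;N\{Q\}$. 5. $(\forall i.\{P*i\mapsto 0,0\}M\{Q\})\Rightarrow\{P\}\mathsf{let}\ i{=}\mathsf{new}\ \mathsf{in}\ M\{Q\}$, $i\notin\mathsf{fv}(P,Q)$. 6. $(\forall i.\{P*E\mapsto i,E_1\}M\{Q\})\Rightarrow\{\exists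 i.P*E\mapsto i,E_1\}\mathsf{let}\ i{=}E.0\ \mathsf{in}\ M\{Q\}$, $i\notin\mathsf{fv}(E,Q)$. 7. $\{E\mapsto -\}\mathsf{free}(E)\{\mathsf{emp}\}$. 8. $\{E\mapsto -,E_1\}E.0:=F\{E\mapsto F,E_1\}$. 9. (Consequence) If $[\![P]\!]_\rho\subseteq[\![P']\!]_\rho$ and $[\![Q']\!]_\rho\subseteq[\![Q]\!]_\rho$ for all $\rho\in[\![\Delta]\!]$, infer $\Delta\mid\Gamma\vdash\{P'\}M\{Q'\}\Rightarrow\{P\}M\{Q\}$. Invariant extension: 10. $\varphi\Rightarrow\varphi\otimes P$; $\{P\}M\{P'\}\otimes Q\Leftrightarrow\{P*Q\}M\{P'*Q\}$; $(E=F)\otimes Q\Leftrightarrow E=F$; $(M=N)\otimes Q\Leftrightarrow M=N$; $(\varphi\otimes P)\otimes Q\Leftrightarrow\varphi\otimes(P*Q)$; $(\varphi\oplus\psi)\otimes P\Leftrightarrow(\varphi\otimes P)\oplus(\psi\otimes P)$ for $\oplus\in\{\Rightarrow,\wedge,\vee\}$; $(\kappa x{:}\tau.\varphi)\otimes P\Leftrightarrow\kappa x{:}\tau.\,\varphi\otimes P$ for $\kappa\in\{\forall,\exists\}$; $(\kappa i.\varphi)\otimes P\Leftrightarrow\kappa i.\,\varphi\otimes P$ for $\kappa\in\{\forall,\exists\}$, $i\notin\mathsf{fv}(P)$. Fixed-point induction: let $C::=[\,]\mid\lambda i.C\mid C\,E\mid\lambda x{:}\tau.C\mid C\,M\mid\mathsf{fix}\,C\mid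 C;M$ and $\gamma::=\{P\}C\{Q\}\mid\gamma\wedge\gamma\mid\forall x{:}\tau.\gamma\mid\forall i.\gamma$, with $\gamma(N)$ the capture-avoiding insertion of $N$ into the hole(s). 11. $(\forall x.\,\gamma(x)\Rightarrow\gamma(M\,x))\Rightarrow\gamma(\mathsf{fix}\,M)$ ($x$ fresh). -}

module Defs where

open import Axiom.ExcludedMiddle using (ExcludedMiddle)
open import Data.Bool.Base using (true; false; if_then_else_)
open import Data.Fin.Base using (Fin; zero; suc; lift)
open import Data.Integer.Base as ℤ using (ℤ; 0ℤ; 1ℤ; -1ℤ)
import Data.Integer.Properties as ℤ
open import Data.List.Base using (List; []; _∷_; _++_; map; foldr; concat)
open import Data.List.Membership.Propositional using (_∈_; _∉_)
open import Data.List.Membership.Propositional.Properties using (∈-++⁺ˡ; ∈-++⁺ʳ; ∈-map⁺; ∈-map⁻; ∈-concat⁺′)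
open import Data.List.Relation.Unary.All using (All)
open import Data.List.Relation.Unary.Any using (here; there)
import Data.Maybe.Properties as Maybe
open import Data.Maybe.Base as Maybe using (Maybe; just; nothing; _<∣>_)
open import Data.Maybe.Properties using (map-<∣>)
open import Data.Nat.Base as ℕ using (ℕ; zero; suc; _⊔_)
import Data.Nat.Properties as ℕ
open import Data.Product.Base using (_×_; _,_; proj₁; proj₂; ∃; ∃-syntax)
open import Data.Product.Relation.Binary.Pointwise.NonDependent using (×-poset)
open import Data.Sum.Base using (_⊎_; inj₁; inj₂; [_,_]′)
open import Data.Unit.Base using (⊤; tt)
open import Data.Vec.Base as Vec using (Vec; []; _∷_)
import Data.Vec.Properties as Vec
open import Function.Base using (_∘_; id)
open import Function.Bundles using (Inverse; Equivalence; _↔_; _⇔_; mk⇔)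
open import Function.Construct.Composition using (_↔-∘_)
open import Function.Construct.Identity using (↔-id)
open import Function.Construct.Symmetry using (↔-sym)
open import Function.Properties.Inverse using (↔⇒↣)
open import Level using (0ℓ; Lift)
open import Relation.Binary.Bundles using (Setoid; Poset)
open import Relation.Binary.Definitions using (DecidableEquality)
open import Relation.Binary.PropositionalEquality as ≡ using (_≡_; _≢_; refl; sym; trans; cong; cong₂; subst)
import Relation.Binary.Properties.Setoid as SetoidProperties
open import Relation.Nullary.Decidable.Core using (yes; no; does; map′)
open import Relation.Nullary.Decidable using (via-injection; does-⇔)
open import Relation.Nullary.Negation.Core using (¬_; contradiction)

-- Both kinds of variables are well-scoped de Bruijn indices, so
-- a side condition i ∉ fv(M) is expressed by weakening M along i.

infixr 6 _⇒_
infixr 6 val⇒_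

data Ty : Set where
  com  : Ty
  val⇒_ : Ty → Ty
  _⇒_  : Ty → Ty → Ty

TyEnv : Set
TyEnv = List Ty

variable
  Δ Δ′ : ℕ
  Γ Γ′ : TyEnv
  σ τ τ′ : Ty

infixl 8 _⊞_ _⊟_

data Exp (Δ : ℕ) : Set where
  svar            : Fin Δ → Exp Δ
  zeroₑ oneₑ -oneₑ : Exp Δ
  _⊞_ _⊟_         : Exp Δ → Exp Δ → Exp Δ

data Field : Set where
  f₀ f₁ : Field

infixl 7 _·ᵥ_ _·ₜ_
infixr 5 _⨾_

data Tm (Δ : ℕ) (Γ : TyEnv) : Ty → Set where
  ident       : τ ∈ Γ → Tm Δ Γ τ
  ƛᵥ          : Tm (suc Δ) Γ τ → Tm Δ Γ (val⇒ τ)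
  _·ᵥ_        : Tm Δ Γ (val⇒ τ) → Exp Δ → Tm Δ Γ τ
  ƛₜ          : Tm Δ (σ ∷ Γ) τ → Tm Δ Γ (σ ⇒ τ)
  _·ₜ_        : Tm Δ Γ (σ ⇒ τ) → Tm Δ Γ σ → Tm Δ Γ τ
  fix         : Tm Δ Γ (τ ⇒ τ) → Tm Δ Γ τ
  if_≟_then_else_ : Exp Δ → Exp Δ → Tm Δ Γ com → Tm Δ Γ com → Tm Δ Γ com
  _⨾_         : Tm Δ Γ com → Tm Δ Γ com → Tm Δ Γ com
  letnew      : Tm (suc Δ) Γ com → Tm Δ Γ com
  free        : Exp Δ → Tm Δ Γ com
  letget      : Exp Δ → Field → Tm (suc Δ) Γ com → Tm Δ Γ com
  _∙_≔_       : Exp Δ → Field → Exp Δ → Tm Δ Γ com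

infix 7 _≐ᵃ_ _≤ᵃ_ _↦_,_
infixr 6 _∗_
infixr 5 _∧ᵃ_ _∨ᵃ_

data Asn (Δ : ℕ) : Set where
  _≐ᵃ_ _≤ᵃ_ : Exp Δ → Exp Δ → Asn Δ
  _↦_,_     : Exp Δ → Exp Δ → Exp Δ → Asn Δ
  emp       : Asn Δ
  _∗_ _∧ᵃ_  : Asn Δ → Asn Δ → Asn Δ
  ¬ᵃ_       : Asn Δ → Asn Δ
  ∃ᵃ_       : Asn (suc Δ) → Asn Δ

infix 4 ⟪_⟫_⟪_⟫ _≐ₑ_ _≐ₜ_
infixl 5 _⊗_
infixr 3 _∧ˢ_
infixr 2 _∨ˢ_
infixr 1 _⇒ˢ_

data Spec (Δ : ℕ) (Γ : TyEnv) : Set where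
  ⟪_⟫_⟪_⟫        : Asn Δ → Tm Δ Γ com → Asn Δ → Spec Δ Γ
  _⊗_            : Spec Δ Γ → Asn Δ → Spec Δ Γ
  _≐ₑ_           : Exp Δ → Exp Δ → Spec Δ Γ
  _≐ₜ_           : Tm Δ Γ τ → Tm Δ Γ τ → Spec Δ Γ
  _∧ˢ_ _∨ˢ_ _⇒ˢ_ : Spec Δ Γ → Spec Δ Γ → Spec Δ Γ
  ∀ₜ ∃ₜ          : (τ : Ty) → Spec Δ (τ ∷ Γ) → Spec Δ Γ
  ∀ᵥ ∃ᵥ          : Spec (suc Δ) Γ → Spec Δ Γ

infixr 0 _⇔ˢ_
_⇔ˢ_ : Spec Δ Γ → Spec Δ Γ → Spec Δ Γ
φ ⇔ˢ ψ = (φ ⇒ˢ ψ) ∧ˢ (ψ ⇒ˢ φ)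

SRen : ℕ → ℕ → Set
SRen Δ Δ′ = Fin Δ → Fin Δ′

TRen : TyEnv → TyEnv → Set
TRen Γ Γ′ = ∀ {τ} → τ ∈ Γ → τ ∈ Γ′

liftᵗ : TRen Γ Γ′ → TRen (σ ∷ Γ) (σ ∷ Γ′)
liftᵗ ξ (here p)  = here p
liftᵗ ξ (there x) = there (ξ x)

renₑ : SRen Δ Δ′ → Exp Δ → Exp Δ′
renₑ s (svar i) = svar (s i)
renₑ s zeroₑ    = zeroₑ
renₑ s oneₑ     = oneₑ
renₑ s -oneₑ    = -oneₑ
renₑ s (E ⊞ F)  = renₑ s E ⊞ renₑ s F
renₑ s (E ⊟ F)  = renₑ s E ⊟ renₑ s F

renₜ : SRen Δ Δ′ → TRen Γ Γ′ → Tm Δ Γ τ → Tm Δ′ Γ′ τ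
renₜ s ξ (ident x)    = ident (ξ x)
renₜ s ξ (ƛᵥ M)       = ƛᵥ (renₜ (lift 1 s) ξ M)
renₜ s ξ (M ·ᵥ E)     = renₜ s ξ M ·ᵥ renₑ s E
renₜ s ξ (ƛₜ M)       = ƛₜ (renₜ s (liftᵗ ξ) M)
renₜ s ξ (M ·ₜ N)     = renₜ s ξ M ·ₜ renₜ s ξ N
renₜ s ξ (fix M)      = fix (renₜ s ξ M)
renₜ s ξ (if E ≟ F then M else N) = if renₑ s E ≟ renₑ s F then renₜ s ξ M else renₜ s ξ N
renₜ s ξ (M ⨾ N)      = renₜ s ξ M ⨾ renₜ s ξ N
renₜ s ξ (letnew M)   = letnew (renₜ (lift 1 s) ξ M)
renₜ s ξ (free E)     = free (renₑ s E)
renₜ s ξ (letget E f M) = letget (renₑ s E) f (renₜ (lift 1 s) ξ M)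
renₜ s ξ (E ∙ f ≔ F)  = renₑ s E ∙ f ≔ renₑ s F

renₐ : SRen Δ Δ′ → Asn Δ → Asn Δ′
renₐ s (E ≐ᵃ F)    = renₑ s E ≐ᵃ renₑ s F
renₐ s (E ≤ᵃ F)    = renₑ s E ≤ᵃ renₑ s F
renₐ s (E ↦ F , G) = renₑ s E ↦ renₑ s F , renₑ s G
renₐ s emp         = emp
renₐ s (P ∗ Q)     = renₐ s P ∗ renₐ s Q
renₐ s (P ∧ᵃ Q)    = renₐ s P ∧ᵃ renₐ s Q
renₐ s (¬ᵃ P)      = ¬ᵃ renₐ s P
renₐ s (∃ᵃ P)      = ∃ᵃ renₐ (lift 1 s) P

renₛ : SRen Δ Δ′ → TRen Γ Γ′ → Spec Δ Γ → Spec Δ′ Γ′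
renₛ s ξ (⟪ P ⟫ M ⟪ Q ⟫) = ⟪ renₐ s P ⟫ renₜ s ξ M ⟪ renₐ s Q ⟫
renₛ s ξ (φ ⊗ P)    = renₛ s ξ φ ⊗ renₐ s P
renₛ s ξ (E ≐ₑ F)   = renₑ s E ≐ₑ renₑ s F
renₛ s ξ (M ≐ₜ N)   = renₜ s ξ M ≐ₜ renₜ s ξ N
renₛ s ξ (φ ∧ˢ ψ)   = renₛ s ξ φ ∧ˢ renₛ s ξ ψ
renₛ s ξ (φ ∨ˢ ψ)   = renₛ s ξ φ ∨ˢ renₛ s ξ ψ
renₛ s ξ (φ ⇒ˢ ψ)   = renₛ s ξ φ ⇒ˢ renₛ s ξ ψ
renₛ s ξ (∀ₜ τ φ)   = ∀ₜ τ (renₛ s (liftᵗ ξ) φ)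
renₛ s ξ (∃ₜ τ φ)   = ∃ₜ τ (renₛ s (liftᵗ ξ) φ)
renₛ s ξ (∀ᵥ φ)     = ∀ᵥ (renₛ (lift 1 s) ξ φ)
renₛ s ξ (∃ᵥ φ)     = ∃ᵥ (renₛ (lift 1 s) ξ φ)

-- Weakening by a stack variable (↑) and by an identifier (⇑).

↑ₑ : Exp Δ → Exp (suc Δ)
↑ₑ = renₑ suc

↑ₐ : Asn Δ → Asn (suc Δ)
↑ₐ = renₐ suc

↑ₜ : Tm Δ Γ τ → Tm (suc Δ) Γ τ
↑ₜ = renₜ suc id

↑ₛ : Spec Δ Γ → Spec (suc Δ) Γ
↑ₛ = renₛ suc id

⇑ₜ : Tm Δ Γ τ → Tm Δ (σ ∷ Γ) τ
⇑ₜ = renₜ id there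

⇑ₛ : Spec Δ Γ → Spec Δ (σ ∷ Γ)
⇑ₛ = renₛ id there

SSub : ℕ → ℕ → Set
SSub Δ Δ′ = Fin Δ → Exp Δ′

TSub : ℕ → TyEnv → TyEnv → Set
TSub Δ′ Γ Γ′ = ∀ {τ} → τ ∈ Γ → Tm Δ′ Γ′ τ

extˢ : SSub Δ Δ′ → SSub (suc Δ) (suc Δ′)
extˢ s zero    = svar zero
extˢ s (suc i) = ↑ₑ (s i)

extᵗ : TSub Δ Γ Γ′ → TSub Δ (σ ∷ Γ) (σ ∷ Γ′)
extᵗ t (here p)  = ident (here p)
extᵗ t (there x) = ⇑ₜ (t x)

subₑ : SSub Δ Δ′ → Exp Δ → Exp Δ′
subₑ s (svar i) = s i
subₑ s zeroₑ    = zeroₑ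
subₑ s oneₑ     = oneₑ
subₑ s -oneₑ    = -oneₑ
subₑ s (E ⊞ F)  = subₑ s E ⊞ subₑ s F
subₑ s (E ⊟ F)  = subₑ s E ⊟ subₑ s F

subₜ : SSub Δ Δ′ → TSub Δ′ Γ Γ′ → Tm Δ Γ τ → Tm Δ′ Γ′ τ
subₜ s t (ident x)    = t x
subₜ s t (ƛᵥ M)       = ƛᵥ (subₜ (extˢ s) (↑ₜ ∘ t) M)
subₜ s t (M ·ᵥ E)     = subₜ s t M ·ᵥ subₑ s E
subₜ s t (ƛₜ M)       = ƛₜ (subₜ s (extᵗ t) M)
subₜ s t (M ·ₜ N)     = subₜ s t M ·ₜ subₜ s t N
subₜ s t (fix M)      = fix (subₜ s t M)
subₜ s t (if E ≟ F then M else N) = if subₑ s E ≟ subₑ s F then subₜ s t M else subₜ s t N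
subₜ s t (M ⨾ N)      = subₜ s t M ⨾ subₜ s t N
subₜ s t (letnew M)   = letnew (subₜ (extˢ s) (↑ₜ ∘ t) M)
subₜ s t (free E)     = free (subₑ s E)
subₜ s t (letget E f M) = letget (subₑ s E) f (subₜ (extˢ s) (↑ₜ ∘ t) M)
subₜ s t (E ∙ f ≔ F)  = subₑ s E ∙ f ≔ subₑ s F

subₐ : SSub Δ Δ′ → Asn Δ → Asn Δ′
subₐ s (E ≐ᵃ F)    = subₑ s E ≐ᵃ subₑ s F
subₐ s (E ≤ᵃ F)    = subₑ s E ≤ᵃ subₑ s F
subₐ s (E ↦ F , G) = subₑ s E ↦ subₑ s F , subₑ s G
subₐ s emp         = emp
subₐ s (P ∗ Q)     = subₐ s P ∗ subₐ s Q
subₐ s (P ∧ᵃ Q)    = subₐ s P ∧ᵃ subₐ s Q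
subₐ s (¬ᵃ P)      = ¬ᵃ subₐ s P
subₐ s (∃ᵃ P)      = ∃ᵃ subₐ (extˢ s) P

subₛ : SSub Δ Δ′ → TSub Δ′ Γ Γ′ → Spec Δ Γ → Spec Δ′ Γ′
subₛ s t (⟪ P ⟫ M ⟪ Q ⟫) = ⟪ subₐ s P ⟫ subₜ s t M ⟪ subₐ s Q ⟫
subₛ s t (φ ⊗ P)    = subₛ s t φ ⊗ subₐ s P
subₛ s t (E ≐ₑ F)   = subₑ s E ≐ₑ subₑ s F
subₛ s t (M ≐ₜ N)   = subₜ s t M ≐ₜ subₜ s t N
subₛ s t (φ ∧ˢ ψ)   = subₛ s t φ ∧ˢ subₛ s t ψ
subₛ s t (φ ∨ˢ ψ)   = subₛ s t φ ∨ˢ subₛ s t ψ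
subₛ s t (φ ⇒ˢ ψ)   = subₛ s t φ ⇒ˢ subₛ s t ψ
subₛ s t (∀ₜ τ φ)   = ∀ₜ τ (subₛ s (extᵗ t) φ)
subₛ s t (∃ₜ τ φ)   = ∃ₜ τ (subₛ s (extᵗ t) φ)
subₛ s t (∀ᵥ φ)     = ∀ᵥ (subₛ (extˢ s) (↑ₜ ∘ t) φ)
subₛ s t (∃ᵥ φ)     = ∃ᵥ (subₛ (extˢ s) (↑ₜ ∘ t) φ)

sub₀ᵛ : Exp Δ → SSub (suc Δ) Δ
sub₀ᵛ E zero    = E
sub₀ᵛ E (suc i) = svar i

sub₀ᵗ : Tm Δ Γ σ → TSub Δ (σ ∷ Γ) Γ
sub₀ᵗ M (here refl) = M
sub₀ᵗ M (there x)   = ident x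

-- φ [ E /i] and φ [ M /x] replace the most recently bound variable.

_[_/i] : Spec (suc Δ) Γ → Exp Δ → Spec Δ Γ
φ [ E /i] = subₛ (sub₀ᵛ E) ident φ

_[_/x] : Spec Δ (σ ∷ Γ) → Tm Δ Γ σ → Spec Δ Γ
φ [ M /x] = subₛ svar (sub₀ᵗ M) φ

_∨ᵃ_ : Asn Δ → Asn Δ → Asn Δ
P ∨ᵃ Q = ¬ᵃ (¬ᵃ P ∧ᵃ ¬ᵃ Q)

_≠ᵃ_ : Exp Δ → Exp Δ → Asn Δ
E ≠ᵃ F = ¬ᵃ (E ≐ᵃ F)

_↦- : Exp Δ → Asn Δ
E ↦- = ∃ᵃ ∃ᵃ (↑ₑ (↑ₑ E) ↦ svar (suc zero) , svar zero)

_↦-,_ : Exp Δ → Exp Δ → Asn Δ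
E ↦-, E₁ = ∃ᵃ (↑ₑ E ↦ svar zero , ↑ₑ E₁)

-- Contexts for fixed-point induction.  σ is the type of the hole; the
-- term put in the hole lives outside all binders of the context and is
-- weakened on the way in, so insertion never captures.

data TmCtx (σ : Ty) (Δ : ℕ) (Γ : TyEnv) : Ty → Set where
  hole : TmCtx σ Δ Γ σ
  ƛᵥ   : TmCtx σ (suc Δ) Γ τ → TmCtx σ Δ Γ (val⇒ τ)
  _·ᵥ_ : TmCtx σ Δ Γ (val⇒ τ) → Exp Δ → TmCtx σ Δ Γ τ
  ƛₜ   : TmCtx σ Δ (τ ∷ Γ) τ′ → TmCtx σ Δ Γ (τ ⇒ τ′)
  _·ₜ_ : TmCtx σ Δ Γ (τ ⇒ τ′) → Tm Δ Γ τ → TmCtx σ Δ Γ τ′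
  fix  : TmCtx σ Δ Γ (τ ⇒ τ) → TmCtx σ Δ Γ τ
  _⨾_  : TmCtx σ Δ Γ com → Tm Δ Γ com → TmCtx σ Δ Γ com

data SpecCtx (σ : Ty) (Δ : ℕ) (Γ : TyEnv) : Set where
  ⟪_⟫_⟪_⟫ : Asn Δ → TmCtx σ Δ Γ com → Asn Δ → SpecCtx σ Δ Γ
  _∧ˢ_    : SpecCtx σ Δ Γ → SpecCtx σ Δ Γ → SpecCtx σ Δ Γ
  ∀ₜ      : (τ : Ty) → SpecCtx σ Δ (τ ∷ Γ) → SpecCtx σ Δ Γ
  ∀ᵥ      : SpecCtx σ (suc Δ) Γ → SpecCtx σ Δ Γ

fillₜ : TmCtx σ Δ Γ τ → Tm Δ Γ σ → Tm Δ Γ τ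
fillₜ hole     N = N
fillₜ (ƛᵥ C)   N = ƛᵥ (fillₜ C (↑ₜ N))
fillₜ (C ·ᵥ E) N = fillₜ C N ·ᵥ E
fillₜ (ƛₜ C)   N = ƛₜ (fillₜ C (⇑ₜ N))
fillₜ (C ·ₜ M) N = fillₜ C N ·ₜ M
fillₜ (fix C)  N = fix (fillₜ C N)
fillₜ (C ⨾ M)  N = fillₜ C N ⨾ M

fillₛ : SpecCtx σ Δ Γ → Tm Δ Γ σ → Spec Δ Γ
fillₛ (⟪ P ⟫ C ⟪ Q ⟫) N = ⟪ P ⟫ fillₜ C N ⟪ Q ⟫
fillₛ (γ ∧ˢ δ) N = fillₛ γ N ∧ˢ fillₛ δ N
fillₛ (∀ₜ τ γ) N = ∀ₜ τ (fillₛ γ (⇑ₜ N))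
fillₛ (∀ᵥ γ)   N = ∀ᵥ (fillₛ γ (↑ₜ N))

renᶜ : SRen Δ Δ′ → TRen Γ Γ′ → TmCtx σ Δ Γ τ → TmCtx σ Δ′ Γ′ τ
renᶜ s ξ hole     = hole
renᶜ s ξ (ƛᵥ C)   = ƛᵥ (renᶜ (lift 1 s) ξ C)
renᶜ s ξ (C ·ᵥ E) = renᶜ s ξ C ·ᵥ renₑ s E
renᶜ s ξ (ƛₜ C)   = ƛₜ (renᶜ s (liftᵗ ξ) C)
renᶜ s ξ (C ·ₜ M) = renᶜ s ξ C ·ₜ renₜ s ξ M
renᶜ s ξ (fix C)  = fix (renᶜ s ξ C)
renᶜ s ξ (C ⨾ M)  = renᶜ s ξ C ⨾ renₜ s ξ M

renˢᶜ : SRen Δ Δ′ → TRen Γ Γ′ → SpecCtx σ Δ Γ → SpecCtx σ Δ′ Γ′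
renˢᶜ s ξ (⟪ P ⟫ C ⟪ Q ⟫) = ⟪ renₐ s P ⟫ renᶜ s ξ C ⟪ renₐ s Q ⟫
renˢᶜ s ξ (γ ∧ˢ δ) = renˢᶜ s ξ γ ∧ˢ renˢᶜ s ξ δ
renˢᶜ s ξ (∀ₜ τ γ) = ∀ₜ τ (renˢᶜ s (liftᵗ ξ) γ)
renˢᶜ s ξ (∀ᵥ γ)   = ∀ᵥ (renˢᶜ (lift 1 s) ξ γ)

⇑ˢᶜ : SpecCtx σ Δ Γ → SpecCtx σ Δ (τ ∷ Γ)
⇑ˢᶜ = renˢᶜ id there

-- Loc is an arbitrary countably infinite set.  The metatheory is classical:
-- excluded middle for small types is a parameter.  The definitions use it
-- only for lubs of chains in the flat cpo O, which do not exist constructively.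

module Semantics (Loc : Set) (Loc↔ℕ : Loc ↔ ℕ) (em : ExcludedMiddle 0ℓ) where

  private
    code : Loc → ℕ
    code = Inverse.to Loc↔ℕ

    bound : List Loc → ℕ
    bound = foldr (λ l n → code l ⊔ n) 0

    ≤-bound : ∀ {l L} → l ∈ L → code l ℕ.≤ bound L
    ≤-bound (here refl) = ℕ.m≤m⊔n _ _
    ≤-bound (there p)   = ℕ.≤-trans (≤-bound p) (ℕ.m≤n⊔m _ _)

  infix 4 _≟ˡ_

  opaque
    _≟ˡ_ : DecidableEquality Loc
    _≟ˡ_ = via-injection (↔⇒↣ Loc↔ℕ) ℕ._≟_

    fresh : List Loc → Loc
    fresh L = Inverse.from Loc↔ℕ (suc (bound L))

    fresh-∉ : ∀ L → fresh L ∉ L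
    fresh-∉ L p = ℕ.1+n≰n (subst (ℕ._≤ bound L) (Inverse.strictlyInverseˡ Loc↔ℕ _) (≤-bound p))

  record Perm : Set where
    no-eta-equality
    field
      bijection : Loc ↔ Loc
    open Inverse bijection public using (to; from; strictlyInverseˡ; strictlyInverseʳ)
    field
      finite : ∃[ L ] ∀ l → to l ≢ l → l ∈ L

  open Perm public using (to; from)

  infix 4 _≋_
  _≋_ : Perm → Perm → Set
  π ≋ π′ = ∀ l → to π l ≡ to π′ l

  _Fixes_ : Perm → List Loc → Set
  π Fixes L = ∀ {l} → l ∈ L → to π l ≡ l

  idₚ : Perm
  idₚ = record { bijection = ↔-id Loc ; finite = [] , λ l l≢l → contradiction refl l≢l }

  infixr 9 _∘ₚ_
  _∘ₚ_ : Perm → Perm → Perm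
  π ∘ₚ π′ = record
    { bijection = Perm.bijection π ↔-∘ Perm.bijection π′
    ; finite    = proj₁ (Perm.finite π′) ++ proj₁ (Perm.finite π) , fin
    }
    where
    fin : ∀ l → to π (to π′ l) ≢ l → l ∈ proj₁ (Perm.finite π′) ++ proj₁ (Perm.finite π)
    fin l ≢l with to π′ l ≟ˡ l
    ... | no  q = ∈-++⁺ˡ (proj₂ (Perm.finite π′) l q)
    ... | yes q = ∈-++⁺ʳ (proj₁ (Perm.finite π′))
                    (proj₂ (Perm.finite π) l λ e → ≢l (trans (cong (to π) q) e))

  infix 10 _⁻¹
  _⁻¹ : Perm → Perm
  π ⁻¹ = record
    { bijection = ↔-sym (Perm.bijection π)
    ; finite    = proj₁ (Perm.finite π)
                , λ l ≢l → proj₂ (Perm.finite π) l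
                    λ e → ≢l (trans (cong (from π) (sym e)) (Perm.strictlyInverseʳ π l))
    }

  π∘π⁻¹ : ∀ π → π ∘ₚ π ⁻¹ ≋ idₚ
  π∘π⁻¹ π = Perm.strictlyInverseˡ π

  π⁻¹∘π : ∀ π → π ⁻¹ ∘ₚ π ≋ idₚ
  π⁻¹∘π π = Perm.strictlyInverseʳ π

  ⁻¹-cong : ∀ {π π′} → π ≋ π′ → π ⁻¹ ≋ π′ ⁻¹
  ⁻¹-cong {π} {π′} e l =
    trans (cong (from π) (sym (Perm.strictlyInverseˡ π′ l)))
      (trans (cong (from π) (sym (e (from π′ l)))) (Perm.strictlyInverseʳ π _))

  Fixes-++ˡ : ∀ {π} {L L′} → π Fixes (L ++ L′) → π Fixes L
  Fixes-++ˡ f p = f (∈-++⁺ˡ p)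

  Fixes-++ʳ : ∀ {π} L {L′} → π Fixes (L ++ L′) → π Fixes L′
  Fixes-++ʳ L f p = f (∈-++⁺ʳ L p)

  Fixes-⁻¹ : ∀ {π L} → π Fixes L → (π ⁻¹) Fixes L
  Fixes-⁻¹ {π} f p = trans (cong (from π) (sym (f p))) (Perm.strictlyInverseʳ π _)

  Fixes-conj : ∀ {π σ L} → σ Fixes map (to π) L → (π ⁻¹ ∘ₚ σ ∘ₚ π) Fixes L
  Fixes-conj {π} f p =
    trans (cong (from π) (f (∈-map⁺ (to π) p))) (Perm.strictlyInverseʳ π _)

  swap : Loc → Loc → Perm
  swap a b = record
    { bijection = record
      { to = sw ; from = sw ; to-cong = cong sw ; from-cong = cong sw
      ; inverse = (λ { refl → sw-sw _ }) , (λ { refl → sw-sw _ })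
      }
    ; finite = a ∷ b ∷ [] , fin
    }
    where
    sw : Loc → Loc
    sw l with l ≟ˡ a
    ... | yes _ = b
    ... | no  _ with l ≟ˡ b
    ...   | yes _ = a
    ...   | no  _ = l

    sw-a : sw a ≡ b
    sw-a with a ≟ˡ a
    ... | yes _ = refl
    ... | no ¬p = contradiction refl ¬p

    sw-b : sw b ≡ a
    sw-b with b ≟ˡ a
    ... | yes b≡a = b≡a
    ... | no  _ with b ≟ˡ b
    ...   | yes _ = refl
    ...   | no ¬p = contradiction refl ¬p

    sw-sw : ∀ l → sw (sw l) ≡ l
    sw-sw l with l ≟ˡ a
    ... | yes refl = sw-b
    ... | no  l≢a with l ≟ˡ b
    ...   | yes refl = sw-a
    ...   | no  l≢b with l ≟ˡ a
    ...     | yes l≡a = contradiction l≡a l≢a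
    ...     | no  _ with l ≟ˡ b
    ...       | yes l≡b = contradiction l≡b l≢b
    ...       | no  _ = refl

    fin : ∀ l → sw l ≢ l → l ∈ a ∷ b ∷ []
    fin l ≢l with l ≟ˡ a
    ... | yes p = here p
    ... | no  _ with l ≟ˡ b
    ...   | yes p = there (here p)
    ...   | no  _ = contradiction refl ≢l

  swap-a : ∀ a b → to (swap a b) a ≡ b
  swap-a a b with a ≟ˡ a
  ... | yes _ = refl
  ... | no ¬p = contradiction refl ¬p

  swap-Fixes : ∀ {a b L} → a ∉ L → b ∉ L → swap a b Fixes L
  swap-Fixes {a} {b} a∉ b∉ {l} p with l ≟ˡ a
  ... | yes refl = contradiction p a∉
  ... | no  _ with l ≟ˡ b
  ...   | yes refl = contradiction p b∉
  ...   | no  _ = refl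

  -- Equality is setoid equality and Perm is taken up to _≋_, so the action
  -- has to respect both.  An element carries some finite support, not
  -- necessarily its smallest one; equality ignores which.

  record IsFMSet (S : Setoid 0ℓ 0ℓ)
                 (_·_ : Perm → Setoid.Carrier S → Setoid.Carrier S) : Set where
    open Setoid S
    field
      ·-cong : ∀ {π π′ a b} → π ≋ π′ → a ≈ b → (π · a) ≈ (π′ · b)
      ·-id   : ∀ a → (idₚ · a) ≈ a
      ·-∘    : ∀ π π′ a → (π · (π′ · a)) ≈ ((π ∘ₚ π′) · a)

    _supports_ : List Loc → Carrier → Set
    L supports a = ∀ π → π Fixes L → (π · a) ≈ a

    field
      finSupp : ∀ a → ∃[ L ] L supports a

  record FMSet : Set₁ where
    no-eta-equality
    infixr 9 _·_
    field
      setoid  : Setoid 0ℓ 0ℓ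
      _·_     : Perm → Setoid.Carrier setoid → Setoid.Carrier setoid
      isFMSet : IsFMSet setoid _·_

  record FMPoset : Set₁ where
    no-eta-equality
    infixr 9 _·_
    field
      poset   : Poset 0ℓ 0ℓ 0ℓ
      _·_     : Perm → Poset.Carrier poset → Poset.Carrier poset
      isFMSet : IsFMSet (Poset.Eq.setoid poset) _·_
    open Poset poset public
      using (Carrier; _≈_; module Eq)
      renaming (_≤_ to _⊑_; refl to ⊑-refl; reflexive to ⊑-reflexive; trans to ⊑-trans; antisym to ⊑-antisym)
    open IsFMSet isFMSet public
    field
      ·-mono : ∀ π {a b} → a ⊑ b → π · a ⊑ π · b

    supp : Carrier → List Loc
    supp a = proj₁ (finSupp a)

    record Chain : Set where
      field
        seq       : ℕ → Carrier
        ascending : ∀ n → seq n ⊑ seq (suc n)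
        support   : List Loc
        supported : ∀ n → support supports seq n

    IsLub : (ℕ → Carrier) → Carrier → Set
    IsLub c a = (∀ n → c n ⊑ a) × (∀ b → (∀ n → c n ⊑ b) → a ⊑ b)

    π·π⁻¹· : ∀ π a → π · π ⁻¹ · a ≈ a
    π·π⁻¹· π a = Eq.trans (·-∘ π (π ⁻¹) a) (Eq.trans (·-cong (π∘π⁻¹ π) Eq.refl) (·-id a))

    π⁻¹·π· : ∀ π a → π ⁻¹ · π · a ≈ a
    π⁻¹·π· π a = Eq.trans (·-∘ (π ⁻¹) π a) (Eq.trans (·-cong (π⁻¹∘π π) Eq.refl) (·-id a))

    ·-cong₂ : ∀ π {a b} → a ≈ b → π · a ≈ π · b
    ·-cong₂ π = ·-cong (λ _ → refl)

    supports-· : ∀ {L a} π → L supports a → map (to π) L supports (π · a)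
    supports-· {L} {a} π s σ f =
      Eq.trans (·-∘ σ π a)
      (Eq.trans (·-cong (λ l → sym (Perm.strictlyInverseˡ π _)) Eq.refl)
      (Eq.trans (Eq.sym (·-∘ π (π ⁻¹ ∘ₚ σ ∘ₚ π) a))
        (·-cong₂ π (s (π ⁻¹ ∘ₚ σ ∘ₚ π) (Fixes-conj {π} {σ} f)))))

    ascending-≤ : (c : Chain) → ∀ {m n} → m ℕ.≤ n → Chain.seq c m ⊑ Chain.seq c n
    ascending-≤ c {m} m≤n = go (ℕ.≤⇒≤′ m≤n)
      where
      go : ∀ {n} → m ℕ.≤′ n → Chain.seq c m ⊑ Chain.seq c n
      go (ℕ.≤′-reflexive refl) = ⊑-refl
      go (ℕ.≤′-step p)         = ⊑-trans (go p) (Chain.ascending c _)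

    ·-chain : Perm → Chain → Chain
    ·-chain π c = record
      { seq       = λ n → π · Chain.seq c n
      ; ascending = λ n → ·-mono π (Chain.ascending c n)
      ; support   = map (to π) (Chain.support c)
      ; supported = λ n → supports-· π (Chain.supported c n)
      }

    ·-lub : ∀ π {c a} → IsLub c a → IsLub (λ n → π · c n) (π · a)
    ·-lub π {c} {a} (ub , least) =
      (λ n → ·-mono π (ub n)) ,
      λ b h → ⊑-trans
        (·-mono π (least (π ⁻¹ · b)
          λ n → ⊑-trans (⊑-reflexive (Eq.sym (π⁻¹·π· π (c n)))) (·-mono (π ⁻¹) (h n))))
        (⊑-reflexive (π·π⁻¹· π b))

    IsLub-unique : ∀ {c a b} → IsLub c a → IsLub c b → a ≈ b
    IsLub-unique (ub , l) (ub′ , l′) = ⊑-antisym (l _ ub′) (l′ _ ub)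

    IsLub-resp : ∀ {c d a b} → (∀ n → c n ≈ d n) → a ≈ b → IsLub c a → IsLub d b
    IsLub-resp e a≈b (ub , l) =
      (λ n → ⊑-trans (⊑-reflexive (Eq.sym (e n))) (⊑-trans (ub n) (⊑-reflexive a≈b))) ,
      λ x h → ⊑-trans (⊑-reflexive (Eq.sym a≈b)) (l x λ n → ⊑-trans (⊑-reflexive (e n)) (h n))

  record FMCpo : Set₁ where
    no-eta-equality
    field
      fmPoset : FMPoset
    open FMPoset fmPoset public
    field
      lub : (c : Chain) → ∃ (IsLub (Chain.seq c))

  ∣_∣ : FMCpo → Set
  ∣ D ∣ = FMCpo.Carrier D

  record IsContinuous (A B : FMCpo) (f : ∣ A ∣ → ∣ B ∣) : Set where
    private
      module A = FMCpo A
      module B = FMCpo B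
    field
      mono : ∀ {a b} → a A.⊑ b → f a B.⊑ f b
      pres : ∀ (c : A.Chain) {a} → A.IsLub (A.Chain.seq c) a → B.IsLub (f ∘ A.Chain.seq c) (f a)

    resp : ∀ {a b} → a A.≈ b → f a B.≈ f b
    resp e = B.⊑-antisym (mono (A.⊑-reflexive e)) (mono (A.⊑-reflexive (A.Eq.sym e)))

  -- L supports f for the action (π · f)(a) = π · f(π⁻¹ · a).
  SupportsFun : (A B : FMCpo) → List Loc → (∣ A ∣ → ∣ B ∣) → Set
  SupportsFun A B L f = ∀ π → π Fixes L → ∀ a → π B.· f (π ⁻¹ A.· a) B.≈ f a
    where
    module A = FMCpo A
    module B = FMCpo B

  infix 1 _⟶_
  record _⟶_ (A B : FMCpo) : Set where
    no-eta-equality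
    private
      module A = FMCpo A
      module B = FMCpo B
    field
      fun          : ∣ A ∣ → ∣ B ∣
      isContinuous : IsContinuous A B fun
      equivariant  : ∀ π a → fun (π A.· a) B.≈ π B.· fun a
    open IsContinuous isContinuous public

    supportsFun : SupportsFun A B [] fun
    supportsFun π _ a = B.Eq.trans (B.Eq.sym (equivariant π _)) (resp (A.π·π⁻¹· π a))

  open _⟶_ public using (fun)

  -- Elements of the exponential A → B.
  record Fun (A B : FMCpo) : Set where
    no-eta-equality
    infixl 8 _⟨$⟩_
    field
      _⟨$⟩_         : ∣ A ∣ → ∣ B ∣
      isContinuous : IsContinuous A B _⟨$⟩_
      finSupport   : ∃[ L ] SupportsFun A B L _⟨$⟩_
    open IsContinuous isContinuous public

  open Fun public using (_⟨$⟩_)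

  supports-$ : ∀ A B {L K f a} → SupportsFun A B L f →
               (∀ {a b} → FMCpo._≈_ A a b → FMCpo._≈_ B (f a) (f b)) →
               FMCpo._supports_ A K a → FMCpo._supports_ B (L ++ K) (f a)
  supports-$ A B {L} {K} {f} {a} sf rf sa π fx =
    B.Eq.trans
      (B.·-cong₂ π (rf (A.Eq.sym (sa (π ⁻¹) (Fixes-⁻¹ {π} (Fixes-++ʳ {π} L fx))))))
      (sf π (Fixes-++ˡ {π} fx) a)
    where
    module A = FMCpo A
    module B = FMCpo B

  map-chain : ∀ A B {L f} → IsContinuous A B f → SupportsFun A B L f →
              FMCpo.Chain A → FMCpo.Chain B
  map-chain A B {L} {f} fc sf c = record
    { seq       = f ∘ C.seq
    ; ascending = λ n → mono (C.ascending n)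
    ; support   = L ++ C.support
    ; supported = λ n → supports-$ A B sf resp (C.supported n)
    }
    where
    module C = FMCpo.Chain A c
    open IsContinuous fc

  discrete : FMSet → FMCpo
  discrete S .FMCpo.fmPoset = D
    where
    module S = FMSet S
    D : FMPoset
    D .FMPoset.poset   = SetoidProperties.≈-poset S.setoid
    D .FMPoset._·_     = S._·_
    D .FMPoset.isFMSet = S.isFMSet
    D .FMPoset.·-mono  = λ π e → IsFMSet.·-cong S.isFMSet (λ _ → refl) e
  discrete S .FMCpo.lub c = Chain.seq c 0 , constant , λ b h → h 0
    where
    open FMPoset (FMCpo.fmPoset (discrete S))
    constant : ∀ n → Chain.seq c n ≈ Chain.seq c 0
    constant zero    = Eq.refl
    constant (suc n) = Eq.trans (Eq.sym (Chain.ascending c n)) (constant n)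

  unitˢ : FMSet
  unitˢ .FMSet.setoid  = ≡.setoid ⊤
  unitˢ .FMSet._·_     = λ _ x → x
  unitˢ .FMSet.isFMSet = record
    { ·-cong = λ _ e → e ; ·-id = λ _ → refl ; ·-∘ = λ _ _ _ → refl
    ; finSupp = λ _ → [] , λ _ _ → refl }

  𝟙 : FMCpo
  𝟙 = discrete unitˢ

  module _ (A B : FMCpo) where
    private
      module A = FMCpo A
      module B = FMCpo B

    ×-FMPoset : FMPoset
    ×-FMPoset .FMPoset.poset   = ×-poset A.poset B.poset
    ×-FMPoset .FMPoset._·_     = λ π (a , b) → π A.· a , π B.· b
    ×-FMPoset .FMPoset.isFMSet = record
      { ·-cong  = λ e (p , q) → A.·-cong e p , B.·-cong e q
      ; ·-id    = λ (a , b) → A.·-id a , B.·-id b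
      ; ·-∘     = λ π π′ (a , b) → A.·-∘ π π′ a , B.·-∘ π π′ b
      ; finSupp = λ (a , b) → A.supp a ++ B.supp b ,
          λ π f → proj₂ (A.finSupp a) π (Fixes-++ˡ {π} f)
                , proj₂ (B.finSupp b) π (Fixes-++ʳ {π} (A.supp a) f)
      }
    ×-FMPoset .FMPoset.·-mono  = λ π (p , q) → A.·-mono π p , B.·-mono π q

    private module P = FMPoset ×-FMPoset

    chain-π₁ : P.Chain → A.Chain
    chain-π₁ c = record
      { seq = proj₁ ∘ P.Chain.seq c ; ascending = proj₁ ∘ P.Chain.ascending c
      ; support = P.Chain.support c ; supported = λ n π f → proj₁ (P.Chain.supported c n π f) }

    chain-π₂ : P.Chain → B.Chain
    chain-π₂ c = record
      { seq = proj₂ ∘ P.Chain.seq c ; ascending = proj₂ ∘ P.Chain.ascending c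
      ; support = P.Chain.support c ; supported = λ n π f → proj₂ (P.Chain.supported c n π f) }

    IsLub-π₁ : ∀ {c p} → P.IsLub c p → A.IsLub (proj₁ ∘ c) (proj₁ p)
    IsLub-π₁ (ub , l) = proj₁ ∘ ub , λ a h → proj₁ (l (a , _) λ n → h n , proj₂ (ub n))

    IsLub-π₂ : ∀ {c p} → P.IsLub c p → B.IsLub (proj₂ ∘ c) (proj₂ p)
    IsLub-π₂ (ub , l) = proj₂ ∘ ub , λ b h → proj₂ (l (_ , b) λ n → proj₁ (ub n) , h n)

    IsLub-pair : ∀ {c d a b} → A.IsLub c a → B.IsLub d b → P.IsLub (λ n → c n , d n) (a , b)
    IsLub-pair (ub , l) (ub′ , l′) =
      (λ n → ub n , ub′ n) , λ (a , b) h → l a (proj₁ ∘ h) , l′ b (proj₂ ∘ h)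

  infixr 3 _×ᶜ_
  _×ᶜ_ : FMCpo → FMCpo → FMCpo
  (A ×ᶜ B) .FMCpo.fmPoset = ×-FMPoset A B
  (A ×ᶜ B) .FMCpo.lub c   =
    let a , la = FMCpo.lub A (chain-π₁ A B c)
        b , lb = FMCpo.lub B (chain-π₂ A B c)
    in (a , b) , IsLub-pair A B la lb

  module _ (A B : FMCpo) where
    private
      module A = FMCpo A
      module B = FMCpo B

    ·-Fun : Perm → Fun A B → Fun A B
    ·-Fun π f = record
      { _⟨$⟩_        = λ a → π B.· (f ⟨$⟩ (π ⁻¹ A.· a))
      ; isContinuous = record
        { mono = λ p → B.·-mono π (Fun.mono f (A.·-mono (π ⁻¹) p))
        ; pres = λ c l → B.·-lub π (Fun.pres f (A.·-chain (π ⁻¹) c) (A.·-lub (π ⁻¹) l))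
        }
      ; finSupport   = map (to π) L , sup
      }
      where
      L = proj₁ (Fun.finSupport f)
      sup : SupportsFun A B (map (to π) L) (λ a → π B.· (f ⟨$⟩ (π ⁻¹ A.· a)))
      sup σ fx a =
        B.Eq.trans (B.·-∘ σ π _)
        (B.Eq.trans (B.·-cong (λ l → sym (Perm.strictlyInverseˡ π _))
           (Fun.resp f
             (A.Eq.trans (A.·-∘ (π ⁻¹) (σ ⁻¹) a)
             (A.Eq.trans (A.·-cong (λ l → cong (λ x → from π (from σ x)) (sym (Perm.strictlyInverseˡ π l))) A.Eq.refl)
               (A.Eq.sym (A.·-∘ (κ ⁻¹) (π ⁻¹) a))))))
        (B.Eq.trans (B.Eq.sym (B.·-∘ π κ _))
          (B.·-cong₂ π (proj₂ (Fun.finSupport f) κ (Fixes-conj {π} {σ} fx) (π ⁻¹ A.· a)))))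
        where
        κ = π ⁻¹ ∘ₚ σ ∘ₚ π

    Fun-poset : Poset 0ℓ 0ℓ 0ℓ
    Fun-poset = record
      { Carrier = Fun A B
      ; _≈_     = λ f g → ∀ a → (f ⟨$⟩ a) B.≈ (g ⟨$⟩ a)
      ; _≤_     = λ f g → ∀ a → (f ⟨$⟩ a) B.⊑ (g ⟨$⟩ a)
      ; isPartialOrder = record
        { isPreorder = record
          { isEquivalence = record
            { refl  = λ _ → B.Eq.refl
            ; sym   = λ p a → B.Eq.sym (p a)
            ; trans = λ p q a → B.Eq.trans (p a) (q a)
            }
          ; reflexive = λ p a → B.⊑-reflexive (p a)
          ; trans     = λ p q a → B.⊑-trans (p a) (q a)
          }
        ; antisym = λ p q a → B.⊑-antisym (p a) (q a)
        }
      }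

    Fun-FMPoset : FMPoset
    Fun-FMPoset .FMPoset.poset   = Fun-poset
    Fun-FMPoset .FMPoset._·_     = ·-Fun
    Fun-FMPoset .FMPoset.isFMSet = record
        { ·-cong  = λ {π} {π′} {f} {g} e p a →
            B.·-cong e (B.Eq.trans (p _) (Fun.resp g (A.·-cong (⁻¹-cong {π} {π′} e) A.Eq.refl)))
        ; ·-id    = λ f a → B.Eq.trans (B.·-id _) (Fun.resp f (A.Eq.trans (A.·-cong {idₚ ⁻¹} {idₚ} (λ _ → refl) A.Eq.refl) (A.·-id a)))
        ; ·-∘     = λ π π′ f a →
            B.Eq.trans (B.·-∘ π π′ _)
              (B.·-cong₂ (π ∘ₚ π′)
                (Fun.resp f (A.Eq.trans (A.·-∘ (π′ ⁻¹) (π ⁻¹) a) (A.·-cong {π′ ⁻¹ ∘ₚ π ⁻¹} {(π ∘ₚ π′) ⁻¹} (λ _ → refl) A.Eq.refl))))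
        ; finSupp = Fun.finSupport
        }
    Fun-FMPoset .FMPoset.·-mono  = λ π p a → B.·-mono π (p _)

    private module F = FMPoset Fun-FMPoset

    chain-at : F.Chain → ∣ A ∣ → B.Chain
    chain-at c a = record
      { seq       = λ n → F.Chain.seq c n ⟨$⟩ a
      ; ascending = λ n → F.Chain.ascending c n a
      ; support   = F.Chain.support c ++ A.supp a
      ; supported = λ n → supports-$ A B (F.Chain.supported c n)
                            (Fun.resp (F.Chain.seq c n)) (proj₂ (A.finSupp a))
      }

    Fun-lub : F.Chain → Fun A B
    Fun-lub c = record
      { _⟨$⟩_        = ⨆
      ; isContinuous = record
        { mono = ⨆-mono
        ; pres = λ d {a} l →
            (λ n → ⨆-mono (proj₁ l n)) ,
            λ b h → proj₂ (⨆-lub a) b λ n →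
              proj₂ (Fun.pres (F.Chain.seq c n) d l) b λ m →
                B.⊑-trans (proj₁ (⨆-lub _) n) (h m)
        }
      ; finSupport   = F.Chain.support c , λ π fx a →
          B.IsLub-unique
            (B.IsLub-resp (λ n → F.Chain.supported c n π fx a) B.Eq.refl (B.·-lub π (⨆-lub _)))
            (⨆-lub a)
      }
      where
      ⨆ : ∣ A ∣ → ∣ B ∣
      ⨆ a = proj₁ (B.lub (chain-at c a))
      ⨆-lub : ∀ a → B.IsLub (λ n → F.Chain.seq c n ⟨$⟩ a) (⨆ a)
      ⨆-lub a = proj₂ (B.lub (chain-at c a))
      ⨆-mono : ∀ {a b} → a A.⊑ b → ⨆ a B.⊑ ⨆ b
      ⨆-mono p = proj₂ (⨆-lub _) _ λ n →
        B.⊑-trans (Fun.mono (F.Chain.seq c n) p) (proj₁ (⨆-lub _) n)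

    Fun-lub-IsLub : ∀ c → F.IsLub (F.Chain.seq c) (Fun-lub c)
    Fun-lub-IsLub c =
      (λ n a → proj₁ (proj₂ (B.lub (chain-at c a))) n) ,
      λ g h a → proj₂ (proj₂ (B.lub (chain-at c a))) (g ⟨$⟩ a) λ n → h n a

    IsLub-at : ∀ (c : F.Chain) {f} → F.IsLub (F.Chain.seq c) f →
               ∀ a → B.IsLub (λ n → F.Chain.seq c n ⟨$⟩ a) (f ⟨$⟩ a)
    IsLub-at c {f} l a =
      B.IsLub-resp (λ _ → B.Eq.refl) (F.IsLub-unique {F.Chain.seq c} {Fun-lub c} {f} (Fun-lub-IsLub c) l a)
        (proj₂ (B.lub (chain-at c a)))

    IsLub-pointwise : ∀ (c : ℕ → Fun A B) (f : Fun A B) →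
      (∀ a → B.IsLub (λ n → c n ⟨$⟩ a) (f ⟨$⟩ a)) → F.IsLub c f
    IsLub-pointwise c f h = (λ n a → proj₁ (h a) n) , λ g u a → proj₂ (h a) (g ⟨$⟩ a) λ n → u n a

  infixr 2 _⇛_
  _⇛_ : FMCpo → FMCpo → FMCpo
  (A ⇛ B) .FMCpo.fmPoset = Fun-FMPoset A B
  (A ⇛ B) .FMCpo.lub c   = Fun-lub A B c , Fun-lub-IsLub A B c

  idᴹ : ∀ {A} → A ⟶ A
  idᴹ {A} = record
    { fun = id ; isContinuous = record { mono = id ; pres = λ _ l → l }
    ; equivariant = λ _ _ → FMCpo.Eq.refl A }

  infixr 9 _∘ᴹ_
  _∘ᴹ_ : ∀ {A B C} → B ⟶ C → A ⟶ B → A ⟶ C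
  _∘ᴹ_ {A} {B} {C} g f = record
    { fun = fun g ∘ fun f
    ; isContinuous = record
      { mono = G.mono ∘ F.mono
      ; pres = λ c l → G.pres (map-chain A B F.isContinuous F.supportsFun c) (F.pres c l)
      }
    ; equivariant = λ π a → FMCpo.Eq.trans C (G.resp (F.equivariant π a)) (G.equivariant π _)
    }
    where
    module F = _⟶_ f
    module G = _⟶_ g

  ⟨_,_⟩ᴹ : ∀ {A B C} → A ⟶ B → A ⟶ C → A ⟶ (B ×ᶜ C)
  ⟨_,_⟩ᴹ {A} {B} {C} f g = record
    { fun = λ a → fun f a , fun g a
    ; isContinuous = record
      { mono = λ p → F.mono p , G.mono p
      ; pres = λ c l → IsLub-pair B C (F.pres c l) (G.pres c l)
      }
    ; equivariant = λ π a → F.equivariant π a , G.equivariant π a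
    }
    where
    module F = _⟶_ f
    module G = _⟶_ g

  π₁ᴹ : ∀ {A B} → (A ×ᶜ B) ⟶ A
  π₁ᴹ {A} {B} = record
    { fun = proj₁ ; isContinuous = record { mono = proj₁ ; pres = λ _ → IsLub-π₁ A B }
    ; equivariant = λ _ _ → FMCpo.Eq.refl A }

  π₂ᴹ : ∀ {A B} → (A ×ᶜ B) ⟶ B
  π₂ᴹ {A} {B} = record
    { fun = proj₂ ; isContinuous = record { mono = proj₂ ; pres = λ _ → IsLub-π₂ A B }
    ; equivariant = λ _ _ → FMCpo.Eq.refl B }

  !ᴹ : ∀ {A} → A ⟶ 𝟙
  !ᴹ = record
    { fun = λ _ → tt
    ; isContinuous = record { mono = λ _ → refl ; pres = λ _ _ → (λ _ → refl) , λ _ _ → refl }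
    ; equivariant = λ _ _ → refl }

  curryᴹ : ∀ {A B C} → (A ×ᶜ B) ⟶ C → A ⟶ (B ⇛ C)
  curryᴹ {A} {B} {C} f = record
    { fun = section
    ; isContinuous = record
      { mono = λ p b → F.mono (p , B.⊑-refl)
      ; pres = λ c {a} l → IsLub-pointwise B C (section ∘ A.Chain.seq c) (section a) λ b → F.pres
          (record { seq = λ n → A.Chain.seq c n , b
                  ; ascending = λ n → A.Chain.ascending c n , B.⊑-refl
                  ; support = A.Chain.support c ++ B.supp b
                  ; supported = λ n π fx → A.Chain.supported c n π (Fixes-++ˡ {π} fx)
                                         , proj₂ (B.finSupp b) π (Fixes-++ʳ {π} (A.Chain.support c) fx) })
          (IsLub-pair A B l ((λ _ → B.⊑-refl) , λ _ h → h 0))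
      }
    ; equivariant = λ π a b →
        C.Eq.trans (F.resp (A.Eq.refl , B.Eq.sym (B.π·π⁻¹· π b))) (F.equivariant π (a , _))
    }
    where
    module A = FMCpo A
    module B = FMCpo B
    module C = FMCpo C
    module F = _⟶_ f
    section : ∣ A ∣ → Fun B C
    section a = record
      { _⟨$⟩_ = λ b → fun f (a , b)
      ; isContinuous = record
        { mono = λ p → F.mono (A.⊑-refl , p)
        ; pres = λ c l → F.pres
            (record { seq = λ n → a , B.Chain.seq c n
                    ; ascending = λ n → A.⊑-refl , B.Chain.ascending c n
                    ; support = A.supp a ++ B.Chain.support c
                    ; supported = λ n π fx → proj₂ (A.finSupp a) π (Fixes-++ˡ {π} fx)
                                           , B.Chain.supported c n π (Fixes-++ʳ {π} (A.supp a) fx) })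
            (IsLub-pair A B ((λ _ → A.⊑-refl) , λ _ h → h 0) l)
        }
      ; finSupport = A.supp a , λ π fx b →
          C.Eq.trans (C.Eq.sym (F.equivariant π _))
            (F.resp (proj₂ (A.finSupp a) π fx , B.π·π⁻¹· π b))
      }

  evalᴹ : ∀ {A B} → ((A ⇛ B) ×ᶜ A) ⟶ B
  evalᴹ {A} {B} = record
    { fun = λ (f , a) → f ⟨$⟩ a
    ; isContinuous = record
      { mono = λ {(f , a)} {(g , b)} (p , q) → B.⊑-trans (Fun.mono f q) (p b)
      ; pres = pres
      }
    ; equivariant = λ π (f , a) → B.·-cong₂ π (Fun.resp f (A.π⁻¹·π· π a))
    }
    where
    module A = FMCpo A
    module B = FMCpo B
    module F = FMCpo (A ⇛ B)
    module P = FMCpo ((A ⇛ B) ×ᶜ A)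
    pres : ∀ (c : P.Chain) {p} → P.IsLub (P.Chain.seq c) p →
           B.IsLub (λ n → proj₁ (P.Chain.seq c n) ⟨$⟩ proj₂ (P.Chain.seq c n)) (proj₁ p ⟨$⟩ proj₂ p)
    pres c {f , a} l =
      (λ n → B.⊑-trans (Fun.mono (F.Chain.seq cf n) (proj₁ la n)) (proj₁ lf n a)) ,
      λ b h → proj₂ (IsLub-at A B cf {f} lf a) b λ m →
        proj₂ (Fun.pres (F.Chain.seq cf m) ca la) b λ n →
          B.⊑-trans (F.ascending-≤ cf (ℕ.m≤m⊔n m n) (A.Chain.seq ca n))
          (B.⊑-trans (Fun.mono (F.Chain.seq cf (m ⊔ n)) (A.ascending-≤ ca (ℕ.m≤n⊔m m n)))
            (h (m ⊔ n)))
      where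
      cf = chain-π₁ (A ⇛ B) A c
      ca = chain-π₂ (A ⇛ B) A c
      lf : F.IsLub (F.Chain.seq cf) f
      lf = IsLub-π₁ (A ⇛ B) A {P.Chain.seq c} {f , a} l
      la : A.IsLub (A.Chain.seq ca) a
      la = IsLub-π₂ (A ⇛ B) A {P.Chain.seq c} {f , a} l

  Discrete : FMCpo → Set
  Discrete X = ∀ {x y} → x ⊑ y → y ⊑ x
    where open FMCpo X

  discrete-× : ∀ {X Y} → Discrete X → Discrete Y → Discrete (X ×ᶜ Y)
  discrete-× dX dY (p , q) = dX p , dY q

  discreteᴹ : ∀ {X B} → Discrete X → (f : ∣ X ∣ → ∣ B ∣) →
              (∀ {x y} → FMCpo._⊑_ X x y → FMCpo._⊑_ B (f x) (f y)) →
              (∀ π x → FMCpo._≈_ B (f (FMCpo._·_ X π x)) (FMCpo._·_ B π (f x))) → X ⟶ B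
  discreteᴹ {X} {B} d f mono eqv = record
    { fun = f
    ; isContinuous = record
      { mono = mono
      ; pres = λ c l → (λ n → mono (proj₁ l n)) ,
               λ b h → FMCpo.⊑-trans B (mono (d (proj₁ l 0))) (h 0)
      }
    ; equivariant = eqv
    }

  -- A family of continuous functions indexed by a discrete FM-cpo.
  familyᴹ : ∀ {X A B} → Discrete X → (f : ∣ X ∣ → ∣ A ∣ → ∣ B ∣) →
            (∀ x → IsContinuous A B (f x)) →
            (∀ {x y} → FMCpo._≈_ X x y → ∀ a → FMCpo._≈_ B (f x a) (f y a)) →
            (∀ π x a → FMCpo._≈_ B (f (FMCpo._·_ X π x) (FMCpo._·_ A π a)) (FMCpo._·_ B π (f x a))) →
            (X ×ᶜ A) ⟶ B
  familyᴹ {X} {A} {B} d f fc fr eqv = record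
    { fun = λ (x , a) → f x a
    ; isContinuous = record
      { mono = λ {(x , a)} {(y , b)} (p , q) →
          B.⊑-trans (IsContinuous.mono (fc x) q) (B.⊑-reflexive (fr (X.⊑-antisym p (d p)) b))
      ; pres = λ c {(x , a)} l →
          let p = proj₁ (IsLub-π₁ X A l) in
          B.IsLub-resp (λ n → fr (X.⊑-antisym (d (p n)) (p n)) _) B.Eq.refl
            (IsContinuous.pres (fc x) (chain-π₂ X A c) (IsLub-π₂ X A l))
      }
    ; equivariant = λ π (x , a) → eqv π x a
    }
    where
    module X = FMCpo X
    module B = FMCpo B

  Pointed : FMCpo → Set
  Pointed D = ∃[ b ] ∀ d → b ⊑ d
    where open FMCpo D

  module _ {D : FMCpo} (⊥ᴰ : Pointed D) where
    private
      module D = FMCpo D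
      bot = proj₁ ⊥ᴰ
      bot-⊑ = proj₂ ⊥ᴰ

    bot-equivariant : ∀ π → (π D.· bot) D.≈ bot
    bot-equivariant π = D.⊑-antisym
      (D.⊑-trans (D.·-mono π (bot-⊑ _)) (D.⊑-reflexive (D.π·π⁻¹· π bot))) (bot-⊑ _)

    iterate : Fun D D → ℕ → ∣ D ∣
    iterate f zero    = bot
    iterate f (suc n) = f ⟨$⟩ iterate f n

    iterates : Fun D D → D.Chain
    iterates f = record
      { seq = iterate f ; ascending = asc
      ; support = proj₁ (Fun.finSupport f) ; supported = sup }
      where
      asc : ∀ n → iterate f n D.⊑ iterate f (suc n)
      asc zero    = bot-⊑ _
      asc (suc n) = Fun.mono f (asc n)
      sup : ∀ n → proj₁ (Fun.finSupport f) D.supports iterate f n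
      sup zero    π fx = bot-equivariant π
      sup (suc n) π fx = D.Eq.trans
        (D.·-cong₂ π (Fun.resp f (D.Eq.sym (sup n (π ⁻¹) (Fixes-⁻¹ {π} fx)))))
        (proj₂ (Fun.finSupport f) π fx _)

    lfp : Fun D D → ∣ D ∣
    lfp f = proj₁ (D.lub (iterates f))

    lfp-IsLub : ∀ f → D.IsLub (iterate f) (lfp f)
    lfp-IsLub f = proj₂ (D.lub (iterates f))

    lfp-prefixed : ∀ f → (f ⟨$⟩ lfp f) D.⊑ lfp f
    lfp-prefixed f = proj₂ (Fun.pres f (iterates f) (lfp-IsLub f)) _ λ n → proj₁ (lfp-IsLub f) (suc n)

    lfp-least : ∀ f {d} → (f ⟨$⟩ d) D.⊑ d → lfp f D.⊑ d
    lfp-least f {d} p = proj₂ (lfp-IsLub f) d go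
      where
      go : ∀ n → iterate f n D.⊑ d
      go zero    = bot-⊑ d
      go (suc n) = D.⊑-trans (Fun.mono f (go n)) p

    private
      module F = FMCpo (D ⇛ D)

      lfp-mono : ∀ {f g} → f F.⊑ g → lfp f D.⊑ lfp g
      lfp-mono {f} {g} p = lfp-least f (D.⊑-trans (p _) (lfp-prefixed g))

      iterate-· : ∀ π f n → iterate (π F.· f) n D.≈ (π D.· iterate f n)
      iterate-· π f zero    = D.Eq.sym (bot-equivariant π)
      iterate-· π f (suc n) = D.·-cong₂ π (Fun.resp f
        (D.Eq.trans (D.·-cong₂ (π ⁻¹) (iterate-· π f n)) (D.π⁻¹·π· π _)))

      lfp-equivariant : ∀ π f → lfp (π F.· f) D.≈ (π D.· lfp f)
      lfp-equivariant π f = D.IsLub-unique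
        (D.IsLub-resp (iterate-· π f) D.Eq.refl (lfp-IsLub (π F.· f)))
        (D.·-lub π (lfp-IsLub f))

      lfp-pres : ∀ (c : F.Chain) {f} → F.IsLub (F.Chain.seq c) f →
                 D.IsLub (lfp ∘ F.Chain.seq c) (lfp f)
      lfp-pres c {f} l = ub , λ d h →
        D.⊑-trans (lfp-least f {s} f-s) (proj₂ s-lub d h)
        where
        ub : ∀ n → lfp (F.Chain.seq c n) D.⊑ lfp f
        ub n = lfp-mono {F.Chain.seq c n} {f} (proj₁ l n)
        lfps : D.Chain
        lfps = record
          { seq = lfp ∘ F.Chain.seq c
          ; ascending = λ n → lfp-mono {F.Chain.seq c n} {F.Chain.seq c (suc n)} (F.Chain.ascending c n)
          ; support = F.Chain.support c
          ; supported = λ n π fx → D.Eq.trans (D.Eq.sym (lfp-equivariant π (F.Chain.seq c n)))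
              (let e = F.Chain.supported c n π fx in
               D.⊑-antisym (lfp-mono {π F.· F.Chain.seq c n} {F.Chain.seq c n} (λ a → D.⊑-reflexive (e a)))
                           (lfp-mono {F.Chain.seq c n} {π F.· F.Chain.seq c n} (λ a → D.⊑-reflexive (D.Eq.sym (e a)))))
          }
        s = proj₁ (D.lub lfps)
        s-lub = proj₂ (D.lub lfps)
        f-s : (f ⟨$⟩ s) D.⊑ s
        f-s = proj₂ (Fun.pres f lfps s-lub) s λ m →
          proj₂ (IsLub-at D D c {f} l _) s λ n →
            D.⊑-trans (F.ascending-≤ c (ℕ.m≤n⊔m m n) _)
            (D.⊑-trans (Fun.mono (F.Chain.seq c (m ⊔ n)) (D.ascending-≤ lfps (ℕ.m≤m⊔n m n)))
            (D.⊑-trans (lfp-prefixed (F.Chain.seq c (m ⊔ n)))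
              (proj₁ s-lub (m ⊔ n))))

    fixᴹ : (D ⇛ D) ⟶ D
    fixᴹ = record
      { fun = lfp
      ; isContinuous = record { mono = λ {f} {g} → lfp-mono {f} {g} ; pres = lfp-pres }
      ; equivariant = lfp-equivariant
      }

  pointed-⇛ : ∀ {A B} → Pointed B → Pointed (A ⇛ B)
  pointed-⇛ {A} {B} b = record
    { _⟨$⟩_ = λ _ → proj₁ b
    ; isContinuous = record
      { mono = λ _ → B.⊑-refl ; pres = λ _ _ → (λ _ → B.⊑-refl) , λ _ h → h 0 }
    ; finSupport = [] , λ π _ _ → bot-equivariant {B} b π
    } , λ f a → proj₂ b (f ⟨$⟩ a)
    where module B = FMCpo B

  locˢ : FMSet
  locˢ .FMSet.setoid  = ≡.setoid Loc
  locˢ .FMSet._·_     = to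
  locˢ .FMSet.isFMSet = record
      { ·-cong = λ { e refl → e _ } ; ·-id = λ _ → refl ; ·-∘ = λ _ _ _ → refl
      ; finSupp = λ l → (l ∷ []) , λ π f → f (here refl) }

  Locᶜ : FMCpo
  Locᶜ = discrete locˢ

  data Val : Set where
    loc     : Loc → Val
    int     : ℤ → Val
    default : Val

  infix 4 _≟ᵥ_
  _≟ᵥ_ : DecidableEquality Val
  loc l   ≟ᵥ loc l′  = map′ (cong loc) (λ { refl → refl }) (l ≟ˡ l′)
  loc _   ≟ᵥ int _   = no λ ()
  loc _   ≟ᵥ default = no λ ()
  int _   ≟ᵥ loc _   = no λ ()
  int m   ≟ᵥ int n   = map′ (cong int) (λ { refl → refl }) (m ℤ.≟ n)
  int _   ≟ᵥ default = no λ ()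
  default ≟ᵥ loc _   = no λ ()
  default ≟ᵥ int _   = no λ ()
  default ≟ᵥ default = yes refl

  infixr 9 _·ⱽ_ _·ᶜ_ _·ʰ_

  _·ⱽ_ : Perm → Val → Val
  π ·ⱽ loc l   = loc (to π l)
  π ·ⱽ int n   = int n
  π ·ⱽ default = default

  locs : Val → List Loc
  locs (loc l) = l ∷ []
  locs (int _) = []
  locs default = []

  ·ⱽ-cong : ∀ {π π′} → π ≋ π′ → ∀ v → π ·ⱽ v ≡ π′ ·ⱽ v
  ·ⱽ-cong e (loc l) = cong loc (e l)
  ·ⱽ-cong e (int _) = refl
  ·ⱽ-cong e default = refl

  ·ⱽ-id : ∀ v → idₚ ·ⱽ v ≡ v
  ·ⱽ-id (loc _) = refl
  ·ⱽ-id (int _) = refl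
  ·ⱽ-id default = refl

  ·ⱽ-∘ : ∀ π π′ v → π ·ⱽ π′ ·ⱽ v ≡ (π ∘ₚ π′) ·ⱽ v
  ·ⱽ-∘ π π′ (loc _) = refl
  ·ⱽ-∘ π π′ (int _) = refl
  ·ⱽ-∘ π π′ default = refl

  locs-supports : ∀ v π → π Fixes locs v → π ·ⱽ v ≡ v
  locs-supports (loc l) π f = cong loc (f (here refl))
  locs-supports (int _) π f = refl
  locs-supports default π f = refl

  ·ⱽ-injective : ∀ π {v w} → π ·ⱽ v ≡ π ·ⱽ w → v ≡ w
  ·ⱽ-injective π {v} {w} e = trans (sym (inv v)) (trans (cong (π ⁻¹ ·ⱽ_) e) (inv w))
    where
    inv : ∀ u → π ⁻¹ ·ⱽ π ·ⱽ u ≡ u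
    inv u = trans (·ⱽ-∘ (π ⁻¹) π u)
      (trans (·ⱽ-cong {π ⁻¹ ∘ₚ π} {idₚ} (π⁻¹∘π π) u) (·ⱽ-id u))

  valˢ : FMSet
  valˢ .FMSet.setoid  = ≡.setoid Val
  valˢ .FMSet._·_     = _·ⱽ_
  valˢ .FMSet.isFMSet = record
      { ·-cong = λ { {π} {π′} {v} e refl → ·ⱽ-cong {π} {π′} e v } ; ·-id = ·ⱽ-id ; ·-∘ = ·ⱽ-∘
      ; finSupp = λ v → locs v , locs-supports v }

  Valᶜ : FMCpo
  Valᶜ = discrete valˢ

  Cell : Set
  Cell = Val × Val

  _·ᶜ_ : Perm → Cell → Cell
  π ·ᶜ (v , w) = π ·ⱽ v , π ·ⱽ w

  cellLocs : Cell → List Loc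
  cellLocs (v , w) = locs v ++ locs w

  cellˢ : FMSet
  cellˢ .FMSet.setoid  = ≡.setoid Cell
  cellˢ .FMSet._·_     = _·ᶜ_
  cellˢ .FMSet.isFMSet = record
      { ·-cong = λ { {π} {π′} {v , w} e refl → cong₂ _,_ (·ⱽ-cong {π} {π′} e v) (·ⱽ-cong {π} {π′} e w) }
      ; ·-id = λ (v , w) → cong₂ _,_ (·ⱽ-id v) (·ⱽ-id w)
      ; ·-∘ = λ π π′ (v , w) → cong₂ _,_ (·ⱽ-∘ π π′ v) (·ⱽ-∘ π π′ w)
      ; finSupp = λ (v , w) → cellLocs (v , w) , λ π f →
          cong₂ _,_ (locs-supports v π (Fixes-++ˡ {π} f)) (locs-supports w π (Fixes-++ʳ {π} (locs v) f)) }

  Cellᶜ : FMCpo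
  Cellᶜ = discrete cellˢ
  module Cellᶜ = FMCpo Cellᶜ

  -- Finite partial functions Loc ⇀ Val × Val.  The order of the domain is
  -- equality, since Val × Val is discrete.
  record Heap : Set where
    no-eta-equality
    field
      lookup : Loc → Maybe Cell
      finite : ∃[ L ] ∀ l → lookup l ≢ nothing → l ∈ L

  open Heap public using (lookup)

  infix 4 _≈ʰ_
  _≈ʰ_ : Heap → Heap → Set
  h ≈ʰ h′ = ∀ l → lookup h l ≡ lookup h′ l

  _·ʰ_ : Perm → Heap → Heap
  π ·ʰ h = record
    { lookup = λ l → Maybe.map (π ·ᶜ_) (lookup h (from π l))
    ; finite = map (to π) (proj₁ (Heap.finite h)) , fin
    }
    where
    fin : ∀ l → Maybe.map (π ·ᶜ_) (lookup h (from π l)) ≢ nothing →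
          l ∈ map (to π) (proj₁ (Heap.finite h))
    fin l ne = subst (_∈ map (to π) (proj₁ (Heap.finite h))) (Perm.strictlyInverseˡ π l)
      (∈-map⁺ (to π) (proj₂ (Heap.finite h) (from π l) λ e → ne (cong (Maybe.map (π ·ᶜ_)) e)))

  heapLocs : Heap → List Loc
  heapLocs h = concat (map (λ l → Maybe.maybe′ cellLocs [] (lookup h l)) (proj₁ (Heap.finite h)))

  ∈-heapLocs : ∀ h {l c x} → lookup h l ≡ just c → x ∈ cellLocs c → x ∈ heapLocs h
  ∈-heapLocs h {l} {c} {x} e p = ∈-concat⁺′
    (subst (λ m → x ∈ Maybe.maybe′ cellLocs [] m) (sym e) p)
    (∈-map⁺ (λ l → Maybe.maybe′ cellLocs [] (lookup h l))
      (proj₂ (Heap.finite h) l λ e′ → contradiction (trans (sym e) e′) λ ()))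

  heap-supports : ∀ h π → π Fixes (proj₁ (Heap.finite h) ++ heapLocs h) → π ·ʰ h ≈ʰ h
  heap-supports h π f l with lookup h l in e
  ... | just c  = trans
          (cong (λ l′ → Maybe.map (π ·ᶜ_) (lookup h l′))
            (Fixes-⁻¹ {π} (Fixes-++ˡ {π} f)
              (proj₂ (Heap.finite h) l λ e′ → contradiction (trans (sym e) e′) λ ())))
          (trans (cong (Maybe.map (π ·ᶜ_)) e)
            (cong just (proj₂ (Cellᶜ.finSupp c) π
              λ p → Fixes-++ʳ {π} (proj₁ (Heap.finite h)) f (∈-heapLocs h e p))))
  ... | nothing with lookup h (from π l) in e′
  ...   | nothing = refl
  ...   | just c  = contradiction (trans (sym e) (trans (cong (lookup h) l≡) e′)) λ ()
    where
    l≡ : l ≡ from π l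
    l≡ = trans (sym (Perm.strictlyInverseˡ π l))
           (f (∈-++⁺ˡ (proj₂ (Heap.finite h) _ λ e″ → contradiction (trans (sym e′) e″) λ ())))

  heapˢ : FMSet
  heapˢ .FMSet.setoid  = record
      { Carrier = Heap ; _≈_ = _≈ʰ_
      ; isEquivalence = record
        { refl = λ _ → refl ; sym = λ e l → sym (e l) ; trans = λ e e′ l → trans (e l) (e′ l) } }
  heapˢ .FMSet._·_     = _·ʰ_
  heapˢ .FMSet.isFMSet = record
      { ·-cong = λ {π} {π′} {h} {h′} e e′ l →
          trans (Maybe.map-cong (λ c → Cellᶜ.·-cong {π} {π′} {c} e refl) (lookup h (from π l)))
            (cong (Maybe.map (π′ ·ᶜ_)) (trans (e′ _) (cong (lookup h′) (⁻¹-cong {π} {π′} e l))))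
      ; ·-id   = λ h l → trans (Maybe.map-cong Cellᶜ.·-id (lookup h l)) (Maybe.map-id (lookup h l))
      ; ·-∘    = λ π π′ h l →
          trans (sym (Maybe.map-∘ (lookup h (from π′ (from π l)))))
            (Maybe.map-cong (Cellᶜ.·-∘ π π′) (lookup h (from π′ (from π l))))
      ; finSupp = λ h → proj₁ (Heap.finite h) ++ heapLocs h , heap-supports h }

  Heapᶜ : FMCpo
  Heapᶜ = discrete heapˢ
  module Heapᶜ = FMCpo Heapᶜ

  []ʰ : Heap
  []ʰ = record { lookup = λ _ → nothing ; finite = [] , λ _ ne → contradiction refl ne }

  [_↦_]ʰ : Loc → Cell → Heap
  [ l ↦ c ]ʰ = record { lookup = look ; finite = (l ∷ []) , fin }
    where
    look : Loc → Maybe Cell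
    look l′ = if does (l′ ≟ˡ l) then just c else nothing
    fin : ∀ l′ → look l′ ≢ nothing → l′ ∈ l ∷ []
    fin l′ ne with l′ ≟ˡ l
    ... | yes e = here e
    ... | no  _ = contradiction refl ne

  infix 4 _#_
  _#_ : Heap → Heap → Set
  h # h′ = ∀ l → lookup h l ≡ nothing ⊎ lookup h′ l ≡ nothing

  -- Left-biased union; only used for disjoint heaps.
  infixr 6 _•_
  _•_ : Heap → Heap → Heap
  h • h′ = record
    { lookup = λ l → lookup h l <∣> lookup h′ l
    ; finite = proj₁ (Heap.finite h) ++ proj₁ (Heap.finite h′) , fin }
    where
    fin : ∀ l → (lookup h l <∣> lookup h′ l) ≢ nothing →
          l ∈ proj₁ (Heap.finite h) ++ proj₁ (Heap.finite h′)
    fin l ne with lookup h l in e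
    ... | just _  = ∈-++⁺ˡ (proj₂ (Heap.finite h) l λ e′ → contradiction (trans (sym e) e′) λ ())
    ... | nothing = ∈-++⁺ʳ (proj₁ (Heap.finite h)) (proj₂ (Heap.finite h′) l ne)

  infix 4 _≈_⊎ʰ_
  _≈_⊎ʰ_ : Heap → Heap → Heap → Set
  h ≈ h₁ ⊎ʰ h₂ = h₁ # h₂ × h ≈ʰ h₁ • h₂

  -- The cell addressed by a value; nothing when v is not in dom(h), in
  -- particular when v is not a location.
  cellAt : Heap → Val → Maybe Cell
  cellAt h (loc l) = lookup h l
  cellAt h (int _) = nothing
  cellAt h default = nothing

  _∖_ : Heap → Val → Heap
  h ∖ v = record { lookup = look ; finite = proj₁ (Heap.finite h) , fin }
    where
    look : Loc → Maybe Cell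
    look l = if does (loc l ≟ᵥ v) then nothing else lookup h l
    fin : ∀ l → look l ≢ nothing → l ∈ proj₁ (Heap.finite h)
    fin l ne with loc l ≟ᵥ v
    ... | yes _ = contradiction refl ne
    ... | no  _ = proj₂ (Heap.finite h) l ne

  _[_≔_]ʰ : Heap → Val → Cell → Heap
  h [ v ≔ c ]ʰ = record { lookup = look ; finite = locs v ++ proj₁ (Heap.finite h) , fin }
    where
    look : Loc → Maybe Cell
    look l = if does (loc l ≟ᵥ v) then just c else lookup h l
    fin : ∀ l → look l ≢ nothing → l ∈ locs v ++ proj₁ (Heap.finite h)
    fin l ne with loc l ≟ᵥ v
    ... | yes refl = here refl
    ... | no  _    = ∈-++⁺ʳ (locs v) (proj₂ (Heap.finite h) l ne)

  •-cong : ∀ {h h′ k k′} → h ≈ʰ h′ → k ≈ʰ k′ → h • k ≈ʰ h′ • k′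
  •-cong e e′ l = cong₂ _<∣>_ (e l) (e′ l)

  •-· : ∀ π h k → π ·ʰ (h • k) ≈ʰ (π ·ʰ h) • (π ·ʰ k)
  •-· π h k l = map-<∣> (π ·ᶜ_) (lookup h (from π l)) (lookup k (from π l))

  map-if : ∀ {A B : Set} (f : A → B) b {x y} →
           Maybe.map f (if b then x else y) ≡ (if b then Maybe.map f x else Maybe.map f y)
  map-if f true  = refl
  map-if f false = refl

  from-≡ : ∀ π {l l′} → from π l ≡ l′ → l ≡ to π l′
  from-≡ π refl = sym (Perm.strictlyInverseˡ π _)

  ≡-to : ∀ π {l l′} → l ≡ to π l′ → from π l ≡ l′
  ≡-to π refl = Perm.strictlyInverseʳ π _

  singleton-· : ∀ π l c → π ·ʰ [ l ↦ c ]ʰ ≈ʰ [ to π l ↦ π ·ᶜ c ]ʰ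
  singleton-· π l c x =
    trans (map-if (π ·ᶜ_) (does (from π x ≟ˡ l)))
      (cong (λ b → if b then just (π ·ᶜ c) else nothing)
        (does-⇔ (mk⇔ (from-≡ π) (≡-to π)) (from π x ≟ˡ l) (x ≟ˡ to π l)))

  does-loc : ∀ π l v → does (loc (from π l) ≟ᵥ v) ≡ does (loc l ≟ᵥ π ·ⱽ v)
  does-loc π l v = does-⇔
    (mk⇔ (λ { refl → cong loc (sym (Perm.strictlyInverseˡ π l)) })
         (λ e → ·ⱽ-injective π (trans (cong loc (Perm.strictlyInverseˡ π l)) e)))
    (loc (from π l) ≟ᵥ v) (loc l ≟ᵥ π ·ⱽ v)

  ∖-· : ∀ π h v → (π ·ʰ h) ∖ (π ·ⱽ v) ≈ʰ π ·ʰ (h ∖ v)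
  ∖-· π h v l = sym (trans (map-if (π ·ᶜ_) (does (loc (from π l) ≟ᵥ v)))
    (cong (λ b → if b then nothing else lookup (π ·ʰ h) l) (does-loc π l v)))

  ≔-· : ∀ π h v c → (π ·ʰ h) [ π ·ⱽ v ≔ π ·ᶜ c ]ʰ ≈ʰ π ·ʰ (h [ v ≔ c ]ʰ)
  ≔-· π h v c l = sym (trans (map-if (π ·ᶜ_) (does (loc (from π l) ≟ᵥ v)))
    (cong (λ b → if b then just (π ·ᶜ c) else lookup (π ·ʰ h) l) (does-loc π l v)))

  if-cong : ∀ {A : Set} b {x x′ y y′ : A} → x ≡ x′ → y ≡ y′ →
            (if b then x else y) ≡ (if b then x′ else y′)
  if-cong true  e _ = e
  if-cong false _ e = e

  cellAt-cong : ∀ {h h′} v → h ≈ʰ h′ → cellAt h v ≡ cellAt h′ v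
  cellAt-cong (loc l) e = e l
  cellAt-cong (int _) e = refl
  cellAt-cong default e = refl

  cellAt-· : ∀ π h v → cellAt (π ·ʰ h) (π ·ⱽ v) ≡ Maybe.map (π ·ᶜ_) (cellAt h v)
  cellAt-· π h (loc l) = cong (λ x → Maybe.map (π ·ᶜ_) (lookup h x)) (Perm.strictlyInverseʳ π l)
  cellAt-· π h (int _) = refl
  cellAt-· π h default = refl

  data O : Set where
    ⊥ₒ normal err : O

  infix 4 _⊑ₒ_
  data _⊑ₒ_ : O → O → Set where
    bot  : ∀ {o} → ⊥ₒ ⊑ₒ o
    same : ∀ {o} → o ⊑ₒ o

  Oᴾ : FMPoset
  Oᴾ .FMPoset.poset = record
    { Carrier = O ; _≈_ = _≡_ ; _≤_ = _⊑ₒ_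
    ; isPartialOrder = record
      { isPreorder = record
        { isEquivalence = ≡.isEquivalence
        ; reflexive = λ { refl → same }
        ; trans = λ { bot _ → bot ; same q → q }
        }
      ; antisym = λ { bot bot → refl ; bot same → refl ; same _ → refl }
      }
    }
  Oᴾ .FMPoset._·_ = λ _ o → o
  Oᴾ .FMPoset.isFMSet = record
    { ·-cong = λ _ e → e ; ·-id = λ _ → refl ; ·-∘ = λ _ _ _ → refl
    ; finSupp = λ _ → [] , λ _ _ → refl }
  Oᴾ .FMPoset.·-mono = λ _ p → p

  Oᶜ : FMCpo
  Oᶜ .FMCpo.fmPoset = Oᴾ
  Oᶜ .FMCpo.lub = lub
    where
    open FMPoset Oᴾ
    maximal : ∀ {o o′} → o ≢ ⊥ₒ → o ⊑ₒ o′ → o′ ⊑ₒ o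
    maximal ne bot = contradiction refl ne
    maximal ne same = same
    ≢⊥⇒ : ∀ o → ¬ (o ≢ ⊥ₒ) → o ⊑ₒ ⊥ₒ
    ≢⊥⇒ ⊥ₒ     _  = same
    ≢⊥⇒ normal ne = contradiction (λ ()) ne
    ≢⊥⇒ err    ne = contradiction (λ ()) ne
    lub : (c : Chain) → ∃ (IsLub (Chain.seq c))
    lub c with em {∃ λ n → Chain.seq c n ≢ ⊥ₒ}
    ... | yes (n , ne) = Chain.seq c n , (λ m → [ ascending-≤ c , (λ n≤m → maximal ne (ascending-≤ c n≤m)) ]′ (ℕ.≤-total m n))
                       , λ _ h → h n
    ... | no ¬∃ = ⊥ₒ , (λ n → ≢⊥⇒ _ λ ne → ¬∃ (n , ne)) , λ _ _ → bot

  G : O → Set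
  G o = o ≡ normal ⊎ o ≡ ⊥ₒ

  Contᶜ : FMCpo
  Contᶜ = Heapᶜ ⇛ Oᶜ

  Cont : Set
  Cont = ∣ Contᶜ ∣

  ⟦_⟧ᵗ : Ty → FMCpo
  ⟦ com ⟧ᵗ    = Heapᶜ ×ᶜ Contᶜ ⇛ Oᶜ
  ⟦ val⇒ τ ⟧ᵗ = Valᶜ ⇛ ⟦ τ ⟧ᵗ
  ⟦ σ ⇒ τ ⟧ᵗ  = ⟦ σ ⟧ᵗ ⇛ ⟦ τ ⟧ᵗ

  pointed : ∀ τ → Pointed ⟦ τ ⟧ᵗ
  pointed com      = pointed-⇛ {Heapᶜ ×ᶜ Contᶜ} {Oᶜ} (⊥ₒ , λ _ → bot)
  pointed (val⇒ τ) = pointed-⇛ {Valᶜ} {⟦ τ ⟧ᵗ} (pointed τ)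
  pointed (σ ⇒ τ)  = pointed-⇛ {⟦ σ ⟧ᵗ} {⟦ τ ⟧ᵗ} (pointed τ)

  ⟦_⟧ᵍ : TyEnv → FMCpo
  ⟦ [] ⟧ᵍ    = 𝟙
  ⟦ τ ∷ Γ ⟧ᵍ = ⟦ Γ ⟧ᵍ ×ᶜ ⟦ τ ⟧ᵗ

  Stack : ℕ → Set
  Stack = Vec Val

  stackˢ : ℕ → FMSet
  stackˢ Δ .FMSet.setoid  = ≡.setoid (Stack Δ)
  stackˢ Δ .FMSet._·_     = λ π → Vec.map (π ·ⱽ_)
  stackˢ Δ .FMSet.isFMSet = record
      { ·-cong  = λ { {π} {π′} {ρ} e refl → Vec.map-cong (·ⱽ-cong {π} {π′} e) ρ }
      ; ·-id    = λ ρ → trans (Vec.map-cong ·ⱽ-id ρ) (Vec.map-id ρ)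
      ; ·-∘     = λ π π′ ρ → trans (sym (Vec.map-∘ (π ·ⱽ_) (π′ ·ⱽ_) ρ)) (Vec.map-cong (·ⱽ-∘ π π′) ρ)
      ; finSupp = λ ρ → stackLocs ρ , stack-supports ρ }
    where
    stackLocs : ∀ {n} → Stack n → List Loc
    stackLocs []      = []
    stackLocs (v ∷ ρ) = locs v ++ stackLocs ρ
    stack-supports : ∀ {n} (ρ : Stack n) π → π Fixes stackLocs ρ → Vec.map (π ·ⱽ_) ρ ≡ ρ
    stack-supports []      π f = refl
    stack-supports (v ∷ ρ) π f =
      cong₂ _∷_ (locs-supports v π (Fixes-++ˡ {π} f)) (stack-supports ρ π (Fixes-++ʳ {π} (locs v) f))

  ⟦_⟧ᵈ : ℕ → FMCpo
  ⟦ Δ ⟧ᵈ = discrete (stackˢ Δ)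

  addᵥ subᵥ : Val → Val → Val
  addᵥ (int m) (int n) = int (m ℤ.+ n)
  addᵥ _       _       = default
  subᵥ (int m) (int n) = int (m ℤ.- n)
  subᵥ _       _       = default

  ⟦_⟧ₑ : Exp Δ → Stack Δ → Val
  ⟦ svar i ⟧ₑ ρ = Vec.lookup ρ i
  ⟦ zeroₑ ⟧ₑ  ρ = int 0ℤ
  ⟦ oneₑ ⟧ₑ   ρ = int 1ℤ
  ⟦ -oneₑ ⟧ₑ  ρ = int -1ℤ
  ⟦ E ⊞ F ⟧ₑ  ρ = addᵥ (⟦ E ⟧ₑ ρ) (⟦ F ⟧ₑ ρ)
  ⟦ E ⊟ F ⟧ₑ  ρ = subᵥ (⟦ E ⟧ₑ ρ) (⟦ F ⟧ₑ ρ)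

  addᵥ-· : ∀ π v w → addᵥ (π ·ⱽ v) (π ·ⱽ w) ≡ π ·ⱽ addᵥ v w
  addᵥ-· π (loc _) w       = refl
  addᵥ-· π (int _) (loc _) = refl
  addᵥ-· π (int _) (int _) = refl
  addᵥ-· π (int _) default = refl
  addᵥ-· π default w       = refl

  subᵥ-· : ∀ π v w → subᵥ (π ·ⱽ v) (π ·ⱽ w) ≡ π ·ⱽ subᵥ v w
  subᵥ-· π (loc _) w       = refl
  subᵥ-· π (int _) (loc _) = refl
  subᵥ-· π (int _) (int _) = refl
  subᵥ-· π (int _) default = refl
  subᵥ-· π default w       = refl

  ⟦⟧ₑ-· : ∀ (E : Exp Δ) π ρ → ⟦ E ⟧ₑ (Vec.map (π ·ⱽ_) ρ) ≡ π ·ⱽ ⟦ E ⟧ₑ ρ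
  ⟦⟧ₑ-· (svar i) π ρ = Vec.lookup-map i (π ·ⱽ_) ρ
  ⟦⟧ₑ-· zeroₑ    π ρ = refl
  ⟦⟧ₑ-· oneₑ     π ρ = refl
  ⟦⟧ₑ-· -oneₑ    π ρ = refl
  ⟦⟧ₑ-· (E ⊞ F)  π ρ = trans (cong₂ addᵥ (⟦⟧ₑ-· E π ρ) (⟦⟧ₑ-· F π ρ)) (addᵥ-· π (⟦ E ⟧ₑ ρ) (⟦ F ⟧ₑ ρ))
  ⟦⟧ₑ-· (E ⊟ F)  π ρ = trans (cong₂ subᵥ (⟦⟧ₑ-· E π ρ) (⟦⟧ₑ-· F π ρ)) (subᵥ-· π (⟦ E ⟧ₑ ρ) (⟦ F ⟧ₑ ρ))

  get : Field → Cell → Val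
  get f₀ (v , _) = v
  get f₁ (_ , w) = w

  put : Field → Val → Cell → Cell
  put f₀ u (_ , w) = u , w
  put f₁ u (v , _) = v , u

  condᴹ : ∀ {A} → ((Valᶜ ×ᶜ Valᶜ) ×ᶜ (A ×ᶜ A)) ⟶ A
  condᴹ {A} = familyᴹ {Valᶜ ×ᶜ Valᶜ} {A ×ᶜ A} {A} (λ (p , q) → sym p , sym q) f fc
    (λ { (refl , refl) _ → A.Eq.refl }) eqv
    where
    module A = FMCpo A
    f : Val × Val → ∣ A ∣ × ∣ A ∣ → ∣ A ∣
    f (v , w) (a , b) = if does (v ≟ᵥ w) then a else b
    fc : ∀ x → IsContinuous (A ×ᶜ A) A (f x)
    fc (v , w) = choice (does (v ≟ᵥ w))
      where
      choice : ∀ b → IsContinuous (A ×ᶜ A) A (λ p → if b then proj₁ p else proj₂ p)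
      choice true  = _⟶_.isContinuous (π₁ᴹ {A} {A})
      choice false = _⟶_.isContinuous (π₂ᴹ {A} {A})
    eqv : ∀ π (x : Val × Val) (a : ∣ A ∣ × ∣ A ∣) →
          f (π ·ⱽ proj₁ x , π ·ⱽ proj₂ x) (π A.· proj₁ a , π A.· proj₂ a) A.≈ (π A.· f x a)
    eqv π (v , w) (a , b)
      rewrite does-⇔ (mk⇔ (·ⱽ-injective π) (cong (π ·ⱽ_))) (π ·ⱽ v ≟ᵥ π ·ⱽ w) (v ≟ᵥ w)
      with does (v ≟ᵥ w)
    ... | true  = A.Eq.refl
    ... | false = A.Eq.refl

  -- ((v , h) , a) ↦ body (h(v) , a), or err when v ∉ dom(h).
  derefᴹ : ∀ {A} → (Cellᶜ ×ᶜ A) ⟶ Oᶜ → ((Valᶜ ×ᶜ Heapᶜ) ×ᶜ A) ⟶ Oᶜ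
  derefᴹ {A} body = familyᴹ {Valᶜ ×ᶜ Heapᶜ} {A} {Oᶜ} (λ (p , q) → sym p , λ l → sym (q l)) f fc
    (λ { {v , h} (refl , e) a → cong (branch a) (cellAt-cong v e) })
    λ π (v , h) a → trans (cong (branch (π A.· a)) (cellAt-· π h v)) (branch-· π a (cellAt h v))
    where
    module A = FMCpo A
    branch : ∣ A ∣ → Maybe Cell → O
    branch a = Maybe.maybe′ (λ c → fun body (c , a)) err
    f : Val × Heap → ∣ A ∣ → O
    f (v , h) a = branch a (cellAt h v)
    fc : ∀ x → IsContinuous A Oᶜ (f x)
    fc (v , h) = branch-cont (cellAt h v)
      where
      branch-cont : ∀ m → IsContinuous A Oᶜ (λ a → branch a m)
      branch-cont (just c) = Fun.isContinuous (fun (curryᴹ {Cellᶜ} {A} {Oᶜ} body) c)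
      branch-cont nothing  = record { mono = λ _ → same ; pres = λ _ _ → (λ _ → same) , λ _ u → u 0 }
    branch-· : ∀ π a m → branch (π A.· a) (Maybe.map (π ·ᶜ_) m) ≡ branch a m
    branch-· π a (just c) = _⟶_.equivariant body π (c , a)
    branch-· π a nothing  = refl

  -- a ↦ body (l , a) for any l ∉ supp(a).  choose takes l outside the support
  -- that a carries; by fresh-any every l outside some support of a (such as
  -- the smallest) gives the same result.
  module _ {A : FMCpo} (body : (Locᶜ ×ᶜ A) ⟶ Oᶜ) where
    private
      module A = FMCpo A

      swap-body : ∀ {L a l l′} → L A.supports a → l ∉ L → l′ ∉ L →
                  fun body (l , a) ≡ fun body (l′ , a)
      swap-body {L} {a} {l} {l′} s l∉ l′∉ =
        trans (sym (_⟶_.equivariant body (swap l l′) (l , a)))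
          (_⟶_.resp body (swap-a l l′ , s (swap l l′) (swap-Fixes l∉ l′∉)))

      choose : ∣ A ∣ → O
      choose a = fun body (fresh (A.supp a) , a)

    fresh-any : ∀ {L a l} → L A.supports a → l ∉ L →
                fun body (fresh (A.supp a) , a) ≡ fun body (l , a)
    fresh-any {L} {a} {l} s l∉ = trans
      (swap-body (proj₂ (A.finSupp a)) (fresh-∉ (A.supp a)) λ p → fresh-∉ (A.supp a ++ L) (∈-++⁺ˡ p))
      (swap-body s (λ p → fresh-∉ (A.supp a ++ L) (∈-++⁺ʳ (A.supp a) p)) l∉)

    freshᴹ : A ⟶ Oᶜ
    freshᴹ = record
      { fun = choose
      ; isContinuous = record { mono = mono ; pres = pres }
      ; equivariant = λ π a → trans
          (fresh-any (A.supports-· π (proj₂ (A.finSupp a))) (∉-map π (fresh-∉ (A.supp a))))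
          (_⟶_.equivariant body π (fresh (A.supp a) , a))
      }
      where
      ∉-map : ∀ π {L l} → l ∉ L → to π l ∉ map (to π) L
      ∉-map π {L} l∉ p =
        let l′ , l′∈ , e = ∈-map⁻ (to π) p in
        l∉ (subst (_∈ L) (trans (sym (Perm.strictlyInverseʳ π l′))
                           (trans (cong (from π) (sym e)) (Perm.strictlyInverseʳ π _))) l′∈)
      mono : ∀ {a b} → a A.⊑ b → choose a ⊑ₒ choose b
      mono {a} {b} p =
        let l  = fresh (A.supp a ++ A.supp b)
            l∉ = fresh-∉ (A.supp a ++ A.supp b)
            open FMCpo Oᶜ using (⊑-trans; ⊑-reflexive) in
        ⊑-trans (⊑-reflexive (fresh-any (proj₂ (A.finSupp a)) (l∉ ∘ ∈-++⁺ˡ)))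
          (⊑-trans (_⟶_.mono body (refl , p))
            (⊑-reflexive (sym (fresh-any (proj₂ (A.finSupp b)) (l∉ ∘ ∈-++⁺ʳ (A.supp a))))))
      pres : ∀ (c : A.Chain) {a} → A.IsLub (A.Chain.seq c) a →
             FMCpo.IsLub Oᶜ (choose ∘ A.Chain.seq c) (choose a)
      pres c {a} lb =
        let l  = fresh (A.Chain.support c ++ A.supp a)
            l∉ = fresh-∉ (A.Chain.support c ++ A.supp a) in
        FMCpo.IsLub-resp Oᶜ
          (λ n → sym (fresh-any (A.Chain.supported c n) (l∉ ∘ ∈-++⁺ˡ)))
          (sym (fresh-any (proj₂ (A.finSupp a)) (l∉ ∘ ∈-++⁺ʳ (A.Chain.support c))))
          (Fun.pres (fun (curryᴹ {Locᶜ} {A} {Oᶜ} body) l) c lb)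

  Env : ℕ → TyEnv → FMCpo
  Env Δ Γ = ⟦ Δ ⟧ᵈ ×ᶜ ⟦ Γ ⟧ᵍ

  Conf : FMCpo → FMCpo
  Conf A = A ×ᶜ (Heapᶜ ×ᶜ Contᶜ)

  expᴹ : Exp Δ → ⟦ Δ ⟧ᵈ ⟶ Valᶜ
  expᴹ E = discreteᴹ sym ⟦ E ⟧ₑ (cong ⟦ E ⟧ₑ) (⟦⟧ₑ-· E)

  consᴹ : (⟦ Δ ⟧ᵈ ×ᶜ Valᶜ) ⟶ ⟦ suc Δ ⟧ᵈ
  consᴹ {Δ} = discreteᴹ {⟦ Δ ⟧ᵈ ×ᶜ Valᶜ} (λ (p , q) → sym p , sym q) (λ (ρ , v) → v ∷ ρ)
    (λ (p , q) → cong₂ _∷_ q p) (λ _ _ → refl)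

  locᴹ : Locᶜ ⟶ Valᶜ
  locᴹ = discreteᴹ sym loc (cong loc) (λ _ _ → refl)

  getᴹ : Field → Cellᶜ ⟶ Valᶜ
  getᴹ f = discreteᴹ sym (get f) (cong (get f)) (eqv f)
    where
    eqv : ∀ f π c → get f (π ·ᶜ c) ≡ π ·ⱽ get f c
    eqv f₀ _ _ = refl
    eqv f₁ _ _ = refl

  putᴹ : Field → (Valᶜ ×ᶜ Cellᶜ) ⟶ Cellᶜ
  putᴹ f = discreteᴹ {Valᶜ ×ᶜ Cellᶜ} (λ (p , q) → sym p , sym q)
    (λ (v , c) → put f v c) (λ (p , q) → cong₂ (put f) p q) (λ π (v , c) → eqv f π v c)
    where
    eqv : ∀ f π v c → put f (π ·ⱽ v) (π ·ᶜ c) ≡ π ·ᶜ put f v c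
    eqv f₀ _ _ _ = refl
    eqv f₁ _ _ _ = refl

  allocᴹ : (Locᶜ ×ᶜ Heapᶜ) ⟶ Heapᶜ
  allocᴹ = discreteᴹ {Locᶜ ×ᶜ Heapᶜ} (λ (p , q) → sym p , λ x → sym (q x))
    (λ (l , h) → h • [ l ↦ int 0ℤ , int 0ℤ ]ʰ)
    (λ { {l , h} {_ , h′} (refl , e) → •-cong {h} {h′} {[ l ↦ int 0ℤ , int 0ℤ ]ʰ} {[ l ↦ int 0ℤ , int 0ℤ ]ʰ} e (λ _ → refl) })
    λ π (l , h) x → sym (trans (•-· π h [ l ↦ int 0ℤ , int 0ℤ ]ʰ x)
      (cong (lookup (π ·ʰ h) x <∣>_) (singleton-· π l (int 0ℤ , int 0ℤ) x)))

  removeᴹ : (Heapᶜ ×ᶜ Valᶜ) ⟶ Heapᶜ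
  removeᴹ = discreteᴹ {Heapᶜ ×ᶜ Valᶜ} (λ (p , q) → (λ x → sym (p x)) , sym q)
    (λ (h , v) → h ∖ v)
    (λ { {_ , v} (e , refl) l → if-cong (does (loc l ≟ᵥ v)) refl (e l) })
    λ π (h , v) → ∖-· π h v

  updateᴹ : (Heapᶜ ×ᶜ (Valᶜ ×ᶜ Cellᶜ)) ⟶ Heapᶜ
  updateᴹ = discreteᴹ {Heapᶜ ×ᶜ (Valᶜ ×ᶜ Cellᶜ)} (λ (p , q , r) → (λ x → sym (p x)) , sym q , sym r)
    (λ (h , v , c) → h [ v ≔ c ]ʰ)
    (λ { {_ , v , _} (e , refl , refl) l → if-cong (does (loc l ≟ᵥ v)) refl (e l) })
    λ π (h , v , c) → ≔-· π h v c

  identᴹ : τ ∈ Γ → ⟦ Γ ⟧ᵍ ⟶ ⟦ τ ⟧ᵗ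
  identᴹ (here refl) = π₂ᴹ
  identᴹ (there x)   = identᴹ x ∘ᴹ π₁ᴹ

  bindᴹ : ∀ {G} → ((⟦ Δ ⟧ᵈ ×ᶜ G) ×ᶜ Valᶜ) ⟶ (⟦ suc Δ ⟧ᵈ ×ᶜ G)
  bindᴹ = ⟨ consᴹ ∘ᴹ ⟨ π₁ᴹ ∘ᴹ π₁ᴹ , π₂ᴹ ⟩ᴹ , π₂ᴹ ∘ᴹ π₁ᴹ ⟩ᴹ

  stackᴹ : ∀ {D G} → Conf (D ×ᶜ G) ⟶ D
  stackᴹ = π₁ᴹ ∘ᴹ π₁ᴹ

  heapᴹ : ∀ {A} → Conf A ⟶ Heapᶜ
  heapᴹ = π₁ᴹ ∘ᴹ π₂ᴹ

  contᴹ : ∀ {A} → Conf A ⟶ Contᶜ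
  contᴹ = π₂ᴹ ∘ᴹ π₂ᴹ

  accessᴹ : ∀ {G} → Exp Δ → (Cellᶜ ×ᶜ Conf (⟦ Δ ⟧ᵈ ×ᶜ G)) ⟶ Oᶜ → (⟦ Δ ⟧ᵈ ×ᶜ G) ⟶ ⟦ com ⟧ᵗ
  accessᴹ E body = curryᴹ (derefᴹ body ∘ᴹ ⟨ ⟨ expᴹ E ∘ᴹ stackᴹ , heapᴹ ⟩ᴹ , idᴹ ⟩ᴹ)

  newᴹ : Tm (suc Δ) Γ com → (Locᶜ ×ᶜ Conf (Env Δ Γ)) ⟶ Oᶜ

  ⟦_⟧ᴹ : Tm Δ Γ τ → Env Δ Γ ⟶ ⟦ τ ⟧ᵗ
  ⟦ ident x ⟧ᴹ    = identᴹ x ∘ᴹ π₂ᴹ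
  ⟦ ƛᵥ M ⟧ᴹ       = curryᴹ (⟦ M ⟧ᴹ ∘ᴹ bindᴹ)
  ⟦ M ·ᵥ E ⟧ᴹ     = evalᴹ ∘ᴹ ⟨ ⟦ M ⟧ᴹ , expᴹ E ∘ᴹ π₁ᴹ ⟩ᴹ
  ⟦ ƛₜ M ⟧ᴹ       = curryᴹ (⟦ M ⟧ᴹ ∘ᴹ ⟨ π₁ᴹ ∘ᴹ π₁ᴹ , ⟨ π₂ᴹ ∘ᴹ π₁ᴹ , π₂ᴹ ⟩ᴹ ⟩ᴹ)
  ⟦ M ·ₜ N ⟧ᴹ     = evalᴹ ∘ᴹ ⟨ ⟦ M ⟧ᴹ , ⟦ N ⟧ᴹ ⟩ᴹ
  ⟦_⟧ᴹ {τ = τ} (fix M) = fixᴹ (pointed τ) ∘ᴹ ⟦ M ⟧ᴹ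
  ⟦ if E ≟ F then M else N ⟧ᴹ =
    condᴹ ∘ᴹ ⟨ ⟨ expᴹ E ∘ᴹ π₁ᴹ , expᴹ F ∘ᴹ π₁ᴹ ⟩ᴹ , ⟨ ⟦ M ⟧ᴹ , ⟦ N ⟧ᴹ ⟩ᴹ ⟩ᴹ
  ⟦ M ⨾ N ⟧ᴹ      = curryᴹ (evalᴹ ∘ᴹ ⟨ ⟦ M ⟧ᴹ ∘ᴹ π₁ᴹ , ⟨ heapᴹ ,
    curryᴹ (evalᴹ ∘ᴹ ⟨ ⟦ N ⟧ᴹ ∘ᴹ π₁ᴹ ∘ᴹ π₁ᴹ , ⟨ π₂ᴹ , contᴹ ∘ᴹ π₁ᴹ ⟩ᴹ ⟩ᴹ) ⟩ᴹ ⟩ᴹ)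
  ⟦ letnew M ⟧ᴹ   = curryᴹ (freshᴹ (newᴹ M))
  ⟦ free E ⟧ᴹ     = accessᴹ E (evalᴹ ∘ᴹ
    ⟨ contᴹ ∘ᴹ π₂ᴹ , removeᴹ ∘ᴹ ⟨ heapᴹ ∘ᴹ π₂ᴹ , expᴹ E ∘ᴹ stackᴹ ∘ᴹ π₂ᴹ ⟩ᴹ ⟩ᴹ)
  ⟦ letget E f M ⟧ᴹ = accessᴹ E (evalᴹ ∘ᴹ
    ⟨ ⟦ M ⟧ᴹ ∘ᴹ bindᴹ ∘ᴹ ⟨ π₁ᴹ ∘ᴹ π₂ᴹ , getᴹ f ∘ᴹ π₁ᴹ ⟩ᴹ , π₂ᴹ ∘ᴹ π₂ᴹ ⟩ᴹ)
  ⟦ E ∙ f ≔ F ⟧ᴹ  = accessᴹ E (evalᴹ ∘ᴹ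
    ⟨ contᴹ ∘ᴹ π₂ᴹ
    , updateᴹ ∘ᴹ ⟨ heapᴹ ∘ᴹ π₂ᴹ , ⟨ expᴹ E ∘ᴹ stackᴹ ∘ᴹ π₂ᴹ ,
        putᴹ f ∘ᴹ ⟨ expᴹ F ∘ᴹ stackᴹ ∘ᴹ π₂ᴹ , π₁ᴹ ⟩ᴹ ⟩ᴹ ⟩ᴹ ⟩ᴹ)

  -- (l , ((ρ , η) , (h , k))) ↦ ⟦ M ⟧ (loc l ∷ ρ) η (h • [ l ↦ 0 , 0 ] , k)
  newᴹ M = evalᴹ ∘ᴹ
    ⟨ ⟦ M ⟧ᴹ ∘ᴹ bindᴹ ∘ᴹ ⟨ π₁ᴹ ∘ᴹ π₂ᴹ , locᴹ ∘ᴹ π₁ᴹ ⟩ᴹ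
    , ⟨ allocᴹ ∘ᴹ ⟨ π₁ᴹ , heapᴹ ∘ᴹ π₂ᴹ ⟩ᴹ , contᴹ ∘ᴹ π₂ᴹ ⟩ᴹ ⟩ᴹ

  ⟦_⟧ : Tm Δ Γ τ → Stack Δ → ∣ ⟦ Γ ⟧ᵍ ∣ → ∣ ⟦ τ ⟧ᵗ ∣
  ⟦ M ⟧ ρ η = fun ⟦ M ⟧ᴹ (ρ , η)

  -- The interpretation of commands is assembled from morphisms; these are the
  -- equations it satisfies.

  module Clauses (ρ : Stack Δ) (η : ∣ ⟦ Γ ⟧ᵍ ∣) (h : Heap) (k : Cont) where
    private
      State = Env Δ Γ ×ᶜ (Heapᶜ ×ᶜ Contᶜ)

    ⟦⨾⟧ : ∀ (M N : Tm Δ Γ com) →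
          ∃[ k′ ] ⟦ M ⨾ N ⟧ ρ η ⟨$⟩ (h , k) ≡ ⟦ M ⟧ ρ η ⟨$⟩ (h , k′)
                × (∀ h′ → k′ ⟨$⟩ h′ ≡ ⟦ N ⟧ ρ η ⟨$⟩ (h′ , k))
    ⟦⨾⟧ M N = _ , refl , λ _ → refl

    ⟦letnew⟧ : ∀ (M : Tm (suc Δ) Γ com) {L l} → FMCpo._supports_ State L ((ρ , η) , (h , k)) → l ∉ L →
               ⟦ letnew M ⟧ ρ η ⟨$⟩ (h , k) ≡
               ⟦ M ⟧ (loc l ∷ ρ) η ⟨$⟩ (h • [ l ↦ int 0ℤ , int 0ℤ ]ʰ , k)
    ⟦letnew⟧ M s l∉ = fresh-any {State} (newᴹ M) {a = (ρ , η) , (h , k)} s l∉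

    ⟦free⟧ : ∀ E → ⟦_⟧ {Γ = Γ} (free E) ρ η ⟨$⟩ (h , k) ≡
             Maybe.maybe′ (λ _ → k ⟨$⟩ (h ∖ ⟦ E ⟧ₑ ρ)) err (cellAt h (⟦ E ⟧ₑ ρ))
    ⟦free⟧ E = refl

    ⟦letget⟧ : ∀ E f (M : Tm (suc Δ) Γ com) → ⟦ letget E f M ⟧ ρ η ⟨$⟩ (h , k) ≡
               Maybe.maybe′ (λ c → ⟦ M ⟧ (get f c ∷ ρ) η ⟨$⟩ (h , k)) err (cellAt h (⟦ E ⟧ₑ ρ))
    ⟦letget⟧ E f M = refl

    ⟦≔⟧ : ∀ E f F → ⟦_⟧ {Γ = Γ} (E ∙ f ≔ F) ρ η ⟨$⟩ (h , k) ≡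
          Maybe.maybe′ (λ c → k ⟨$⟩ (h [ ⟦ E ⟧ₑ ρ ≔ put f (⟦ F ⟧ₑ ρ) c ]ʰ)) err (cellAt h (⟦ E ⟧ₑ ρ))
    ⟦≔⟧ E f F = refl

    ⟦if⟧ : ∀ E F (M N : Tm Δ Γ com) → ⟦ if E ≟ F then M else N ⟧ ρ η ≡
           (if does (⟦ E ⟧ₑ ρ ≟ᵥ ⟦ F ⟧ₑ ρ) then ⟦ M ⟧ ρ η else ⟦ N ⟧ ρ η)
    ⟦if⟧ E F M N = refl

  -- Holds only between integers.
  infix 4 _≤ᵥ_
  data _≤ᵥ_ : Val → Val → Set where
    int : ∀ {m n} → m ℤ.≤ n → int m ≤ᵥ int n

  ⟦_⟧ₐ : Asn Δ → Stack Δ → Heap → Set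
  ⟦ E ≐ᵃ F ⟧ₐ ρ h    = ⟦ E ⟧ₑ ρ ≡ ⟦ F ⟧ₑ ρ
  ⟦ E ≤ᵃ F ⟧ₐ ρ h    = ⟦ E ⟧ₑ ρ ≤ᵥ ⟦ F ⟧ₑ ρ
  ⟦ E ↦ E₀ , E₁ ⟧ₐ ρ h = ∃[ l ] ⟦ E ⟧ₑ ρ ≡ loc l × h ≈ʰ [ l ↦ ⟦ E₀ ⟧ₑ ρ , ⟦ E₁ ⟧ₑ ρ ]ʰ
  ⟦ emp ⟧ₐ ρ h       = h ≈ʰ []ʰ
  ⟦ P ∗ Q ⟧ₐ ρ h     = ∃[ h₁ ] ∃[ h₂ ] h ≈ h₁ ⊎ʰ h₂ × ⟦ P ⟧ₐ ρ h₁ × ⟦ Q ⟧ₐ ρ h₂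
  ⟦ P ∧ᵃ Q ⟧ₐ ρ h    = ⟦ P ⟧ₐ ρ h × ⟦ Q ⟧ₐ ρ h
  ⟦ ¬ᵃ P ⟧ₐ ρ h      = ¬ ⟦ P ⟧ₐ ρ h
  ⟦ ∃ᵃ P ⟧ₐ ρ h      = ∃[ v ] ⟦ P ⟧ₐ (v ∷ ρ) h

  ⟦⟧ₐ-resp : ∀ (P : Asn Δ) {ρ h h′} → h ≈ʰ h′ → ⟦ P ⟧ₐ ρ h → ⟦ P ⟧ₐ ρ h′
  ⟦⟧ₐ-resp (E ≐ᵃ F) e p = p
  ⟦⟧ₐ-resp (E ≤ᵃ F) e p = p
  ⟦⟧ₐ-resp (E ↦ E₀ , E₁) e (l , p , q) = l , p , λ x → trans (sym (e x)) (q x)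
  ⟦⟧ₐ-resp emp e p = λ x → trans (sym (e x)) (p x)
  ⟦⟧ₐ-resp (P ∗ Q) e (h₁ , h₂ , (d , s) , p , q) = h₁ , h₂ , (d , λ x → trans (sym (e x)) (s x)) , p , q
  ⟦⟧ₐ-resp (P ∧ᵃ Q) e (p , q) = ⟦⟧ₐ-resp P e p , ⟦⟧ₐ-resp Q e q
  ⟦⟧ₐ-resp (¬ᵃ P) e ¬p p = ¬p (⟦⟧ₐ-resp P (λ x → sym (e x)) p)
  ⟦⟧ₐ-resp (∃ᵃ P) e (v , p) = v , ⟦⟧ₐ-resp P e p

  #-· : ∀ π {h h′} → h # h′ → π ·ʰ h # π ·ʰ h′
  #-· π d l = [ inj₁ ∘ cong (Maybe.map (π ·ᶜ_)) , inj₂ ∘ cong (Maybe.map (π ·ᶜ_)) ]′ (d (from π l))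

  ⊎ʰ-· : ∀ π {h h₁ h₂} → h ≈ h₁ ⊎ʰ h₂ → π ·ʰ h ≈ π ·ʰ h₁ ⊎ʰ (π ·ʰ h₂)
  ⊎ʰ-· π {h} {h₁} {h₂} (d , e) = #-· π {h₁} {h₂} d ,
    λ l → trans (cong (Maybe.map (π ·ᶜ_)) (e (from π l))) (•-· π h₁ h₂ l)

  ≤ᵥ-· : ∀ π {v w} → v ≤ᵥ w → π ·ⱽ v ≤ᵥ π ·ⱽ w
  ≤ᵥ-· π (int p) = int p

  ⟦⟧ₐ-· : ∀ (P : Asn Δ) π {ρ h} → ⟦ P ⟧ₐ ρ h → ⟦ P ⟧ₐ (Vec.map (π ·ⱽ_) ρ) (π ·ʰ h)
  ⟦⟧ₐ-· (E ≐ᵃ F) π {ρ} p = trans (⟦⟧ₑ-· E π ρ) (trans (cong (π ·ⱽ_) p) (sym (⟦⟧ₑ-· F π ρ)))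
  ⟦⟧ₐ-· (E ≤ᵃ F) π {ρ} p =
    ≡.subst₂ _≤ᵥ_ (sym (⟦⟧ₑ-· E π ρ)) (sym (⟦⟧ₑ-· F π ρ)) (≤ᵥ-· π p)
  ⟦⟧ₐ-· (E ↦ E₀ , E₁) π {ρ} {h} (l , p , q) =
    to π l , trans (⟦⟧ₑ-· E π ρ) (cong (π ·ⱽ_) p) , λ x →
      trans (cong (Maybe.map (π ·ᶜ_)) (q (from π x)))
        (trans (singleton-· π l (⟦ E₀ ⟧ₑ ρ , ⟦ E₁ ⟧ₑ ρ) x)
          (cong (λ c → lookup [ to π l ↦ c ]ʰ x) (sym (cong₂ _,_ (⟦⟧ₑ-· E₀ π ρ) (⟦⟧ₑ-· E₁ π ρ)))))
  ⟦⟧ₐ-· emp π p = λ x → cong (Maybe.map (π ·ᶜ_)) (p (from π x))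
  ⟦⟧ₐ-· (P ∗ Q) π {h = h} (h₁ , h₂ , s , p , q) =
    π ·ʰ h₁ , π ·ʰ h₂ , ⊎ʰ-· π {h} {h₁} {h₂} s , ⟦⟧ₐ-· P π p , ⟦⟧ₐ-· Q π q
  ⟦⟧ₐ-· (P ∧ᵃ Q) π (p , q) = ⟦⟧ₐ-· P π p , ⟦⟧ₐ-· Q π q
  ⟦⟧ₐ-· {Δ} (¬ᵃ P) π {ρ} {h} ¬p p = ¬p
    (subst (λ ρ′ → ⟦ P ⟧ₐ ρ′ h) (FMCpo.π⁻¹·π· ⟦ Δ ⟧ᵈ π ρ)
      (⟦⟧ₐ-resp P (Heapᶜ.π⁻¹·π· π h) (⟦⟧ₐ-· P (π ⁻¹) p)))
  ⟦⟧ₐ-· (∃ᵃ P) π (v , p) = π ·ⱽ v , ⟦⟧ₐ-· P π p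

  -- For a subset D₀ of D, the relation eq(D₀).
  Eq : (D : FMCpo) → (∣ D ∣ → Set) → ∣ D ∣ → ∣ D ∣ → Set
  Eq D D₀ d d′ = FMCpo._≈_ D d d′ × D₀ d

  -- resp: heaps are compared by _≈ʰ_, so a relation on heaps has to respect it.
  record 𝓡 : Set₁ where
    no-eta-equality
    field
      rel     : Heap → Heap → Set
      resp    : ∀ {h₀ h₀′ h₁ h₁′} → h₀ ≈ʰ h₀′ → h₁ ≈ʰ h₁′ → rel h₀ h₁ → rel h₀′ h₁′
      finSupp : ∃[ L ] ∀ π → π Fixes L → ∀ h₀ h₁ → rel h₀ h₁ ⇔ rel (π ·ʰ h₀) (π ·ʰ h₁)

  open 𝓡 public using (rel)

  -- One direction of the support condition gives the other, using π⁻¹.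
  supp-⇔ : ∀ {L} {R : Heap → Heap → Set} →
    (∀ {h₀ h₀′ h₁ h₁′} → h₀ ≈ʰ h₀′ → h₁ ≈ʰ h₁′ → R h₀ h₁ → R h₀′ h₁′) →
    (∀ π → π Fixes L → ∀ h₀ h₁ → R h₀ h₁ → R (π ·ʰ h₀) (π ·ʰ h₁)) →
    ∀ π → π Fixes L → ∀ h₀ h₁ → R h₀ h₁ ⇔ R (π ·ʰ h₀) (π ·ʰ h₁)
  supp-⇔ resp f π fx h₀ h₁ = mk⇔ (f π fx h₀ h₁) λ r →
    resp (Heapᶜ.π⁻¹·π· π h₀) (Heapᶜ.π⁻¹·π· π h₁) (f (π ⁻¹) (Fixes-⁻¹ {π} fx) _ _ r)

  eqᴿ : Asn Δ → Stack Δ → 𝓡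
  eqᴿ {Δ} P ρ = record
    { rel     = Eq Heapᶜ (⟦ P ⟧ₐ ρ)
    ; resp    = λ {a b c d} → resp {a} {b} {c} {d}
    ; finSupp = FMCpo.supp ⟦ Δ ⟧ᵈ ρ , supp-⇔ {R = Eq Heapᶜ (⟦ P ⟧ₐ ρ)} (λ {a b c d} → resp {a} {b} {c} {d}) λ π fx h₀ h₁ (e , p) →
        Heapᶜ.·-cong₂ π {h₀} {h₁} e ,
        subst (λ ρ′ → ⟦ P ⟧ₐ ρ′ (π ·ʰ h₀)) (proj₂ (FMCpo.finSupp ⟦ Δ ⟧ᵈ ρ) π fx) (⟦⟧ₐ-· P π p)
    }
    where
    resp : ∀ {h₀ h₀′ h₁ h₁′} → h₀ ≈ʰ h₀′ → h₁ ≈ʰ h₁′ →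
           Eq Heapᶜ (⟦ P ⟧ₐ ρ) h₀ h₁ → Eq Heapᶜ (⟦ P ⟧ₐ ρ) h₀′ h₁′
    resp e e′ (q , p) = (λ l → trans (sym (e l)) (trans (q l) (e′ l))) , ⟦⟧ₐ-resp P e p

  infixl 6 _∗ᴿ_
  _∗ᴿ_ : 𝓡 → 𝓡 → 𝓡
  r ∗ᴿ s = record
    { rel     = R
    ; resp    = λ {a b c d} → resp {a} {b} {c} {d}
    ; finSupp = proj₁ (𝓡.finSupp r) ++ proj₁ (𝓡.finSupp s) , supp-⇔ {R = R} (λ {a b c d} → resp {a} {b} {c} {d})
        λ π fx h₀ h₁ (n₀ , m₀ , n₁ , m₁ , s₀ , s₁ , p , q) →
          π ·ʰ n₀ , π ·ʰ m₀ , π ·ʰ n₁ , π ·ʰ m₁ , ⊎ʰ-· π {h₀} {n₀} {m₀} s₀ , ⊎ʰ-· π {h₁} {n₁} {m₁} s₁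
          , Equivalence.to (proj₂ (𝓡.finSupp r) π (Fixes-++ˡ {π} fx) n₀ n₁) p
          , Equivalence.to (proj₂ (𝓡.finSupp s) π (Fixes-++ʳ {π} (proj₁ (𝓡.finSupp r)) fx) m₀ m₁) q
    }
    where
    R : Heap → Heap → Set
    R h₀ h₁ = ∃[ n₀ ] ∃[ m₀ ] ∃[ n₁ ] ∃[ m₁ ]
      h₀ ≈ n₀ ⊎ʰ m₀ × h₁ ≈ n₁ ⊎ʰ m₁ × rel r n₀ n₁ × rel s m₀ m₁
    resp : ∀ {h₀ h₀′ h₁ h₁′} → h₀ ≈ʰ h₀′ → h₁ ≈ʰ h₁′ → R h₀ h₁ → R h₀′ h₁′
    resp e e′ (n₀ , m₀ , n₁ , m₁ , (d₀ , s₀) , (d₁ , s₁) , p , q) =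
      n₀ , m₀ , n₁ , m₁ , (d₀ , λ l → trans (sym (e l)) (s₀ l))
                        , (d₁ , λ l → trans (sym (e′ l)) (s₁ l)) , p , q

  _[_→eqG]_ : Cont → 𝓡 → Cont → Set
  k₀ [ r →eqG] k₁ = ∀ h₀ h₁ → rel r h₀ h₁ → Eq Oᶜ G (k₀ ⟨$⟩ h₀) (k₁ ⟨$⟩ h₁)

  Quadruple : 𝓡 → ∣ ⟦ com ⟧ᵗ ∣ → ∣ ⟦ com ⟧ᵗ ∣ → 𝓡 → Set₁
  Quadruple r c₀ c₁ s = ∀ (r′ : 𝓡) (h₀ h₁ : Heap) (k₀ k₁ : Cont) →
    rel (r ∗ᴿ r′) h₀ h₁ → k₀ [ s ∗ᴿ r′ →eqG] k₁ →
    Eq Oᶜ G (c₀ ⟨$⟩ (h₀ , k₀)) (c₁ ⟨$⟩ (h₁ , k₁))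

  infix 0 ⟨_,_,_,_⟩⊨_
  ⟨_,_,_,_⟩⊨_ : Stack Δ → ∣ ⟦ Γ ⟧ᵍ ∣ → ∣ ⟦ Γ ⟧ᵍ ∣ → 𝓡 → Spec Δ Γ → Set₁
  ⟨ ρ , η₀ , η₁ , r ⟩⊨ ⟪ P ⟫ M ⟪ Q ⟫ =
    Quadruple (eqᴿ P ρ ∗ᴿ r) (⟦ M ⟧ ρ η₀) (⟦ M ⟧ ρ η₁) (eqᴿ Q ρ ∗ᴿ r)
  ⟨ ρ , η₀ , η₁ , r ⟩⊨ φ ⊗ P    = ⟨ ρ , η₀ , η₁ , r ∗ᴿ eqᴿ P ρ ⟩⊨ φ
  ⟨ ρ , η₀ , η₁ , r ⟩⊨ E ≐ₑ F   = Lift _ (⟦ E ⟧ₑ ρ ≡ ⟦ F ⟧ₑ ρ)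
  ⟨ ρ , η₀ , η₁ , r ⟩⊨ _≐ₜ_ {τ = τ} M N =
    Lift _ ((⟦ M ⟧ ρ η₀ ≈ ⟦ N ⟧ ρ η₀) × (⟦ M ⟧ ρ η₁ ≈ ⟦ N ⟧ ρ η₁))
    where open FMCpo ⟦ τ ⟧ᵗ using (_≈_)
  ⟨ ρ , η₀ , η₁ , r ⟩⊨ φ ∧ˢ ψ   = (⟨ ρ , η₀ , η₁ , r ⟩⊨ φ) × (⟨ ρ , η₀ , η₁ , r ⟩⊨ ψ)
  ⟨ ρ , η₀ , η₁ , r ⟩⊨ φ ∨ˢ ψ   = (⟨ ρ , η₀ , η₁ , r ⟩⊨ φ) ⊎ (⟨ ρ , η₀ , η₁ , r ⟩⊨ ψ)
  ⟨ ρ , η₀ , η₁ , r ⟩⊨ φ ⇒ˢ ψ   =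
    ∀ (s : 𝓡) → (⟨ ρ , η₀ , η₁ , r ∗ᴿ s ⟩⊨ φ) → (⟨ ρ , η₀ , η₁ , r ∗ᴿ s ⟩⊨ ψ)
  ⟨ ρ , η₀ , η₁ , r ⟩⊨ ∀ₜ τ φ   = ∀ (m n : ∣ ⟦ τ ⟧ᵗ ∣) → ⟨ ρ , (η₀ , m) , (η₁ , n) , r ⟩⊨ φ
  ⟨ ρ , η₀ , η₁ , r ⟩⊨ ∃ₜ τ φ   = ∃[ m ] ∃[ n ] (⟨ ρ , (η₀ , m) , (η₁ , n) , r ⟩⊨ φ)
  ⟨ ρ , η₀ , η₁ , r ⟩⊨ ∀ᵥ φ     = ∀ (v : Val) → ⟨ v ∷ ρ , η₀ , η₁ , r ⟩⊨ φ
  ⟨ ρ , η₀ , η₁ , r ⟩⊨ ∃ᵥ φ     = ∃[ v ] (⟨ v ∷ ρ , η₀ , η₁ , r ⟩⊨ φ)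

  Valid : Spec Δ Γ → Set₁
  Valid {Δ} {Γ} φ = ∀ (ρ : Stack Δ) (η₀ η₁ : ∣ ⟦ Γ ⟧ᵍ ∣) (r : 𝓡) → ⟨ ρ , η₀ , η₁ , r ⟩⊨ φ

  record Judgement : Set where
    constructor [_∣_]⊢_
    field
      stackVars : ℕ
      tyEnv     : TyEnv
      spec      : Spec stackVars tyEnv

  infix 0 [_∣_]⊢_

  ⊢_ : Spec Δ Γ → Judgement
  ⊢ φ = [ _ ∣ _ ]⊢ φ

  infix 0 ⊢_

  ValidJ : Judgement → Set₁
  ValidJ ([ Δ ∣ Γ ]⊢ φ) = Valid φ

  infix 4 _⊆ₐ_
  _⊆ₐ_ : Asn Δ → Asn Δ → Set
  _⊆ₐ_ {Δ} P Q = ∀ (ρ : Stack Δ) h → ⟦ P ⟧ₐ ρ h → ⟦ Q ⟧ₐ ρ h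

  -- Rule js φ: from the premises js infer φ.  First-order intuitionistic
  -- logic with equality is given by a Hilbert system.
  data Rule {Δ : ℕ} {Γ : TyEnv} : List Judgement → Spec Δ Γ → Set where

    ⇒-mp : ∀ {φ ψ : Spec Δ Γ} → Rule ((⊢ φ) ∷ (⊢ φ ⇒ˢ ψ) ∷ []) ψ
    ⇒-K  : ∀ {φ ψ : Spec Δ Γ} → Rule [] (φ ⇒ˢ ψ ⇒ˢ φ)
    ⇒-S  : ∀ {φ ψ χ : Spec Δ Γ} → Rule [] ((φ ⇒ˢ ψ ⇒ˢ χ) ⇒ˢ (φ ⇒ˢ ψ) ⇒ˢ φ ⇒ˢ χ)
    ∧-i  : ∀ {φ ψ : Spec Δ Γ} → Rule [] (φ ⇒ˢ ψ ⇒ˢ φ ∧ˢ ψ)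
    ∧-e₁ : ∀ {φ ψ : Spec Δ Γ} → Rule [] (φ ∧ˢ ψ ⇒ˢ φ)
    ∧-e₂ : ∀ {φ ψ : Spec Δ Γ} → Rule [] (φ ∧ˢ ψ ⇒ˢ ψ)
    ∨-i₁ : ∀ {φ ψ : Spec Δ Γ} → Rule [] (φ ⇒ˢ φ ∨ˢ ψ)
    ∨-i₂ : ∀ {φ ψ : Spec Δ Γ} → Rule [] (ψ ⇒ˢ φ ∨ˢ ψ)
    ∨-e  : ∀ {φ ψ χ : Spec Δ Γ} → Rule [] ((φ ⇒ˢ χ) ⇒ˢ (ψ ⇒ˢ χ) ⇒ˢ φ ∨ˢ ψ ⇒ˢ χ)

    ∀ᵥ-i : ∀ {φ : Spec Δ Γ} {ψ} → Rule ((⊢ ↑ₛ φ ⇒ˢ ψ) ∷ []) (φ ⇒ˢ ∀ᵥ ψ)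
    ∀ᵥ-e : ∀ {φ : Spec (suc Δ) Γ} E → Rule [] (∀ᵥ φ ⇒ˢ φ [ E /i])
    ∃ᵥ-i : ∀ {φ : Spec (suc Δ) Γ} E → Rule [] (φ [ E /i] ⇒ˢ ∃ᵥ φ)
    ∃ᵥ-e : ∀ {φ : Spec (suc Δ) Γ} {ψ} → Rule ((⊢ φ ⇒ˢ ↑ₛ ψ) ∷ []) (∃ᵥ φ ⇒ˢ ψ)
    ∀ₜ-i : ∀ {φ : Spec Δ Γ} {ψ} → Rule ((⊢ ⇑ₛ φ ⇒ˢ ψ) ∷ []) (φ ⇒ˢ ∀ₜ τ ψ)
    ∀ₜ-e : ∀ {φ : Spec Δ (τ ∷ Γ)} M → Rule [] (∀ₜ τ φ ⇒ˢ φ [ M /x])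
    ∃ₜ-i : ∀ {φ : Spec Δ (τ ∷ Γ)} M → Rule [] (φ [ M /x] ⇒ˢ ∃ₜ τ φ)
    ∃ₜ-e : ∀ {φ : Spec Δ (τ ∷ Γ)} {ψ} → Rule ((⊢ φ ⇒ˢ ⇑ₛ ψ) ∷ []) (∃ₜ τ φ ⇒ˢ ψ)

    ≐ₑ-refl  : ∀ E → Rule [] (E ≐ₑ E)
    ≐ₑ-subst : ∀ (φ : Spec (suc Δ) Γ) {E F} → Rule [] (E ≐ₑ F ⇒ˢ φ [ E /i] ⇒ˢ φ [ F /i])
    ≐ₜ-refl  : ∀ (M : Tm Δ Γ τ) → Rule [] (M ≐ₜ M)
    ≐ₜ-subst : ∀ (φ : Spec Δ (τ ∷ Γ)) {M N} → Rule [] (M ≐ₜ N ⇒ˢ φ [ M /x] ⇒ˢ φ [ N /x])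

    triple-∃ : ∀ {P Q : Asn (suc Δ)} {M : Tm Δ Γ com} →
      Rule [] (∀ᵥ (⟪ P ⟫ ↑ₜ M ⟪ Q ⟫) ⇒ˢ ⟪ ∃ᵃ P ⟫ M ⟪ ∃ᵃ Q ⟫)
    triple-∨ : ∀ {P P′ Q Q′ : Asn Δ} {M : Tm Δ Γ com} →
      Rule [] (⟪ P ⟫ M ⟪ Q ⟫ ∧ˢ ⟪ P′ ⟫ M ⟪ Q′ ⟫ ⇒ˢ ⟪ P ∨ᵃ P′ ⟫ M ⟪ Q ∨ᵃ Q′ ⟫)
    triple-if : ∀ {P Q : Asn Δ} {E F} {M N : Tm Δ Γ com} →
      Rule [] (⟪ P ∧ᵃ (E ≐ᵃ F) ⟫ M ⟪ Q ⟫ ∧ˢ ⟪ P ∧ᵃ (E ≠ᵃ F) ⟫ N ⟪ Q ⟫ ⇒ˢ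
               ⟪ P ⟫ (if E ≟ F then M else N) ⟪ Q ⟫)
    triple-⨾ : ∀ {P P₀ Q : Asn Δ} {M N : Tm Δ Γ com} →
      Rule [] (⟪ P ⟫ M ⟪ P₀ ⟫ ∧ˢ ⟪ P₀ ⟫ N ⟪ Q ⟫ ⇒ˢ ⟪ P ⟫ (M ⨾ N) ⟪ Q ⟫)
    triple-new : ∀ {P Q : Asn Δ} {M : Tm (suc Δ) Γ com} →
      Rule [] (∀ᵥ (⟪ ↑ₐ P ∗ (svar zero ↦ zeroₑ , zeroₑ) ⟫ M ⟪ ↑ₐ Q ⟫) ⇒ˢ ⟪ P ⟫ letnew M ⟪ Q ⟫)
    triple-get : ∀ {P : Asn (suc Δ)} {E : Exp Δ} {E₁ : Exp (suc Δ)} {Q : Asn Δ} {M : Tm (suc Δ) Γ com} →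
      Rule [] (∀ᵥ (⟪ P ∗ (↑ₑ E ↦ svar zero , E₁) ⟫ M ⟪ ↑ₐ Q ⟫) ⇒ˢ
               ⟪ ∃ᵃ (P ∗ (↑ₑ E ↦ svar zero , E₁)) ⟫ letget E f₀ M ⟪ Q ⟫)
    triple-free : ∀ E → Rule [] (⟪ E ↦- ⟫ free E ⟪ emp ⟫)
    triple-≔ : ∀ E E₁ F → Rule [] (⟪ E ↦-, E₁ ⟫ (E ∙ f₀ ≔ F) ⟪ E ↦ F , E₁ ⟫)
    consequence : ∀ {P P′ Q Q′ : Asn Δ} {M : Tm Δ Γ com} → P ⊆ₐ P′ → Q′ ⊆ₐ Q →
      Rule [] (⟪ P′ ⟫ M ⟪ Q′ ⟫ ⇒ˢ ⟪ P ⟫ M ⟪ Q ⟫)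

    ⊗-i      : ∀ {φ : Spec Δ Γ} {P} → Rule [] (φ ⇒ˢ φ ⊗ P)
    ⊗-triple : ∀ {P P′ Q : Asn Δ} {M : Tm Δ Γ com} →
      Rule [] ((⟪ P ⟫ M ⟪ P′ ⟫) ⊗ Q ⇔ˢ ⟪ P ∗ Q ⟫ M ⟪ P′ ∗ Q ⟫)
    ⊗-≐ₑ     : ∀ {E F Q} → Rule [] ((E ≐ₑ F) ⊗ Q ⇔ˢ (E ≐ₑ F))
    ⊗-≐ₜ     : ∀ {M N : Tm Δ Γ τ} {Q} → Rule [] ((M ≐ₜ N) ⊗ Q ⇔ˢ (M ≐ₜ N))
    ⊗-⊗      : ∀ {φ : Spec Δ Γ} {P Q} → Rule [] (φ ⊗ P ⊗ Q ⇔ˢ φ ⊗ (P ∗ Q))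
    ⊗-⇒      : ∀ {φ ψ : Spec Δ Γ} {P} → Rule [] ((φ ⇒ˢ ψ) ⊗ P ⇔ˢ (φ ⊗ P ⇒ˢ ψ ⊗ P))
    ⊗-∧      : ∀ {φ ψ : Spec Δ Γ} {P} → Rule [] ((φ ∧ˢ ψ) ⊗ P ⇔ˢ φ ⊗ P ∧ˢ ψ ⊗ P)
    ⊗-∨      : ∀ {φ ψ : Spec Δ Γ} {P} → Rule [] ((φ ∨ˢ ψ) ⊗ P ⇔ˢ φ ⊗ P ∨ˢ ψ ⊗ P)
    ⊗-∀ₜ     : ∀ {φ : Spec Δ (τ ∷ Γ)} {P} → Rule [] (∀ₜ τ φ ⊗ P ⇔ˢ ∀ₜ τ (φ ⊗ P))
    ⊗-∃ₜ     : ∀ {φ : Spec Δ (τ ∷ Γ)} {P} → Rule [] (∃ₜ τ φ ⊗ P ⇔ˢ ∃ₜ τ (φ ⊗ P))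
    ⊗-∀ᵥ     : ∀ {φ : Spec (suc Δ) Γ} {P} → Rule [] (∀ᵥ φ ⊗ P ⇔ˢ ∀ᵥ (φ ⊗ ↑ₐ P))
    ⊗-∃ᵥ     : ∀ {φ : Spec (suc Δ) Γ} {P} → Rule [] (∃ᵥ φ ⊗ P ⇔ˢ ∃ᵥ (φ ⊗ ↑ₐ P))

    fixpoint-induction : ∀ (γ : SpecCtx τ Δ Γ) (M : Tm Δ Γ (τ ⇒ τ)) →
      Rule [] (∀ₜ τ (fillₛ (⇑ˢᶜ γ) (ident (here refl)) ⇒ˢ fillₛ (⇑ˢᶜ γ) (⇑ₜ M ·ₜ ident (here refl)))
               ⇒ˢ fillₛ γ (fix M))

{-# OPTIONS --safe #-}
module Submission where

open import Algebra.Bundles using (CommutativeMonoid)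
import Algebra.Properties.CommutativeSemigroup as CommutativeSemigroupProperties
open import Axiom.ExcludedMiddle using (ExcludedMiddle)
open import Data.Bool.Base using (true; false)
import Data.Fin.Base as Fin
open import Data.Fin.Base using (zero; suc)
open import Data.Integer.Base using (0ℤ)
open import Data.List.Base using (List; []; _∷_; _++_)
open import Data.List.Membership.Propositional using (_∈_; _∉_)
open import Data.List.Membership.Propositional.Properties using (∈-++⁺ˡ; ∈-++⁺ʳ)
open import Data.List.Relation.Unary.All using (All; []; _∷_)
open import Data.List.Relation.Unary.Any using (here; there)
open import Data.Maybe.Base as Maybe using (Maybe; just; nothing; _<∣>_)
import Data.Maybe.Properties as Maybe
open import Data.Nat.Base using (ℕ; zero; suc)
open import Data.Product.Base using (_×_; _,_; proj₁; proj₂; ∃; ∃-syntax)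
open import Data.Product.Function.NonDependent.Propositional using (_×-⇔_)
open import Data.Sum.Base as Sum using (_⊎_; inj₁; inj₂; [_,_]′)
open import Data.Sum.Function.Propositional using (_⊎-⇔_)
open import Data.Vec.Base as Vec using ([]; _∷_)
open import Function.Base using (_∘_; id)
open import Function.Bundles using (_↔_; _⇔_; mk⇔; Equivalence)
open import Function.Construct.Identity using (⇔-id)
open import Function.Related.TypeIsomorphisms using (→-cong-⇔; ¬-cong-⇔)
open import Level using (0ℓ; Level; Lift; lift; lower) renaming (suc to lsuc)
open import Relation.Binary.PropositionalEquality using (_≡_; refl; sym; trans; cong; cong₂)
open import Relation.Nullary.Decidable.Core using (yes; no; does)
open import Relation.Nullary.Negation.Core using (contradiction)
open import Defs

-- Satisfaction is monotone along r ≼ r′ :⇔ r ∗ t ≃ r′ for some t, because the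
-- frame a quadruple quantifies over can absorb t; as relations form a commutative monoid
-- under ∗ up to ≃, this makes ⇒ a Kripke implication and ⊗ a change of world,
-- which accounts for the logical rules and for invariant extension.  The
-- quantifier rules rest on substitution lemmas.  For allocation one location
-- is chosen outside the supports of both configurations.  For fixed-point
-- induction, a context is strict and continuous in its hole and triples are
-- closed under lubs of chains, since eq(G) is; so γ passes from ⊥ through the
-- Kleene iterates to fix M.

-- Meanings are compared only up to the setoid equality of their domain, so a world or an
-- environment can be exchanged only by a lemma saying that satisfaction respects the exchange. For
-- renaming and substitution these lemmas are equivalences, because a formula also occurs to the
-- left of `⇒ˢ` and an assertion under `¬ᵃ`. A triple excludes errors because `err` is not in `G`.
-- The rules for heap commands therefore have to find the addressed cell in both heaps; the two runs
-- share the stack, hence the address. On the other hand `⊥ₒ` is in `G`, so two diverging runs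
-- satisfy every triple, and this is what starts fixed-point induction.

private variable
  a b ℓ : Level

∃-⇔ : {I : Set a} {A : I → Set b} {B : I → Set ℓ} → (∀ i → A i ⇔ B i) → ∃ A ⇔ ∃ B
∃-⇔ e = mk⇔ (λ (i , x) → i , Equivalence.to (e i) x) (λ (i , y) → i , Equivalence.from (e i) y)

∀-⇔ : {I : Set a} {A : I → Set b} {B : I → Set ℓ} → (∀ i → A i ⇔ B i) → (∀ i → A i) ⇔ (∀ i → B i)
∀-⇔ e = mk⇔ (λ f i → Equivalence.to (e i) (f i)) (λ g i → Equivalence.from (e i) (g i))

≡⇒⇔ : {A B : Set a} → A ≡ B → A ⇔ B
≡⇒⇔ refl = ⇔-id _

Lift-⇔ : {A B : Set a} → A ⇔ B → Lift ℓ A ⇔ Lift ℓ B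
Lift-⇔ e = mk⇔ (lift ∘ Equivalence.to e ∘ lower) (lift ∘ Equivalence.from e ∘ lower)

module Soundness (Loc : Set) (Loc↔ℕ : Loc ↔ ℕ) (em : ExcludedMiddle 0ℓ) where
  open Semantics Loc Loc↔ℕ em

  -- Renaming and substitution

  infix 4 ≈-syntax
  ≈-syntax : (A : FMCpo) → ∣ A ∣ → ∣ A ∣ → Set
  ≈-syntax = FMCpo._≈_
  syntax ≈-syntax A a b = a ≈[ A ] b

  -- A record, unlike the equality it wraps, does not compute, so M, M′ and the
  -- environments can be inferred from it.
  infix 4 _⊩_≅_⊩_
  record _⊩_≅_⊩_ {Δ Γ Δ′ Γ′ τ} (e : ∣ Env Δ Γ ∣) (M : Tm Δ Γ τ)
                 (M′ : Tm Δ′ Γ′ τ) (e′ : ∣ Env Δ′ Γ′ ∣) : Set where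
    constructor equal
    field
      equality : fun ⟦ M ⟧ᴹ e ≈[ ⟦ τ ⟧ᵗ ] fun ⟦ M′ ⟧ᴹ e′

  open _⊩_≅_⊩_ public

  module _ {Δ Δ′ Γ Γ′} {ρ : Stack Δ} {ρ′ : Stack Δ′} {η : ∣ ⟦ Γ ⟧ᵍ ∣} {η′ : ∣ ⟦ Γ′ ⟧ᵍ ∣} where
    private
      infix 4 _≅_
      _≅_ : Tm Δ Γ τ → Tm Δ′ Γ′ τ → Set
      M ≅ M′ = (ρ , η) ⊩ M ≅ M′ ⊩ (ρ′ , η′)

    ƛᵥ-cong : ∀ {M : Tm (suc Δ) Γ τ} {M′} → (∀ v → (v ∷ ρ , η) ⊩ M ≅ M′ ⊩ (v ∷ ρ′ , η′)) → ƛᵥ M ≅ ƛᵥ M′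
    ƛᵥ-cong p = equal λ v → equality (p v)

    ·ᵥ-cong : ∀ {M : Tm Δ Γ (val⇒ τ)} {M′ E E′} → M ≅ M′ → ⟦ E ⟧ₑ ρ ≡ ⟦ E′ ⟧ₑ ρ′ → M ·ᵥ E ≅ M′ ·ᵥ E′
    ·ᵥ-cong {τ} {M} {M′} {E} {E′} (equal p) q =
      equal (FMCpo.Eq.trans ⟦ τ ⟧ᵗ (p (⟦ E ⟧ₑ ρ)) (Fun.resp (⟦ M′ ⟧ ρ′ η′) q))

    ƛₜ-cong : ∀ {M : Tm Δ (σ ∷ Γ) τ} {M′} → (∀ m → (ρ , (η , m)) ⊩ M ≅ M′ ⊩ (ρ′ , (η′ , m))) → ƛₜ M ≅ ƛₜ M′
    ƛₜ-cong p = equal λ m → equality (p m)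

    ·ₜ-cong : ∀ {M : Tm Δ Γ (σ ⇒ τ)} {M′ N N′} → M ≅ M′ → N ≅ N′ → M ·ₜ N ≅ M′ ·ₜ N′
    ·ₜ-cong {σ} {τ} {M} {M′} {N} {N′} (equal p) (equal q) = equal
      (FMCpo.Eq.trans ⟦ τ ⟧ᵗ (p (⟦ N ⟧ ρ η)) (Fun.resp (⟦ M′ ⟧ ρ′ η′) {⟦ N ⟧ ρ η} {⟦ N′ ⟧ ρ′ η′} q))

    fix-cong : ∀ {M : Tm Δ Γ (τ ⇒ τ)} {M′} → M ≅ M′ → fix M ≅ fix M′
    fix-cong {τ} {M} {M′} (equal p) =
      equal (_⟶_.resp (fixᴹ (pointed τ)) {⟦ M ⟧ ρ η} {⟦ M′ ⟧ ρ′ η′} p)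

    ifᵗ-cong : ∀ {E F E′ F′} {M N : Tm Δ Γ com} {M′ N′} → ⟦ E ⟧ₑ ρ ≡ ⟦ E′ ⟧ₑ ρ′ → ⟦ F ⟧ₑ ρ ≡ ⟦ F′ ⟧ₑ ρ′ →
      M ≅ M′ → N ≅ N′ → (if E ≟ F then M else N) ≅ (if E′ ≟ F′ then M′ else N′)
    ifᵗ-cong {E} {F} {E′} {F′} {M} {N} {M′} {N′} p q (equal e) (equal f) = equal go
      where
      go : ⟦ if E ≟ F then M else N ⟧ ρ η ≈[ ⟦ com ⟧ᵗ ] ⟦ if E′ ≟ F′ then M′ else N′ ⟧ ρ′ η′
      go c rewrite p | q with does (⟦ E′ ⟧ₑ ρ′ ≟ᵥ ⟦ F′ ⟧ₑ ρ′)
      ... | true  = e c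
      ... | false = f c

    ⨾-cong : ∀ {M N : Tm Δ Γ com} {M′ N′} → M ≅ M′ → N ≅ N′ → (M ⨾ N) ≅ (M′ ⨾ N′)
    ⨾-cong {M} {N} {M′} {N′} (equal p) (equal q) = equal λ (h , k) → trans (p (h , _))
      (Fun.resp (⟦ M′ ⟧ ρ′ η′) ((λ _ → refl) , λ h′ → q (h′ , k)))

    -- The two sides may pick different fresh locations, as their configurations carry different
    -- supports. Independence of the choice moves both to one location outside both supports, where
    -- the hypothesis applies.
    letnew-cong : ∀ {M : Tm (suc Δ) Γ com} {M′} →
      (∀ v → (v ∷ ρ , η) ⊩ M ≅ M′ ⊩ (v ∷ ρ′ , η′)) → letnew M ≅ letnew M′
    letnew-cong {M} {M′} e = equal λ (h , k) →
      let c  = (ρ , η) , (h , k)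
          c′ = (ρ′ , η′) , (h , k)
          L  = S.supp c ++ S′.supp c′ in
      trans (Clauses.⟦letnew⟧ ρ η h k M (proj₂ (S.finSupp c)) (fresh-∉ L ∘ ∈-++⁺ˡ))
        (trans (equality (e (loc (fresh L))) _)
          (sym (Clauses.⟦letnew⟧ ρ′ η′ h k M′ (proj₂ (S′.finSupp c′)) (fresh-∉ L ∘ ∈-++⁺ʳ (S.supp c)))))
      where
      module S  = FMCpo (Conf (Env Δ Γ))
      module S′ = FMCpo (Conf (Env Δ′ Γ′))

    free-cong : ∀ {E E′} → ⟦ E ⟧ₑ ρ ≡ ⟦ E′ ⟧ₑ ρ′ → free E ≅ free E′
    free-cong e = equal λ (h , k) →
      cong (λ v → Maybe.maybe′ (λ _ → k ⟨$⟩ (h ∖ v)) err (cellAt h v)) e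

    letget-cong : ∀ {E E′ f} {M : Tm (suc Δ) Γ com} {M′} → ⟦ E ⟧ₑ ρ ≡ ⟦ E′ ⟧ₑ ρ′ →
      (∀ v → (v ∷ ρ , η) ⊩ M ≅ M′ ⊩ (v ∷ ρ′ , η′)) → letget E f M ≅ letget E′ f M′
    letget-cong {E} {E′} {f} {M} {M′} e p = equal go
      where
      go : ⟦ letget E f M ⟧ ρ η ≈[ ⟦ com ⟧ᵗ ] ⟦ letget E′ f M′ ⟧ ρ′ η′
      go (h , k) rewrite e with cellAt h (⟦ E′ ⟧ₑ ρ′)
      ... | just c  = equality (p (get f c)) (h , k)
      ... | nothing = refl

    ≔-cong : ∀ {E E′ f F F′} → ⟦ E ⟧ₑ ρ ≡ ⟦ E′ ⟧ₑ ρ′ → ⟦ F ⟧ₑ ρ ≡ ⟦ F′ ⟧ₑ ρ′ → (E ∙ f ≔ F) ≅ (E′ ∙ f ≔ F′)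
    ≔-cong {f = f} p q = equal λ (h , k) →
      cong₂ (λ v w → Maybe.maybe′ (λ c → k ⟨$⟩ (h [ v ≔ put f w c ]ʰ)) err (cellAt h v)) p q

  infix 4 _∼⟨_⟩ʳ_ _∼⟨_∣_⟩ʳ_

  _∼⟨_⟩ʳ_ : Stack Δ → SRen Δ Δ′ → Stack Δ′ → Set
  ρ ∼⟨ s ⟩ʳ ρ′ = ∀ i → Vec.lookup ρ′ (s i) ≡ Vec.lookup ρ i

  -- A relation is used instead of a reindexed environment: it passes under binders variable by
  -- variable and asks identifiers to agree only up to `≈`.
  record _∼⟨_∣_⟩ʳ_ {Δ Δ′ Γ Γ′} (e : ∣ Env Δ Γ ∣) (s : SRen Δ Δ′) (ξ : TRen Γ Γ′)
                   (e′ : ∣ Env Δ′ Γ′ ∣) : Set where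
    constructor mkʳ
    field
      svarʳ : proj₁ e ∼⟨ s ⟩ʳ proj₁ e′
      identʳ : ∀ {τ} (x : τ ∈ Γ) → fun (identᴹ (ξ x)) (proj₂ e′) ≈[ ⟦ τ ⟧ᵗ ] fun (identᴹ x) (proj₂ e)

  open _∼⟨_∣_⟩ʳ_ public

  lift-∼ : ∀ {s : SRen Δ Δ′} {ρ ρ′} v → ρ ∼⟨ s ⟩ʳ ρ′ → v ∷ ρ ∼⟨ Fin.lift 1 s ⟩ʳ v ∷ ρ′
  lift-∼ v e zero    = refl
  lift-∼ v e (suc i) = e i

  liftᵛʳ : ∀ {s : SRen Δ Δ′} {ξ : TRen Γ Γ′} {ρ ρ′ η η′} v →
    (ρ , η) ∼⟨ s ∣ ξ ⟩ʳ (ρ′ , η′) → (v ∷ ρ , η) ∼⟨ Fin.lift 1 s ∣ ξ ⟩ʳ (v ∷ ρ′ , η′)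
  liftᵛʳ v d = mkʳ (lift-∼ v (svarʳ d)) (identʳ d)

  liftᵗʳ : ∀ {s : SRen Δ Δ′} {ξ : TRen Γ Γ′} {ρ ρ′ η η′} (m : ∣ ⟦ σ ⟧ᵗ ∣) →
    (ρ , η) ∼⟨ s ∣ ξ ⟩ʳ (ρ′ , η′) → (ρ , (η , m)) ∼⟨ s ∣ liftᵗ {σ = σ} ξ ⟩ʳ (ρ′ , (η′ , m))
  liftᵗʳ {Γ = Γ} {σ = σ} {ξ = ξ} {η = η} {η′} m d = mkʳ (svarʳ d) go
    where
    go : ∀ {τ} (x : τ ∈ σ ∷ Γ) → fun (identᴹ (liftᵗ ξ x)) (η′ , m) ≈[ ⟦ τ ⟧ᵗ ] fun (identᴹ x) (η , m)
    go (here refl) = FMCpo.Eq.refl ⟦ σ ⟧ᵗ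
    go (there x)   = identʳ d x

  ⟦renₑ⟧ : ∀ (E : Exp Δ) {s : SRen Δ Δ′} {ρ ρ′} → ρ ∼⟨ s ⟩ʳ ρ′ → ⟦ renₑ s E ⟧ₑ ρ′ ≡ ⟦ E ⟧ₑ ρ
  ⟦renₑ⟧ (svar i) e = e i
  ⟦renₑ⟧ zeroₑ    e = refl
  ⟦renₑ⟧ oneₑ     e = refl
  ⟦renₑ⟧ -oneₑ    e = refl
  ⟦renₑ⟧ (E ⊞ F)  e = cong₂ addᵥ (⟦renₑ⟧ E e) (⟦renₑ⟧ F e)
  ⟦renₑ⟧ (E ⊟ F)  e = cong₂ subᵥ (⟦renₑ⟧ E e) (⟦renₑ⟧ F e)

  ⟦renₜ⟧ : ∀ (M : Tm Δ Γ τ) {s : SRen Δ Δ′} {ξ : TRen Γ Γ′} {ρ ρ′ η η′} →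
    (ρ , η) ∼⟨ s ∣ ξ ⟩ʳ (ρ′ , η′) → (ρ′ , η′) ⊩ renₜ s ξ M ≅ M ⊩ (ρ , η)
  ⟦renₜ⟧ (ident x) d = equal (identʳ d x)
  ⟦renₜ⟧ (ƛᵥ M)    d = ƛᵥ-cong λ v → ⟦renₜ⟧ M (liftᵛʳ v d)
  ⟦renₜ⟧ (M ·ᵥ E)  d = ·ᵥ-cong (⟦renₜ⟧ M d) (⟦renₑ⟧ E (svarʳ d))
  ⟦renₜ⟧ (ƛₜ M)    d = ƛₜ-cong λ m → ⟦renₜ⟧ M (liftᵗʳ m d)
  ⟦renₜ⟧ (M ·ₜ N)  d = ·ₜ-cong (⟦renₜ⟧ M d) (⟦renₜ⟧ N d)
  ⟦renₜ⟧ (fix M)   d = fix-cong (⟦renₜ⟧ M d)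
  ⟦renₜ⟧ (if E ≟ F then M else N) d =
    ifᵗ-cong (⟦renₑ⟧ E (svarʳ d)) (⟦renₑ⟧ F (svarʳ d)) (⟦renₜ⟧ M d) (⟦renₜ⟧ N d)
  ⟦renₜ⟧ (M ⨾ N)    d = ⨾-cong (⟦renₜ⟧ M d) (⟦renₜ⟧ N d)
  ⟦renₜ⟧ (letnew M) d = letnew-cong λ v → ⟦renₜ⟧ M (liftᵛʳ v d)
  ⟦renₜ⟧ (free E)   d = free-cong (⟦renₑ⟧ E (svarʳ d))
  ⟦renₜ⟧ (letget E f M) d = letget-cong (⟦renₑ⟧ E (svarʳ d)) λ v → ⟦renₜ⟧ M (liftᵛʳ v d)
  ⟦renₜ⟧ (E ∙ f ≔ F) d = ≔-cong (⟦renₑ⟧ E (svarʳ d)) (⟦renₑ⟧ F (svarʳ d))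

  weakenᵛʳ : ∀ {ρ : Stack Δ} {η : ∣ ⟦ Γ ⟧ᵍ ∣} v → _∼⟨_∣_⟩ʳ_ {Γ = Γ} {Γ} (ρ , η) suc id (v ∷ ρ , η)
  weakenᵛʳ v = mkʳ (λ _ → refl) λ {τ} _ → FMCpo.Eq.refl ⟦ τ ⟧ᵗ

  weakenᵗʳ : ∀ {ρ : Stack Δ} {η : ∣ ⟦ Γ ⟧ᵍ ∣} (m : ∣ ⟦ σ ⟧ᵗ ∣) →
    _∼⟨_∣_⟩ʳ_ {Γ′ = σ ∷ Γ} (ρ , η) id there (ρ , (η , m))
  weakenᵗʳ m = mkʳ (λ _ → refl) λ {τ} _ → FMCpo.Eq.refl ⟦ τ ⟧ᵗ

  infix 4 _∼⟨_⟩ˢ_ _∼⟨_∣_⟩ˢ_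

  _∼⟨_⟩ˢ_ : Stack Δ → SSub Δ Δ′ → Stack Δ′ → Set
  ρ ∼⟨ s ⟩ˢ ρ′ = ∀ i → ⟦ s i ⟧ₑ ρ′ ≡ Vec.lookup ρ i

  record _∼⟨_∣_⟩ˢ_ {Δ Δ′ Γ Γ′} (e : ∣ Env Δ Γ ∣) (s : SSub Δ Δ′) (t : TSub Δ′ Γ Γ′)
                   (e′ : ∣ Env Δ′ Γ′ ∣) : Set where
    constructor mkˢ
    field
      svarˢ : proj₁ e ∼⟨ s ⟩ˢ proj₁ e′
      identˢ : ∀ {τ} (x : τ ∈ Γ) → fun ⟦ t x ⟧ᴹ e′ ≈[ ⟦ τ ⟧ᵗ ] fun (identᴹ x) (proj₂ e)

  open _∼⟨_∣_⟩ˢ_ public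

  extˢ-∼ : ∀ {s : SSub Δ Δ′} {ρ ρ′} v → ρ ∼⟨ s ⟩ˢ ρ′ → v ∷ ρ ∼⟨ extˢ s ⟩ˢ v ∷ ρ′
  extˢ-∼ v e zero    = refl
  extˢ-∼ {s = s} v e (suc i) = trans (⟦renₑ⟧ (s i) λ _ → refl) (e i)

  -- A substituted term is weakened when it crosses a binder, so this step needs the renaming lemma
  -- for terms already in place.
  extᵛˢ : ∀ {s : SSub Δ Δ′} {t : TSub Δ′ Γ Γ′} {ρ ρ′ η η′} v →
    (ρ , η) ∼⟨ s ∣ t ⟩ˢ (ρ′ , η′) → (v ∷ ρ , η) ∼⟨ extˢ s ∣ ↑ₜ ∘ t ⟩ˢ (v ∷ ρ′ , η′)
  extᵛˢ {t = t} v d = mkˢ (extˢ-∼ v (svarˢ d)) λ {τ} x →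
    FMCpo.Eq.trans ⟦ τ ⟧ᵗ (equality (⟦renₜ⟧ (t x) (weakenᵛʳ v))) (identˢ d x)

  extᵗˢ : ∀ {s : SSub Δ Δ′} {t : TSub Δ′ Γ Γ′} {ρ ρ′ η η′} (m : ∣ ⟦ σ ⟧ᵗ ∣) →
    (ρ , η) ∼⟨ s ∣ t ⟩ˢ (ρ′ , η′) → (ρ , (η , m)) ∼⟨ s ∣ extᵗ {σ = σ} t ⟩ˢ (ρ′ , (η′ , m))
  extᵗˢ {Γ = Γ} {σ = σ} {t = t} {ρ′ = ρ′} {η = η} {η′} m d = mkˢ (svarˢ d) go
    where
    go : ∀ {τ} (x : τ ∈ σ ∷ Γ) → ⟦ extᵗ t x ⟧ ρ′ (η′ , m) ≈[ ⟦ τ ⟧ᵗ ] fun (identᴹ x) (η , m)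
    go (here refl)   = FMCpo.Eq.refl ⟦ σ ⟧ᵗ
    go {τ} (there x) = FMCpo.Eq.trans ⟦ τ ⟧ᵗ (equality (⟦renₜ⟧ (t x) (weakenᵗʳ m))) (identˢ d x)

  ⟦subₑ⟧ : ∀ (E : Exp Δ) {s : SSub Δ Δ′} {ρ ρ′} → ρ ∼⟨ s ⟩ˢ ρ′ → ⟦ subₑ s E ⟧ₑ ρ′ ≡ ⟦ E ⟧ₑ ρ
  ⟦subₑ⟧ (svar i) e = e i
  ⟦subₑ⟧ zeroₑ    e = refl
  ⟦subₑ⟧ oneₑ     e = refl
  ⟦subₑ⟧ -oneₑ    e = refl
  ⟦subₑ⟧ (E ⊞ F)  e = cong₂ addᵥ (⟦subₑ⟧ E e) (⟦subₑ⟧ F e)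
  ⟦subₑ⟧ (E ⊟ F)  e = cong₂ subᵥ (⟦subₑ⟧ E e) (⟦subₑ⟧ F e)

  ⟦subₜ⟧ : ∀ (M : Tm Δ Γ τ) {s : SSub Δ Δ′} {t : TSub Δ′ Γ Γ′} {ρ ρ′ η η′} →
    (ρ , η) ∼⟨ s ∣ t ⟩ˢ (ρ′ , η′) → (ρ′ , η′) ⊩ subₜ s t M ≅ M ⊩ (ρ , η)
  ⟦subₜ⟧ (ident x) d = equal (identˢ d x)
  ⟦subₜ⟧ (ƛᵥ M)    d = ƛᵥ-cong λ v → ⟦subₜ⟧ M (extᵛˢ v d)
  ⟦subₜ⟧ (M ·ᵥ E)  d = ·ᵥ-cong (⟦subₜ⟧ M d) (⟦subₑ⟧ E (svarˢ d))
  ⟦subₜ⟧ (ƛₜ M)    d = ƛₜ-cong λ m → ⟦subₜ⟧ M (extᵗˢ m d)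
  ⟦subₜ⟧ (M ·ₜ N)  d = ·ₜ-cong (⟦subₜ⟧ M d) (⟦subₜ⟧ N d)
  ⟦subₜ⟧ (fix M)   d = fix-cong (⟦subₜ⟧ M d)
  ⟦subₜ⟧ (if E ≟ F then M else N) d =
    ifᵗ-cong (⟦subₑ⟧ E (svarˢ d)) (⟦subₑ⟧ F (svarˢ d)) (⟦subₜ⟧ M d) (⟦subₜ⟧ N d)
  ⟦subₜ⟧ (M ⨾ N)    d = ⨾-cong (⟦subₜ⟧ M d) (⟦subₜ⟧ N d)
  ⟦subₜ⟧ (letnew M) d = letnew-cong λ v → ⟦subₜ⟧ M (extᵛˢ v d)
  ⟦subₜ⟧ (free E)   d = free-cong (⟦subₑ⟧ E (svarˢ d))
  ⟦subₜ⟧ (letget E f M) d = letget-cong (⟦subₑ⟧ E (svarˢ d)) λ v → ⟦subₜ⟧ M (extᵛˢ v d)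
  ⟦subₜ⟧ (E ∙ f ≔ F) d = ≔-cong (⟦subₑ⟧ E (svarˢ d)) (⟦subₑ⟧ F (svarˢ d))

  -- The meaning of a points-to assertion as a function of the address and the contents, so that
  -- equal values of the expressions give equal propositions by congruence.
  Points : Heap → Val → Cell → Set
  Points h v c = ∃[ l ] v ≡ loc l × h ≈ʰ [ l ↦ c ]ʰ

  ⟦renₐ⟧ : ∀ (P : Asn Δ) {s : SRen Δ Δ′} {ρ ρ′} → ρ ∼⟨ s ⟩ʳ ρ′ → ∀ h → ⟦ renₐ s P ⟧ₐ ρ′ h ⇔ ⟦ P ⟧ₐ ρ h
  ⟦renₐ⟧ (E ≐ᵃ F)    e h = ≡⇒⇔ (cong₂ _≡_ (⟦renₑ⟧ E e) (⟦renₑ⟧ F e))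
  ⟦renₐ⟧ (E ≤ᵃ F)    e h = ≡⇒⇔ (cong₂ _≤ᵥ_ (⟦renₑ⟧ E e) (⟦renₑ⟧ F e))
  ⟦renₐ⟧ (E ↦ F , G) e h = ≡⇒⇔ (cong₂ (Points h) (⟦renₑ⟧ E e) (cong₂ _,_ (⟦renₑ⟧ F e) (⟦renₑ⟧ G e)))
  ⟦renₐ⟧ emp         e h = ⇔-id _
  ⟦renₐ⟧ (P ∗ Q)     e h = ∃-⇔ λ h₁ → ∃-⇔ λ h₂ → ⇔-id _ ×-⇔ (⟦renₐ⟧ P e h₁ ×-⇔ ⟦renₐ⟧ Q e h₂)
  ⟦renₐ⟧ (P ∧ᵃ Q)    e h = ⟦renₐ⟧ P e h ×-⇔ ⟦renₐ⟧ Q e h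
  ⟦renₐ⟧ (¬ᵃ P)      e h = ¬-cong-⇔ (⟦renₐ⟧ P e h)
  ⟦renₐ⟧ (∃ᵃ P)      e h = ∃-⇔ λ v → ⟦renₐ⟧ P (lift-∼ v e) h

  ⟦subₐ⟧ : ∀ (P : Asn Δ) {s : SSub Δ Δ′} {ρ ρ′} → ρ ∼⟨ s ⟩ˢ ρ′ → ∀ h → ⟦ subₐ s P ⟧ₐ ρ′ h ⇔ ⟦ P ⟧ₐ ρ h
  ⟦subₐ⟧ (E ≐ᵃ F)    e h = ≡⇒⇔ (cong₂ _≡_ (⟦subₑ⟧ E e) (⟦subₑ⟧ F e))
  ⟦subₐ⟧ (E ≤ᵃ F)    e h = ≡⇒⇔ (cong₂ _≤ᵥ_ (⟦subₑ⟧ E e) (⟦subₑ⟧ F e))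
  ⟦subₐ⟧ (E ↦ F , G) e h = ≡⇒⇔ (cong₂ (Points h) (⟦subₑ⟧ E e) (cong₂ _,_ (⟦subₑ⟧ F e) (⟦subₑ⟧ G e)))
  ⟦subₐ⟧ emp         e h = ⇔-id _
  ⟦subₐ⟧ (P ∗ Q)     e h = ∃-⇔ λ h₁ → ∃-⇔ λ h₂ → ⇔-id _ ×-⇔ (⟦subₐ⟧ P e h₁ ×-⇔ ⟦subₐ⟧ Q e h₂)
  ⟦subₐ⟧ (P ∧ᵃ Q)    e h = ⟦subₐ⟧ P e h ×-⇔ ⟦subₐ⟧ Q e h
  ⟦subₐ⟧ (¬ᵃ P)      e h = ¬-cong-⇔ (⟦subₐ⟧ P e h)
  ⟦subₐ⟧ (∃ᵃ P)      e h = ∃-⇔ λ v → ⟦subₐ⟧ P (extˢ-∼ v e) h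

  -- The commutative monoid of relations

  ⊎ʰ-comm : ∀ {h} h₁ h₂ → h ≈ h₁ ⊎ʰ h₂ → h ≈ h₂ ⊎ʰ h₁
  ⊎ʰ-comm h₁ h₂ (d , e) = (λ l → Sum.swap (d l)) , λ l → trans (e l) (go (d l))
    where
    go : ∀ {x y : Maybe Cell} → x ≡ nothing ⊎ y ≡ nothing → (x <∣> y) ≡ (y <∣> x)
    go {y = nothing} (inj₁ refl) = refl
    go {y = just _}  (inj₁ refl) = refl
    go {x = nothing} (inj₂ refl) = refl
    go {x = just _}  (inj₂ refl) = refl

  -- At each location at most one of the three parts is defined. The union `•` is total and
  -- left-biased, so disjointness does not come with it and is derived location by location,
  -- including that of the new inner pair.
  ⊎ʰ-assoc : ∀ {h} h₁₂ h₁ h₂ h₃ → h ≈ h₁₂ ⊎ʰ h₃ → h₁₂ ≈ h₁ ⊎ʰ h₂ → h ≈ h₁ ⊎ʰ (h₂ • h₃) × h₂ # h₃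
  ⊎ʰ-assoc h₁₂ h₁ h₂ h₃ (d , e) (d′ , e′) =
    ((λ l → left (d l) (d′ l) (e′ l)) ,
     λ l → trans (e l) (trans (cong (_<∣> lookup h₃ l) (e′ l))
       (Maybe.<∣>-assoc (lookup h₁ l) (lookup h₂ l) (lookup h₃ l)))) ,
    λ l → right (lookup h₁ l) (d l) (d′ l) (e′ l)
    where
    left : ∀ {x y z w : Maybe Cell} → x ≡ nothing ⊎ w ≡ nothing → y ≡ nothing ⊎ z ≡ nothing → x ≡ (y <∣> z) →
           y ≡ nothing ⊎ (z <∣> w) ≡ nothing
    left p           (inj₁ q)    e = inj₁ q
    left (inj₂ refl) (inj₂ refl) e = inj₂ refl
    left {y = nothing} (inj₁ refl) (inj₂ refl) e = inj₁ refl
    right : ∀ {x z w : Maybe Cell} y → x ≡ nothing ⊎ w ≡ nothing → y ≡ nothing ⊎ z ≡ nothing → x ≡ (y <∣> z) →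
            z ≡ nothing ⊎ w ≡ nothing
    right y       (inj₂ p)    q        e = inj₂ p
    right y       (inj₁ p)    (inj₂ q) e = inj₁ q
    right nothing (inj₁ refl) (inj₁ q) e = inj₁ (sym e)

  infix 4 _⊆ᴿ_ _≃_

  _⊆ᴿ_ : 𝓡 → 𝓡 → Set
  r ⊆ᴿ s = ∀ h₀ h₁ → rel r h₀ h₁ → rel s h₀ h₁

  record _≃_ (r s : 𝓡) : Set where
    constructor mk≃
    field
      to≃   : r ⊆ᴿ s
      from≃ : s ⊆ᴿ r

  open _≃_ public

  ≃-refl : ∀ {r} → r ≃ r
  ≃-refl = mk≃ (λ _ _ → id) (λ _ _ → id)

  ≃-sym : ∀ {r s} → r ≃ s → s ≃ r
  ≃-sym (mk≃ p q) = mk≃ q p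

  ≃-trans : ∀ {r s t} → r ≃ s → s ≃ t → r ≃ t
  ≃-trans (mk≃ p q) (mk≃ p′ q′) = mk≃ (λ _ _ → p′ _ _ ∘ p _ _) (λ _ _ → q _ _ ∘ q′ _ _)

  -- As an instance of `eqᴿ` the unit inherits finite support and closure under `≈ʰ`. The stack is
  -- arbitrary, since `emp` does not read it.
  empᴿ : 𝓡
  empᴿ = eqᴿ emp []

  ∗ᴿ-mono : ∀ r r′ s s′ → r ⊆ᴿ r′ → s ⊆ᴿ s′ → r ∗ᴿ s ⊆ᴿ r′ ∗ᴿ s′
  ∗ᴿ-mono r r′ s s′ f g h₀ h₁ (n₀ , m₀ , n₁ , m₁ , s₀ , s₁ , p , q) =
    n₀ , m₀ , n₁ , m₁ , s₀ , s₁ , f _ _ p , g _ _ q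

  ∗ᴿ-cong : ∀ {r r′ s s′} → r ≃ r′ → s ≃ s′ → r ∗ᴿ s ≃ r′ ∗ᴿ s′
  ∗ᴿ-cong {r} {r′} {s} {s′} (mk≃ p q) (mk≃ p′ q′) = mk≃ (∗ᴿ-mono r r′ s s′ p p′) (∗ᴿ-mono r′ r s′ s q q′)

  ∗ᴿ-congʳ : ∀ {r r′} s → r ≃ r′ → r ∗ᴿ s ≃ r′ ∗ᴿ s
  ∗ᴿ-congʳ s e = ∗ᴿ-cong e (≃-refl {s})

  ∗ᴿ-congˡ : ∀ r {s s′} → s ≃ s′ → r ∗ᴿ s ≃ r ∗ᴿ s′
  ∗ᴿ-congˡ r e = ∗ᴿ-cong (≃-refl {r}) e

  ∗ᴿ-swap : ∀ r s → r ∗ᴿ s ⊆ᴿ s ∗ᴿ r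
  ∗ᴿ-swap r s h₀ h₁ (n₀ , m₀ , n₁ , m₁ , s₀ , s₁ , p , q) =
    m₀ , n₀ , m₁ , n₁ , ⊎ʰ-comm {h₀} n₀ m₀ s₀ , ⊎ʰ-comm {h₁} n₁ m₁ s₁ , q , p

  ∗ᴿ-comm : ∀ r s → r ∗ᴿ s ≃ s ∗ᴿ r
  ∗ᴿ-comm r s = mk≃ (∗ᴿ-swap r s) (∗ᴿ-swap s r)

  -- Only one inclusion is proved on heaps. The other follows by rotating the three factors:
  -- commutativity and the first inclusion alternate until `r ∗ᴿ (s ∗ᴿ t)` has become
  -- `(r ∗ᴿ s) ∗ᴿ t`.
  ∗ᴿ-assoc : ∀ r s t → (r ∗ᴿ s) ∗ᴿ t ≃ r ∗ᴿ (s ∗ᴿ t)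
  ∗ᴿ-assoc r s t = mk≃ (right r s t) λ h₀ h₁ →
    ∗ᴿ-swap t (r ∗ᴿ s) h₀ h₁ ∘ right t r s h₀ h₁ ∘ ∗ᴿ-swap s (t ∗ᴿ r) h₀ h₁ ∘
    right s t r h₀ h₁ ∘ ∗ᴿ-swap r (s ∗ᴿ t) h₀ h₁
    where
    right : ∀ r s t → (r ∗ᴿ s) ∗ᴿ t ⊆ᴿ r ∗ᴿ (s ∗ᴿ t)
    right r s t h₀ h₁ (n₀ , m₀ , n₁ , m₁ , s₀ , s₁ , (a₀ , b₀ , a₁ , b₁ , s₀′ , s₁′ , p , p′) , q) =
      let s₀″ , d₀ = ⊎ʰ-assoc {h₀} n₀ a₀ b₀ m₀ s₀ s₀′
          s₁″ , d₁ = ⊎ʰ-assoc {h₁} n₁ a₁ b₁ m₁ s₁ s₁′ in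
      a₀ , b₀ • m₀ , a₁ , b₁ • m₁ , s₀″ , s₁″ , p ,
      b₀ , m₀ , b₁ , m₁ , (d₀ , λ _ → refl) , (d₁ , λ _ → refl) , p′ , q

  ∗ᴿ-identityˡ : ∀ r → empᴿ ∗ᴿ r ≃ r
  ∗ᴿ-identityˡ r = mk≃
    (λ { _ _ (n₀ , m₀ , n₁ , m₁ , (_ , e₀) , (_ , e₁) , (n₀≈n₁ , n₀≈[]) , q) → 𝓡.resp r
      (λ l → sym (trans (e₀ l) (cong (_<∣> lookup m₀ l) (n₀≈[] l))))
      (λ l → sym (trans (e₁ l) (cong (_<∣> lookup m₁ l) (trans (sym (n₀≈n₁ l)) (n₀≈[] l))))) q })
    λ h₀ h₁ p → []ʰ , h₀ , []ʰ , h₁ , ((λ _ → inj₁ refl) , λ _ → refl) , ((λ _ → inj₁ refl) , λ _ → refl) ,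
      ((λ _ → refl) , λ _ → refl) , p

  ∗ᴿ-identityʳ : ∀ r → r ∗ᴿ empᴿ ≃ r
  ∗ᴿ-identityʳ r = ≃-trans (∗ᴿ-comm r empᴿ) (∗ᴿ-identityˡ r)

  ∗ᴿ-commutativeMonoid : CommutativeMonoid (lsuc 0ℓ) 0ℓ
  ∗ᴿ-commutativeMonoid = record
    { Carrier = 𝓡 ; _≈_ = _≃_ ; _∙_ = _∗ᴿ_ ; ε = empᴿ
    ; isCommutativeMonoid = record
      { isMonoid = record
        { isSemigroup = record
          { isMagma = record
            { isEquivalence = record { refl = ≃-refl ; sym = ≃-sym ; trans = ≃-trans }
            ; ∙-cong = ∗ᴿ-cong }
          ; assoc = ∗ᴿ-assoc }
        ; identity = ∗ᴿ-identityˡ , ∗ᴿ-identityʳ }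
      ; comm = ∗ᴿ-comm } }

  open CommutativeSemigroupProperties (CommutativeMonoid.commutativeSemigroup ∗ᴿ-commutativeMonoid) public
    using (xy∙z≈xz∙y; x∙yz≈xz∙y; xy∙z≈x∙zy)

  eqᴿ-mono : ∀ (P : Asn Δ) (P′ : Asn Δ′) {ρ ρ′} → (∀ h → ⟦ P ⟧ₐ ρ h → ⟦ P′ ⟧ₐ ρ′ h) → eqᴿ P ρ ⊆ᴿ eqᴿ P′ ρ′
  eqᴿ-mono P P′ f h₀ h₁ (e , p) = e , f h₀ p

  eqᴿ-cong : ∀ {P : Asn Δ} {P′ : Asn Δ′} {ρ ρ′} → (∀ h → ⟦ P ⟧ₐ ρ h ⇔ ⟦ P′ ⟧ₐ ρ′ h) → eqᴿ P ρ ≃ eqᴿ P′ ρ′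
  eqᴿ-cong {P = P} {P′} e =
    mk≃ (eqᴿ-mono P P′ λ h → Equivalence.to (e h)) (eqᴿ-mono P′ P λ h → Equivalence.from (e h))

  -- Equal heaps can be split alike, and componentwise equal parts have equal unions. This links the
  -- invariant that `⊗` adds to the world with separating conjunction inside a triple.
  eqᴿ-∗ : ∀ (P Q : Asn Δ) {ρ} → eqᴿ (P ∗ Q) ρ ≃ eqᴿ P ρ ∗ᴿ eqᴿ Q ρ
  eqᴿ-∗ P Q = mk≃
    (λ { _ _ (e , h₁ , h₂ , (d , s) , p , q) → h₁ , h₂ , h₁ , h₂ , (d , s) , (d , λ l → trans (sym (e l)) (s l)) ,
         ((λ _ → refl) , p) , ((λ _ → refl) , q) })
    λ { _ _ (n₀ , m₀ , n₁ , m₁ , (d₀ , s₀) , (d₁ , s₁) , (e , p) , (e′ , q)) →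
      (λ l → trans (s₀ l) (trans (cong₂ _<∣>_ (e l) (e′ l)) (sym (s₁ l)))) , n₀ , m₀ , (d₀ , s₀) , p , q }

  -- Satisfaction

  ≈-cong-⇔ : ∀ (A : FMCpo) {a a′ b b′} → a ≈[ A ] a′ → b ≈[ A ] b′ → (a ≈[ A ] b) ⇔ (a′ ≈[ A ] b′)
  ≈-cong-⇔ A p q = mk⇔ (λ e → trans′ (sym′ p) (trans′ e q)) (λ e → trans′ p (trans′ e (sym′ q)))
    where open FMCpo.Eq A renaming (trans to trans′; sym to sym′)

  EqG-resp : ∀ {o₀ o₁ o₀′ o₁′} → o₀ ≡ o₀′ → o₁ ≡ o₁′ → Eq Oᶜ G o₀ o₁ → Eq Oᶜ G o₀′ o₁′
  EqG-resp refl refl p = p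

  Quadruple-mono : ∀ r r′ s s′ {c₀ c₀′ c₁ c₁′} → r′ ⊆ᴿ r → s ⊆ᴿ s′ →
    c₀ ≈[ ⟦ com ⟧ᵗ ] c₀′ → c₁ ≈[ ⟦ com ⟧ᵗ ] c₁′ → Quadruple r c₀ c₁ s → Quadruple r′ c₀′ c₁′ s′
  Quadruple-mono r r′ s s′ f g e₀ e₁ q t h₀ h₁ k₀ k₁ p K = EqG-resp (e₀ _) (e₁ _)
    (q t h₀ h₁ k₀ k₁ (∗ᴿ-mono r′ r t t f (λ _ _ → id) h₀ h₁ p)
      λ h₀ h₁ p → K h₀ h₁ (∗ᴿ-mono s s′ t t g (λ _ _ → id) h₀ h₁ p))

  Quadruple-cong : ∀ {r r′ s s′ c₀ c₀′ c₁ c₁′} → r′ ≃ r → s′ ≃ s →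
    c₀′ ≈[ ⟦ com ⟧ᵗ ] c₀ → c₁′ ≈[ ⟦ com ⟧ᵗ ] c₁ → Quadruple r′ c₀′ c₁′ s′ ⇔ Quadruple r c₀ c₁ s
  Quadruple-cong {r} {r′} {s} {s′} {c₀} {c₀′} {c₁} {c₁′} (mk≃ p q) (mk≃ p′ q′) e₀ e₁ = mk⇔
    (Quadruple-mono r′ r s′ s {c₀′} {c₀} {c₁′} {c₁} q p′ e₀ e₁)
    (Quadruple-mono r r′ s s′ {c₀} {c₀′} {c₁} {c₁′} p q′ (sym ∘ e₀) (sym ∘ e₁))

  -- The hypothesis is used with the frame `t ∗ᴿ t′`; associativity does the rest. The frame rule is
  -- thus built into the quantification over `r′` in a quadruple.
  Quadruple-frame : ∀ r s t {c₀ c₁} → Quadruple r c₀ c₁ s → Quadruple (r ∗ᴿ t) c₀ c₁ (s ∗ᴿ t)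
  Quadruple-frame r s t q t′ h₀ h₁ k₀ k₁ p K =
    q (t ∗ᴿ t′) h₀ h₁ k₀ k₁ (to≃ (∗ᴿ-assoc r t t′) h₀ h₁ p)
      λ h₀ h₁ p → K h₀ h₁ (from≃ (∗ᴿ-assoc s t t′) h₀ h₁ p)

  triple-cong : ∀ {P Q : Asn Δ} {P′ Q′ : Asn Δ′} {M : Tm Δ Γ com} {M′ : Tm Δ′ Γ′ com} {ρ ρ′ η₀ η₀′ η₁ η₁′ r r′} →
    eqᴿ P′ ρ′ ≃ eqᴿ P ρ → eqᴿ Q′ ρ′ ≃ eqᴿ Q ρ →
    (ρ′ , η₀′) ⊩ M′ ≅ M ⊩ (ρ , η₀) → (ρ′ , η₁′) ⊩ M′ ≅ M ⊩ (ρ , η₁) → r′ ≃ r →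
    (⟨ ρ′ , η₀′ , η₁′ , r′ ⟩⊨ ⟪ P′ ⟫ M′ ⟪ Q′ ⟫) ⇔ (⟨ ρ , η₀ , η₁ , r ⟩⊨ ⟪ P ⟫ M ⟪ Q ⟫)
  triple-cong {M = M} {M′} {ρ} {ρ′} {η₀} {η₀′} {η₁} {η₁′} p q e₀ e₁ e =
    Quadruple-cong {c₀ = ⟦ M ⟧ ρ η₀} {⟦ M′ ⟧ ρ′ η₀′} {⟦ M ⟧ ρ η₁} {⟦ M′ ⟧ ρ′ η₁′}
      (∗ᴿ-cong p e) (∗ᴿ-cong q e) (equality e₀) (equality e₁)

  infix 4 _≼_
  _≼_ : 𝓡 → 𝓡 → Set₁
  r ≼ r′ = ∃[ t ] r ∗ᴿ t ≃ r′

  ≼-∗ : ∀ r t → r ≼ r ∗ᴿ t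
  ≼-∗ r t = t , ≃-refl {r ∗ᴿ t}

  ≃⇒≼ : ∀ {r r′} → r ≃ r′ → r ≼ r′
  ≃⇒≼ {r} e = empᴿ , ≃-trans (∗ᴿ-identityʳ r) e

  ≼-∗ʳ : ∀ r {r′} s → r ≼ r′ → r ∗ᴿ s ≼ r′ ∗ᴿ s
  ≼-∗ʳ r s (t , e) = t , ≃-trans (xy∙z≈xz∙y r s t) (∗ᴿ-congʳ s e)

  sat-mono : ∀ (φ : Spec Δ Γ) {ρ η₀ η₁ r r′} → r ≼ r′ → (⟨ ρ , η₀ , η₁ , r ⟩⊨ φ) → (⟨ ρ , η₀ , η₁ , r′ ⟩⊨ φ)
  sat-mono (⟪ P ⟫ M ⟪ Q ⟫) {ρ} {η₀} {η₁} {r} {r′} (t , e) q = Equivalence.to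
    (Quadruple-cong {c₀ = ⟦ M ⟧ ρ η₀} {⟦ M ⟧ ρ η₀} {⟦ M ⟧ ρ η₁} {⟦ M ⟧ ρ η₁}
      (assoc P) (assoc Q) (λ _ → refl) (λ _ → refl))
    (Quadruple-frame (eqᴿ P ρ ∗ᴿ r) (eqᴿ Q ρ ∗ᴿ r) t {⟦ M ⟧ ρ η₀} {⟦ M ⟧ ρ η₁} q)
    where
    assoc : ∀ P → (eqᴿ P ρ ∗ᴿ r) ∗ᴿ t ≃ eqᴿ P ρ ∗ᴿ r′
    assoc P = ≃-trans (∗ᴿ-assoc (eqᴿ P ρ) r t) (∗ᴿ-congˡ (eqᴿ P ρ) e)
  sat-mono (φ ⊗ P) {ρ} {r = r} e p = sat-mono φ (≼-∗ʳ r (eqᴿ P ρ) e) p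
  sat-mono (E ≐ₑ F) e p = p
  sat-mono (M ≐ₜ N) e p = p
  sat-mono (φ ∧ˢ ψ) e (p , q) = sat-mono φ e p , sat-mono ψ e q
  sat-mono (φ ∨ˢ ψ) e (inj₁ p) = inj₁ (sat-mono φ e p)
  sat-mono (φ ∨ˢ ψ) e (inj₂ q) = inj₂ (sat-mono ψ e q)
  -- Every extension of `r′` by `s` is an extension of `r` by `t ∗ᴿ s`, so the implication at `r`
  -- already covers it. The antecedent travels back along `≃`, which is symmetric, unlike `≼`.
  sat-mono (φ ⇒ˢ ψ) {r = r} {r′} (t , e) f s p = sat-mono ψ (≃⇒≼ e′)
    (f (t ∗ᴿ s) (sat-mono φ (≃⇒≼ (≃-sym e′)) p))
    where
    e′ : r ∗ᴿ (t ∗ᴿ s) ≃ r′ ∗ᴿ s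
    e′ = ≃-trans (≃-sym (∗ᴿ-assoc r t s)) (∗ᴿ-congʳ s e)
  sat-mono (∀ₜ τ φ) e f m n = sat-mono φ e (f m n)
  sat-mono (∃ₜ τ φ) e (m , n , p) = m , n , sat-mono φ e p
  sat-mono (∀ᵥ φ)   e f v = sat-mono φ e (f v)
  sat-mono (∃ᵥ φ)   e (v , p) = v , sat-mono φ e p

  sat-resp : ∀ (φ : Spec Δ Γ) {ρ η₀ η₁ r r′} → r ≃ r′ → (⟨ ρ , η₀ , η₁ , r ⟩⊨ φ) → (⟨ ρ , η₀ , η₁ , r′ ⟩⊨ φ)
  sat-resp φ e = sat-mono φ (≃⇒≼ e)

  -- Extending the world by the unit `empᴿ` gives the present world back up to `≃`.
  ⇒-apply : ∀ (φ ψ : Spec Δ Γ) {ρ η₀ η₁ r} →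
    (⟨ ρ , η₀ , η₁ , r ⟩⊨ φ ⇒ˢ ψ) → (⟨ ρ , η₀ , η₁ , r ⟩⊨ φ) → (⟨ ρ , η₀ , η₁ , r ⟩⊨ ψ)
  ⇒-apply φ ψ {r = r} f p = sat-resp ψ (∗ᴿ-identityʳ r) (f empᴿ (sat-resp φ (≃-sym (∗ᴿ-identityʳ r)) p))

  -- The worlds on the two sides are only required to be `≃`: passing `⊗` adjoins a renamed
  -- assertion on one side and the original on the other, and these denote equivalent, not
  -- identical, relations.
  ⟦renₛ⟧ : ∀ (φ : Spec Δ Γ) {s : SRen Δ Δ′} {ξ : TRen Γ Γ′} {ρ ρ′ η₀ η₀′ η₁ η₁′ r r′} →
    (ρ , η₀) ∼⟨ s ∣ ξ ⟩ʳ (ρ′ , η₀′) → (ρ , η₁) ∼⟨ s ∣ ξ ⟩ʳ (ρ′ , η₁′) → r′ ≃ r →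
    (⟨ ρ′ , η₀′ , η₁′ , r′ ⟩⊨ renₛ s ξ φ) ⇔ (⟨ ρ , η₀ , η₁ , r ⟩⊨ φ)
  ⟦renₛ⟧ (⟪ P ⟫ M ⟪ Q ⟫) d₀ d₁ e = triple-cong
    (eqᴿ-cong (⟦renₐ⟧ P (svarʳ d₀))) (eqᴿ-cong (⟦renₐ⟧ Q (svarʳ d₀))) (⟦renₜ⟧ M d₀) (⟦renₜ⟧ M d₁) e
  ⟦renₛ⟧ (φ ⊗ P)  d₀ d₁ e = ⟦renₛ⟧ φ d₀ d₁ (∗ᴿ-cong e (eqᴿ-cong (⟦renₐ⟧ P (svarʳ d₀))))
  ⟦renₛ⟧ (E ≐ₑ F) d₀ d₁ e = Lift-⇔ (≡⇒⇔ (cong₂ _≡_ (⟦renₑ⟧ E (svarʳ d₀)) (⟦renₑ⟧ F (svarʳ d₀))))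
  ⟦renₛ⟧ (_≐ₜ_ {τ = τ} M N) d₀ d₁ e = Lift-⇔
    (≈-cong-⇔ ⟦ τ ⟧ᵗ (equality (⟦renₜ⟧ M d₀)) (equality (⟦renₜ⟧ N d₀)) ×-⇔
     ≈-cong-⇔ ⟦ τ ⟧ᵗ (equality (⟦renₜ⟧ M d₁)) (equality (⟦renₜ⟧ N d₁)))
  ⟦renₛ⟧ (φ ∧ˢ ψ) d₀ d₁ e = ⟦renₛ⟧ φ d₀ d₁ e ×-⇔ ⟦renₛ⟧ ψ d₀ d₁ e
  ⟦renₛ⟧ (φ ∨ˢ ψ) d₀ d₁ e = ⟦renₛ⟧ φ d₀ d₁ e ⊎-⇔ ⟦renₛ⟧ ψ d₀ d₁ e
  ⟦renₛ⟧ (φ ⇒ˢ ψ) d₀ d₁ e = ∀-⇔ λ s →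
    →-cong-⇔ (⟦renₛ⟧ φ d₀ d₁ (∗ᴿ-congʳ s e)) (⟦renₛ⟧ ψ d₀ d₁ (∗ᴿ-congʳ s e))
  ⟦renₛ⟧ (∀ₜ τ φ) d₀ d₁ e = ∀-⇔ λ m → ∀-⇔ λ n → ⟦renₛ⟧ φ (liftᵗʳ m d₀) (liftᵗʳ n d₁) e
  ⟦renₛ⟧ (∃ₜ τ φ) d₀ d₁ e = ∃-⇔ λ m → ∃-⇔ λ n → ⟦renₛ⟧ φ (liftᵗʳ m d₀) (liftᵗʳ n d₁) e
  ⟦renₛ⟧ (∀ᵥ φ)   d₀ d₁ e = ∀-⇔ λ v → ⟦renₛ⟧ φ (liftᵛʳ v d₀) (liftᵛʳ v d₁) e
  ⟦renₛ⟧ (∃ᵥ φ)   d₀ d₁ e = ∃-⇔ λ v → ⟦renₛ⟧ φ (liftᵛʳ v d₀) (liftᵛʳ v d₁) e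

  ⟦subₛ⟧ : ∀ (φ : Spec Δ Γ) {s : SSub Δ Δ′} {t : TSub Δ′ Γ Γ′} {ρ ρ′ η₀ η₀′ η₁ η₁′ r r′} →
    (ρ , η₀) ∼⟨ s ∣ t ⟩ˢ (ρ′ , η₀′) → (ρ , η₁) ∼⟨ s ∣ t ⟩ˢ (ρ′ , η₁′) → r′ ≃ r →
    (⟨ ρ′ , η₀′ , η₁′ , r′ ⟩⊨ subₛ s t φ) ⇔ (⟨ ρ , η₀ , η₁ , r ⟩⊨ φ)
  ⟦subₛ⟧ (⟪ P ⟫ M ⟪ Q ⟫) d₀ d₁ e = triple-cong
    (eqᴿ-cong (⟦subₐ⟧ P (svarˢ d₀))) (eqᴿ-cong (⟦subₐ⟧ Q (svarˢ d₀))) (⟦subₜ⟧ M d₀) (⟦subₜ⟧ M d₁) e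
  ⟦subₛ⟧ (φ ⊗ P)  d₀ d₁ e = ⟦subₛ⟧ φ d₀ d₁ (∗ᴿ-cong e (eqᴿ-cong (⟦subₐ⟧ P (svarˢ d₀))))
  ⟦subₛ⟧ (E ≐ₑ F) d₀ d₁ e = Lift-⇔ (≡⇒⇔ (cong₂ _≡_ (⟦subₑ⟧ E (svarˢ d₀)) (⟦subₑ⟧ F (svarˢ d₀))))
  ⟦subₛ⟧ (_≐ₜ_ {τ = τ} M N) d₀ d₁ e = Lift-⇔
    (≈-cong-⇔ ⟦ τ ⟧ᵗ (equality (⟦subₜ⟧ M d₀)) (equality (⟦subₜ⟧ N d₀)) ×-⇔
     ≈-cong-⇔ ⟦ τ ⟧ᵗ (equality (⟦subₜ⟧ M d₁)) (equality (⟦subₜ⟧ N d₁)))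
  ⟦subₛ⟧ (φ ∧ˢ ψ) d₀ d₁ e = ⟦subₛ⟧ φ d₀ d₁ e ×-⇔ ⟦subₛ⟧ ψ d₀ d₁ e
  ⟦subₛ⟧ (φ ∨ˢ ψ) d₀ d₁ e = ⟦subₛ⟧ φ d₀ d₁ e ⊎-⇔ ⟦subₛ⟧ ψ d₀ d₁ e
  ⟦subₛ⟧ (φ ⇒ˢ ψ) d₀ d₁ e = ∀-⇔ λ s →
    →-cong-⇔ (⟦subₛ⟧ φ d₀ d₁ (∗ᴿ-congʳ s e)) (⟦subₛ⟧ ψ d₀ d₁ (∗ᴿ-congʳ s e))
  ⟦subₛ⟧ (∀ₜ τ φ) d₀ d₁ e = ∀-⇔ λ m → ∀-⇔ λ n → ⟦subₛ⟧ φ (extᵗˢ m d₀) (extᵗˢ n d₁) e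
  ⟦subₛ⟧ (∃ₜ τ φ) d₀ d₁ e = ∃-⇔ λ m → ∃-⇔ λ n → ⟦subₛ⟧ φ (extᵗˢ m d₀) (extᵗˢ n d₁) e
  ⟦subₛ⟧ (∀ᵥ φ)   d₀ d₁ e = ∀-⇔ λ v → ⟦subₛ⟧ φ (extᵛˢ v d₀) (extᵛˢ v d₁) e
  ⟦subₛ⟧ (∃ᵥ φ)   d₀ d₁ e = ∃-⇔ λ v → ⟦subₛ⟧ φ (extᵛˢ v d₀) (extᵛˢ v d₁) e

  -- The value `v` is kept apart from `E` so that two expressions with the same value can be related
  -- to the same extended stack, which is what the substitution rule for equality needs.
  sub₀ᵛ-∼ : ∀ (E : Exp Δ) {ρ} {η : ∣ ⟦ Γ ⟧ᵍ ∣} {v} → ⟦ E ⟧ₑ ρ ≡ v →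
    _∼⟨_∣_⟩ˢ_ {Γ = Γ} {Γ} (v ∷ ρ , η) (sub₀ᵛ E) ident (ρ , η)
  sub₀ᵛ-∼ E {ρ} {v = v} e = mkˢ go λ {τ} _ → FMCpo.Eq.refl ⟦ τ ⟧ᵗ
    where
    go : v ∷ ρ ∼⟨ sub₀ᵛ E ⟩ˢ ρ
    go zero    = e
    go (suc i) = refl

  sub₀ᵗ-∼ : ∀ (M : Tm Δ Γ σ) {ρ η m} → ⟦ M ⟧ ρ η ≈[ ⟦ σ ⟧ᵗ ] m →
    (ρ , (η , m)) ∼⟨ svar ∣ sub₀ᵗ M ⟩ˢ (ρ , η)
  sub₀ᵗ-∼ {Γ = Γ} {σ} M {ρ} {η} {m} e = mkˢ (λ _ → refl) go
    where
    go : ∀ {τ} (x : τ ∈ σ ∷ Γ) → ⟦ sub₀ᵗ M x ⟧ ρ η ≈[ ⟦ τ ⟧ᵗ ] fun (identᴹ x) (η , m)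
    go (here refl)   = e
    go {τ} (there x) = FMCpo.Eq.refl ⟦ τ ⟧ᵗ

  -- Triples

  -- A triple may be proved one starting heap at a time, since eq(⟦P⟧) relates equal heaps.
  Quadruple-eqᴿ : ∀ {P Q : Asn Δ} {ρ} r {c₀ c₁} →
    (∀ h → ⟦ P ⟧ₐ ρ h → ∃[ p ] ∃[ q ] rel p h h × q ⊆ᴿ eqᴿ Q ρ × Quadruple (p ∗ᴿ r) c₀ c₁ (q ∗ᴿ r)) →
    Quadruple (eqᴿ P ρ ∗ᴿ r) c₀ c₁ (eqᴿ Q ρ ∗ᴿ r)
  Quadruple-eqᴿ {Q = Q} {ρ} r f t h₀ h₁ k₀ k₁
    (n₀ , m₀ , n₁ , m₁ , s₀ , s₁ , (a₀ , b₀ , a₁ , b₁ , s₀′ , s₁′ , (e , pre) , u) , v) K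
    with p , q , p-a₀ , q⊆Q , quad ← f a₀ pre =
    quad t h₀ h₁ k₀ k₁
      (n₀ , m₀ , n₁ , m₁ , s₀ , s₁ , (a₀ , b₀ , a₁ , b₁ , s₀′ , s₁′ , 𝓡.resp p (λ _ → refl) e p-a₀ , u) , v)
      λ h₀ h₁ x → K h₀ h₁ (∗ᴿ-mono (q ∗ᴿ r) (eqᴿ Q ρ ∗ᴿ r) t t
        (∗ᴿ-mono q (eqᴿ Q ρ) r r q⊆Q (λ _ _ → id)) (λ _ _ → id) h₀ h₁ x)

  triple-∃-sound : ∀ {P Q : Asn (suc Δ)} {M : Tm Δ Γ com} →
    Valid (∀ᵥ (⟪ P ⟫ ↑ₜ M ⟪ Q ⟫) ⇒ˢ ⟪ ∃ᵃ P ⟫ M ⟪ ∃ᵃ Q ⟫)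
  triple-∃-sound {P = P} {Q} {M} ρ η₀ η₁ r s f =
    Quadruple-eqᴿ {P = ∃ᵃ P} {∃ᵃ Q} (r ∗ᴿ s) {c₀ = ⟦ M ⟧ ρ η₀} {⟦ M ⟧ ρ η₁} λ h (v , p) →
      eqᴿ P (v ∷ ρ) , eqᴿ Q (v ∷ ρ) , ((λ _ → refl) , p) , eqᴿ-mono Q (∃ᵃ Q) (λ _ q → v , q) ,
      Equivalence.to (Quadruple-cong {c₀ = ⟦ M ⟧ ρ η₀} {⟦ ↑ₜ M ⟧ (v ∷ ρ) η₀} {⟦ M ⟧ ρ η₁} {⟦ ↑ₜ M ⟧ (v ∷ ρ) η₁}
        (≃-refl {eqᴿ P (v ∷ ρ) ∗ᴿ (r ∗ᴿ s)}) (≃-refl {eqᴿ Q (v ∷ ρ) ∗ᴿ (r ∗ᴿ s)})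
        (equality (⟦renₜ⟧ M (weakenᵛʳ v))) (equality (⟦renₜ⟧ M (weakenᵛʳ v)))) (f v)

  -- `P ∨ᵃ P′` is encoded as a negated conjunction, so excluded middle is used to learn which of the
  -- two preconditions the starting heap satisfies.
  triple-∨-sound : ∀ {P P′ Q Q′ : Asn Δ} {M : Tm Δ Γ com} →
    Valid (⟪ P ⟫ M ⟪ Q ⟫ ∧ˢ ⟪ P′ ⟫ M ⟪ Q′ ⟫ ⇒ˢ ⟪ P ∨ᵃ P′ ⟫ M ⟪ Q ∨ᵃ Q′ ⟫)
  triple-∨-sound {P = P} {P′} {Q} {Q′} {M} ρ η₀ η₁ r s (f , g) =
    Quadruple-eqᴿ {P = P ∨ᵃ P′} {Q ∨ᵃ Q′} (r ∗ᴿ s) {c₀ = ⟦ M ⟧ ρ η₀} {⟦ M ⟧ ρ η₁} cases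
    where
    cases : ∀ h → ⟦ P ∨ᵃ P′ ⟧ₐ ρ h → ∃[ p ] ∃[ q ] rel p h h × q ⊆ᴿ eqᴿ (Q ∨ᵃ Q′) ρ ×
      Quadruple (p ∗ᴿ (r ∗ᴿ s)) (⟦ M ⟧ ρ η₀) (⟦ M ⟧ ρ η₁) (q ∗ᴿ (r ∗ᴿ s))
    cases h ¬¬p with em {⟦ P ⟧ₐ ρ h} | em {⟦ P′ ⟧ₐ ρ h}
    ... | yes p | _      = eqᴿ P ρ , eqᴿ Q ρ , ((λ _ → refl) , p) , eqᴿ-mono Q (Q ∨ᵃ Q′) (λ _ q (¬q , _) → ¬q q) , f
    ... | no ¬p | yes p′ = eqᴿ P′ ρ , eqᴿ Q′ ρ , ((λ _ → refl) , p′) , eqᴿ-mono Q′ (Q ∨ᵃ Q′) (λ _ q (_ , ¬q) → ¬q q) , g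
    ... | no ¬p | no ¬p′ = contradiction (¬p , ¬p′) ¬¬p

  -- The test reads only `ρ`, which both runs share, so they take the same branch.
  triple-if-sound : ∀ {P Q : Asn Δ} {E F} {M N : Tm Δ Γ com} →
    Valid (⟪ P ∧ᵃ (E ≐ᵃ F) ⟫ M ⟪ Q ⟫ ∧ˢ ⟪ P ∧ᵃ (E ≠ᵃ F) ⟫ N ⟪ Q ⟫ ⇒ˢ ⟪ P ⟫ (if E ≟ F then M else N) ⟪ Q ⟫)
  triple-if-sound {P = P} {Q} {E} {F} {M} {N} ρ η₀ η₁ r s (f , g) =
    Quadruple-eqᴿ {P = P} {Q} (r ∗ᴿ s) {c₀ = ⟦ if E ≟ F then M else N ⟧ ρ η₀} {⟦ if E ≟ F then M else N ⟧ ρ η₁} cases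
    where
    cases : ∀ h → ⟦ P ⟧ₐ ρ h → ∃[ p ] ∃[ q ] rel p h h × q ⊆ᴿ eqᴿ Q ρ ×
      Quadruple (p ∗ᴿ (r ∗ᴿ s)) (⟦ if E ≟ F then M else N ⟧ ρ η₀) (⟦ if E ≟ F then M else N ⟧ ρ η₁) (q ∗ᴿ (r ∗ᴿ s))
    cases h p with ⟦ E ⟧ₑ ρ ≟ᵥ ⟦ F ⟧ₑ ρ
    ... | yes e = eqᴿ (P ∧ᵃ (E ≐ᵃ F)) ρ , eqᴿ Q ρ , ((λ _ → refl) , p , e) , (λ _ _ → id) , f
    ... | no ¬e = eqᴿ (P ∧ᵃ (E ≠ᵃ F)) ρ , eqᴿ Q ρ , ((λ _ → refl) , p , ¬e) , (λ _ _ → id) , g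

  consequence-sound : ∀ {P P′ Q Q′ : Asn Δ} {M : Tm Δ Γ com} → P ⊆ₐ P′ → Q′ ⊆ₐ Q →
    Valid (⟪ P′ ⟫ M ⟪ Q′ ⟫ ⇒ˢ ⟪ P ⟫ M ⟪ Q ⟫)
  consequence-sound {P = P} {P′} {Q} {Q′} {M} P⊆P′ Q′⊆Q ρ η₀ η₁ r s f =
    Quadruple-eqᴿ {P = P} {Q} (r ∗ᴿ s) {c₀ = ⟦ M ⟧ ρ η₀} {⟦ M ⟧ ρ η₁} λ h p →
      eqᴿ P′ ρ , eqᴿ Q′ ρ , ((λ _ → refl) , P⊆P′ ρ h p) , eqᴿ-mono Q′ Q (Q′⊆Q ρ) , f

  -- The continuations handed to `M` run `N`; the triple for `N`, at the same frame `t`, is exactly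
  -- the condition that the triple for `M` puts on them.
  triple-⨾-sound : ∀ {P P₀ Q : Asn Δ} {M N : Tm Δ Γ com} →
    Valid (⟪ P ⟫ M ⟪ P₀ ⟫ ∧ˢ ⟪ P₀ ⟫ N ⟪ Q ⟫ ⇒ˢ ⟪ P ⟫ (M ⨾ N) ⟪ Q ⟫)
  triple-⨾-sound {M = M} {N} ρ η₀ η₁ r s (f , g) t h₀ h₁ k₀ k₁ p K =
    let k₀′ , e₀ , e₀′ = Clauses.⟦⨾⟧ ρ η₀ h₀ k₀ M N
        k₁′ , e₁ , e₁′ = Clauses.⟦⨾⟧ ρ η₁ h₁ k₁ M N in
    EqG-resp (sym e₀) (sym e₁) (f t h₀ h₁ k₀′ k₁′ p λ h₀′ h₁′ p′ →
      EqG-resp (sym (e₀′ h₀′)) (sym (e₁′ h₁′)) (g t h₀′ h₁′ k₀ k₁ p′ K))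

  -- Single cells and the commands that access the heap

  module _ {h l c m} (h≈ : h ≈ [ l ↦ c ]ʰ ⊎ʰ m) where
    ⊎ʰ-lookup : lookup h l ≡ just c
    ⊎ʰ-lookup with l ≟ˡ l | proj₂ h≈ l
    ... | yes _ | e = e
    ... | no ¬p | _ = contradiction refl ¬p

    ⊎ʰ-∖ : m ≈ʰ h ∖ loc l
    ⊎ʰ-∖ x with x ≟ˡ l | proj₁ h≈ x | proj₂ h≈ x
    ... | yes _ | inj₂ e | _ = e
    ... | no _  | _      | e = sym e

    ⊎ʰ-≔ : ∀ c′ → h [ loc l ≔ c′ ]ʰ ≈ [ l ↦ c′ ]ʰ ⊎ʰ m
    ⊎ʰ-≔ c′ = disjoint , agree
      where
      disjoint : [ l ↦ c′ ]ʰ # m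
      disjoint x with x ≟ˡ l | proj₁ h≈ x
      ... | yes _ | inj₂ e = inj₂ e
      ... | no _  | _      = inj₁ refl
      agree : h [ loc l ≔ c′ ]ʰ ≈ʰ [ l ↦ c′ ]ʰ • m
      agree x with x ≟ˡ l | proj₂ h≈ x
      ... | yes _ | _ = refl
      ... | no _  | e = e

  ⊎ʰ-alloc : ∀ h l c → lookup h l ≡ nothing → h • [ l ↦ c ]ʰ ≈ [ l ↦ c ]ʰ ⊎ʰ h
  ⊎ʰ-alloc h l c e = ⊎ʰ-comm {h • [ l ↦ c ]ʰ} h [ l ↦ c ]ʰ (disjoint , λ _ → refl)
    where
    disjoint : h # [ l ↦ c ]ʰ
    disjoint x with x ≟ˡ l
    ... | yes refl = inj₁ e
    ... | no _     = inj₂ refl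

  ⊎ʰ-respˡ : ∀ {h n n′} m → n ≈ʰ n′ → h ≈ n ⊎ʰ m → h ≈ n′ ⊎ʰ m
  ⊎ʰ-respˡ m e (d , s) =
    (λ l → [ inj₁ ∘ trans (sym (e l)) , inj₂ ]′ (d l)) , λ l → trans (s l) (cong (_<∣> lookup m l) (e l))

  -- The relation `eqᴿ` forces the two related cells to coincide, so both heaps split off the same
  -- cell at the same location.
  ↦-∗ᴿ : ∀ E E₀ E₁ (ρ : Stack Δ) (r : 𝓡) {h₀ h₁} → rel (eqᴿ (E ↦ E₀ , E₁) ρ ∗ᴿ r) h₀ h₁ →
    ∃[ l ] ⟦ E ⟧ₑ ρ ≡ loc l × ∃[ m₀ ] ∃[ m₁ ]
      h₀ ≈ [ l ↦ ⟦ E₀ ⟧ₑ ρ , ⟦ E₁ ⟧ₑ ρ ]ʰ ⊎ʰ m₀ × h₁ ≈ [ l ↦ ⟦ E₀ ⟧ₑ ρ , ⟦ E₁ ⟧ₑ ρ ]ʰ ⊎ʰ m₁ × rel r m₀ m₁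
  ↦-∗ᴿ E E₀ E₁ ρ r {h₀} {h₁} (n₀ , m₀ , n₁ , m₁ , s₀ , s₁ , (e , l , e′ , p) , q) =
    l , e′ , m₀ , m₁ , ⊎ʰ-respˡ {h₀} {n₀} {[ l ↦ _ ]ʰ} m₀ p s₀ ,
    ⊎ʰ-respˡ {h₁} {n₁} {[ l ↦ _ ]ʰ} m₁ (λ x → trans (sym (e x)) (p x)) s₁ , q

  ∗ᴿ-↦ : ∀ E E₀ E₁ (ρ : Stack Δ) (r : 𝓡) h₀ h₁ {l} m₀ m₁ → ⟦ E ⟧ₑ ρ ≡ loc l →
    h₀ ≈ [ l ↦ ⟦ E₀ ⟧ₑ ρ , ⟦ E₁ ⟧ₑ ρ ]ʰ ⊎ʰ m₀ → h₁ ≈ [ l ↦ ⟦ E₀ ⟧ₑ ρ , ⟦ E₁ ⟧ₑ ρ ]ʰ ⊎ʰ m₁ → rel r m₀ m₁ →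
    rel (eqᴿ (E ↦ E₀ , E₁) ρ ∗ᴿ r) h₀ h₁
  ∗ᴿ-↦ E E₀ E₁ ρ r _ _ {l} m₀ m₁ e s₀ s₁ q =
    [ l ↦ _ ]ʰ , m₀ , [ l ↦ _ ]ʰ , m₁ , s₀ , s₁ , ((λ _ → refl) , l , e , λ _ → refl) , q

  -- Brings the points-to conjunct to the front and collects everything else into one relation, the
  -- form that `↦-∗ᴿ` and `∗ᴿ-↦` work with.
  eqᴿ-∗-pull : ∀ (P Q : Asn Δ) ρ r s → (eqᴿ (P ∗ Q) ρ ∗ᴿ r) ∗ᴿ s ≃ eqᴿ Q ρ ∗ᴿ ((eqᴿ P ρ ∗ᴿ r) ∗ᴿ s)
  eqᴿ-∗-pull P Q ρ r s =
    ≃-trans (∗ᴿ-congʳ s (∗ᴿ-congʳ r (≃-trans (eqᴿ-∗ P Q) (∗ᴿ-comm (eqᴿ P ρ) (eqᴿ Q ρ)))))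
    (≃-trans (∗ᴿ-congʳ s (∗ᴿ-assoc (eqᴿ Q ρ) (eqᴿ P ρ) r)) (∗ᴿ-assoc (eqᴿ Q ρ) (eqᴿ P ρ ∗ᴿ r) s))

  ∗ᴿ-mono₂ : ∀ p q r s → p ⊆ᴿ q → (p ∗ᴿ r) ∗ᴿ s ⊆ᴿ (q ∗ᴿ r) ∗ᴿ s
  ∗ᴿ-mono₂ p q r s f =
    ∗ᴿ-mono (p ∗ᴿ r) (q ∗ᴿ r) s s (∗ᴿ-mono p q r r f (λ _ _ → id)) (λ _ _ → id)

  eqᴿ-↑ : ∀ (P : Asn Δ) ρ v → eqᴿ (↑ₐ P) (v ∷ ρ) ≃ eqᴿ P ρ
  eqᴿ-↑ P ρ v = eqᴿ-cong (⟦renₐ⟧ P {ρ = ρ} {v ∷ ρ} λ _ → refl)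

  module _ {Δ Γ} (ρ : Stack Δ) (η : ∣ ⟦ Γ ⟧ᵍ ∣) (h : Heap) (k : Cont) where
    private module S = FMCpo (Conf (Env Δ Γ))

    -- The support that a configuration carries contains the list bounding the domain of its heap,
    -- so a fresh location is unallocated.
    supp-lookup : ∀ {l} → l ∉ S.supp ((ρ , η) , (h , k)) → lookup h l ≡ nothing
    supp-lookup {l} l∉ with lookup h l in e
    ... | nothing = refl
    ... | just _  = contradiction
      (∈-++⁺ʳ (FMCpo.supp (Env Δ Γ) (ρ , η)) (∈-++⁺ˡ (∈-++⁺ˡ (proj₂ (Heap.finite h) l λ e′ → contradiction (trans (sym e) e′) λ ())))) l∉

  triple-new-sound : ∀ {P Q : Asn Δ} {M : Tm (suc Δ) Γ com} →
    Valid (∀ᵥ (⟪ ↑ₐ P ∗ (svar zero ↦ zeroₑ , zeroₑ) ⟫ M ⟪ ↑ₐ Q ⟫) ⇒ˢ ⟪ P ⟫ letnew M ⟪ Q ⟫)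
  triple-new-sound {Δ} {Γ} {P = P} {Q} {M} ρ η₀ η₁ r s f t h₀ h₁ k₀ k₁ p K =
    EqG-resp
      (sym (Clauses.⟦letnew⟧ ρ η₀ h₀ k₀ M (proj₂ (S.finSupp c₀)) l∉₀))
      (sym (Clauses.⟦letnew⟧ ρ η₁ h₁ k₁ M (proj₂ (S.finSupp c₁)) l∉₁))
      (f (loc l) t h₀′ h₁′ k₀ k₁ pre
        λ h h′ q → K h h′ (∗ᴿ-mono₂ (eqᴿ (↑ₐ Q) (loc l ∷ ρ)) (eqᴿ Q ρ) (r ∗ᴿ s) t (to≃ (eqᴿ-↑ Q ρ (loc l))) h h′ q))
    where
    module S = FMCpo (Conf (Env Δ Γ))
    c₀ c₁ : ∣ Conf (Env Δ Γ) ∣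
    c₀ = (ρ , η₀) , (h₀ , k₀)
    c₁ = (ρ , η₁) , (h₁ , k₁)
    l : Loc
    l = fresh (S.supp c₀ ++ S.supp c₁)
    l∉₀ : l ∉ S.supp c₀
    l∉₀ = fresh-∉ (S.supp c₀ ++ S.supp c₁) ∘ ∈-++⁺ˡ
    l∉₁ : l ∉ S.supp c₁
    l∉₁ = fresh-∉ (S.supp c₀ ++ S.supp c₁) ∘ ∈-++⁺ʳ (S.supp c₀)
    X : Asn (suc Δ)
    X = svar zero ↦ zeroₑ , zeroₑ
    h₀′ h₁′ : Heap
    h₀′ = h₀ • [ l ↦ int 0ℤ , int 0ℤ ]ʰ
    h₁′ = h₁ • [ l ↦ int 0ℤ , int 0ℤ ]ʰ
    -- The new cell is disjoint from the whole old heap, frame included. The old heaps therefore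
    -- serve as remainders and stay related by `p`.
    pre = from≃ (eqᴿ-∗-pull (↑ₐ P) X (loc l ∷ ρ) (r ∗ᴿ s) t) h₀′ h₁′
      (∗ᴿ-↦ (svar zero) zeroₑ zeroₑ (loc l ∷ ρ) ((eqᴿ (↑ₐ P) (loc l ∷ ρ) ∗ᴿ (r ∗ᴿ s)) ∗ᴿ t) h₀′ h₁′ {l} h₀ h₁ refl
        (⊎ʰ-alloc h₀ l _ (supp-lookup {Γ = Γ} ρ η₀ h₀ k₀ l∉₀)) (⊎ʰ-alloc h₁ l _ (supp-lookup {Γ = Γ} ρ η₁ h₁ k₁ l∉₁))
        (∗ᴿ-mono₂ (eqᴿ P ρ) (eqᴿ (↑ₐ P) (loc l ∷ ρ)) (r ∗ᴿ s) t (from≃ (eqᴿ-↑ P ρ (loc l))) h₀ h₁ p))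

  cellAt-just : ∀ {h v l c m} → v ≡ loc l → h ≈ [ l ↦ c ]ʰ ⊎ʰ m → cellAt h v ≡ just c
  cellAt-just {h} {l = l} {c} {m} refl h≈ = ⊎ʰ-lookup {h} {l} {c} {m} h≈

  triple-get-sound : ∀ {P : Asn (suc Δ)} {E : Exp Δ} {E₁ : Exp (suc Δ)} {Q : Asn Δ} {M : Tm (suc Δ) Γ com} →
    Valid (∀ᵥ (⟪ P ∗ (↑ₑ E ↦ svar zero , E₁) ⟫ M ⟪ ↑ₐ Q ⟫) ⇒ˢ ⟪ ∃ᵃ (P ∗ (↑ₑ E ↦ svar zero , E₁)) ⟫ letget E f₀ M ⟪ Q ⟫)
  triple-get-sound {Γ = Γ} {P = P} {E} {E₁} {Q} {M} ρ η₀ η₁ r s f t h₀ h₁ k₀ k₁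
    (n₀ , m₀ , n₁ , m₁ , s₀ , s₁ , (a₀ , b₀ , a₁ , b₁ , s₀′ , s₁′ , (e , v , pre) , u) , w) K =
    -- Opening the existential yields `v`, and the points-to assertion makes `v` the first component
    -- of the cell in both heaps. It is thus the value that the read binds, and the premise is taken
    -- at `v` with the heaps unchanged.
    let p = n₀ , m₀ , n₁ , m₁ , s₀ , s₁ , (a₀ , b₀ , a₁ , b₁ , s₀′ , s₁′ , (e , pre) , u) , w
        l , e , o₀ , o₁ , h₀≈ , h₁≈ , _ = ↦-∗ᴿ (↑ₑ E) (svar zero) E₁ (v ∷ ρ) ((eqᴿ P (v ∷ ρ) ∗ᴿ (r ∗ᴿ s)) ∗ᴿ t) {h₀} {h₁}
          (to≃ (eqᴿ-∗-pull P (↑ₑ E ↦ svar zero , E₁) (v ∷ ρ) (r ∗ᴿ s) t) h₀ h₁ p)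
        e′ = trans (sym (⟦renₑ⟧ E {ρ = ρ} λ _ → refl)) e in
    EqG-resp
      (sym (cong (access η₀ h₀ k₀) (cellAt-just {h₀} {m = o₀} e′ h₀≈)))
      (sym (cong (access η₁ h₁ k₁) (cellAt-just {h₁} {m = o₁} e′ h₁≈)))
      (f v t h₀ h₁ k₀ k₁ p
        λ h h′ q → K h h′ (∗ᴿ-mono₂ (eqᴿ (↑ₐ Q) (v ∷ ρ)) (eqᴿ Q ρ) (r ∗ᴿ s) t (to≃ (eqᴿ-↑ Q ρ v)) h h′ q))
    where
    access : ∣ ⟦ Γ ⟧ᵍ ∣ → Heap → Cont → Maybe Cell → O
    access η h k = Maybe.maybe′ (λ c → ⟦ M ⟧ (proj₁ c ∷ ρ) η ⟨$⟩ (h , k)) err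

  triple-free-sound : ∀ (E : Exp Δ) → Valid {Γ = Γ} (⟪ E ↦- ⟫ free E ⟪ emp ⟫)
  triple-free-sound E ρ η₀ η₁ r t h₀ h₁ k₀ k₁ p K
    with n₀ , m₀ , n₁ , m₁ , s₀ , s₁ , (e , v , w , x) , u ← to≃ (∗ᴿ-assoc (eqᴿ (E ↦-) ρ) r t) h₀ h₁ p =
    let l , e , o₀ , o₁ , h₀≈ , h₁≈ , q = ↦-∗ᴿ (↑ₑ (↑ₑ E)) (svar (suc zero)) (svar zero) (w ∷ v ∷ ρ) (r ∗ᴿ t) {h₀} {h₁}
          (n₀ , m₀ , n₁ , m₁ , s₀ , s₁ , (e , x) , u)
        e′ = trans (sym (trans (⟦renₑ⟧ (↑ₑ E) {ρ = v ∷ ρ} λ _ → refl) (⟦renₑ⟧ E {ρ = ρ} λ _ → refl))) e in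
    EqG-resp
      (sym (cong (access h₀ k₀) (cellAt-just {h₀} {m = o₀} e′ h₀≈)))
      (sym (cong (access h₁ k₁) (cellAt-just {h₁} {m = o₁} e′ h₁≈)))
      -- Removing the cell leaves the remainders `o₀` and `o₁`, related by `r ∗ᴿ t`; the
      -- postcondition contributes only the unit.
      (K h₀′ h₁′ (from≃ (≃-trans (∗ᴿ-assoc (eqᴿ emp ρ) r t)
        (≃-trans (∗ᴿ-congʳ (r ∗ᴿ t) (eqᴿ-cong {P = emp} {emp} {ρ} {[]} λ _ → ⇔-id _)) (∗ᴿ-identityˡ (r ∗ᴿ t)))) h₀′ h₁′
        (𝓡.resp (r ∗ᴿ t) {o₀} {h₀′} {o₁} {h₁′} (remove h₀ o₀ e′ h₀≈) (remove h₁ o₁ e′ h₁≈) q)))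
    where
    h₀′ h₁′ : Heap
    h₀′ = h₀ ∖ ⟦ E ⟧ₑ ρ
    h₁′ = h₁ ∖ ⟦ E ⟧ₑ ρ
    access : Heap → Cont → Maybe Cell → O
    access h k = Maybe.maybe′ (λ _ → k ⟨$⟩ (h ∖ ⟦ E ⟧ₑ ρ)) err
    remove : ∀ h m {v l c} → v ≡ loc l → h ≈ [ l ↦ c ]ʰ ⊎ʰ m → m ≈ʰ h ∖ v
    remove h m refl h≈ = ⊎ʰ-∖ {h} {m = m} h≈

  triple-≔-sound : ∀ (E E₁ F : Exp Δ) → Valid {Γ = Γ} (⟪ E ↦-, E₁ ⟫ (E ∙ f₀ ≔ F) ⟪ E ↦ F , E₁ ⟫)
  triple-≔-sound E E₁ F ρ η₀ η₁ r t h₀ h₁ k₀ k₁ p K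
    with n₀ , m₀ , n₁ , m₁ , s₀ , s₁ , (e , v , x) , u ← to≃ (∗ᴿ-assoc (eqᴿ (E ↦-, E₁) ρ) r t) h₀ h₁ p =
    let l , e , o₀ , o₁ , h₀≈ , h₁≈ , q = ↦-∗ᴿ (↑ₑ E) (svar zero) (↑ₑ E₁) (v ∷ ρ) (r ∗ᴿ t) {h₀} {h₁}
          (n₀ , m₀ , n₁ , m₁ , s₀ , s₁ , (e , x) , u)
        e′ = trans (sym (⟦renₑ⟧ E {ρ = ρ} λ _ → refl)) e
        -- The untouched second component is known as the value of the weakened `E₁` on `v ∷ ρ`,
        -- while the postcondition speaks of `E₁` on `ρ`.
        e₁ = ⟦renₑ⟧ E₁ {suc} {ρ} {v ∷ ρ} λ _ → refl
        h₀′ = h₀ [ ⟦ E ⟧ₑ ρ ≔ ⟦ F ⟧ₑ ρ , ⟦ ↑ₑ E₁ ⟧ₑ (v ∷ ρ) ]ʰ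
        h₁′ = h₁ [ ⟦ E ⟧ₑ ρ ≔ ⟦ F ⟧ₑ ρ , ⟦ ↑ₑ E₁ ⟧ₑ (v ∷ ρ) ]ʰ in
    EqG-resp
      (sym (cong (access h₀ k₀) (cellAt-just {h₀} {m = o₀} e′ h₀≈)))
      (sym (cong (access h₁ k₁) (cellAt-just {h₁} {m = o₁} e′ h₁≈)))
      (K h₀′ h₁′ (from≃ (∗ᴿ-assoc (eqᴿ (E ↦ F , E₁) ρ) r t) h₀′ h₁′
        (∗ᴿ-↦ E F E₁ ρ (r ∗ᴿ t) h₀′ h₁′ o₀ o₁ e′ (update h₀ o₀ e′ e₁ h₀≈) (update h₁ o₁ e′ e₁ h₁≈) q)))
    where
    access : Heap → Cont → Maybe Cell → O
    access h k = Maybe.maybe′ (λ c → k ⟨$⟩ (h [ ⟦ E ⟧ₑ ρ ≔ ⟦ F ⟧ₑ ρ , proj₂ c ]ʰ)) err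
    update : ∀ h m {v l c d d′} → v ≡ loc l → d ≡ d′ → h ≈ [ l ↦ c ]ʰ ⊎ʰ m →
      h [ v ≔ ⟦ F ⟧ₑ ρ , d ]ʰ ≈ [ l ↦ ⟦ F ⟧ₑ ρ , d′ ]ʰ ⊎ʰ m
    update h m refl refl h≈ = ⊎ʰ-≔ {h} {m = m} h≈ _

  -- Fixed-point induction

  -- The value of the hole is a further argument of the morphism, so continuity in it needs no
  -- separate proof. It passes unchanged under binders, matching the weakening done by `fillₜ`.
  ⟦_⟧ᶜ : TmCtx σ Δ Γ τ → (Env Δ Γ ×ᶜ ⟦ σ ⟧ᵗ) ⟶ ⟦ τ ⟧ᵗ
  ⟦ hole ⟧ᶜ   = π₂ᴹ
  ⟦ ƛᵥ C ⟧ᶜ   = curryᴹ (⟦ C ⟧ᶜ ∘ᴹ ⟨ bindᴹ ∘ᴹ ⟨ π₁ᴹ ∘ᴹ π₁ᴹ , π₂ᴹ ⟩ᴹ , π₂ᴹ ∘ᴹ π₁ᴹ ⟩ᴹ)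
  ⟦ C ·ᵥ E ⟧ᶜ = evalᴹ ∘ᴹ ⟨ ⟦ C ⟧ᶜ , expᴹ E ∘ᴹ π₁ᴹ ∘ᴹ π₁ᴹ ⟩ᴹ
  ⟦ ƛₜ C ⟧ᶜ   = curryᴹ (⟦ C ⟧ᶜ ∘ᴹ
    ⟨ ⟨ π₁ᴹ ∘ᴹ π₁ᴹ ∘ᴹ π₁ᴹ , ⟨ π₂ᴹ ∘ᴹ π₁ᴹ ∘ᴹ π₁ᴹ , π₂ᴹ ⟩ᴹ ⟩ᴹ , π₂ᴹ ∘ᴹ π₁ᴹ ⟩ᴹ)
  ⟦ C ·ₜ M ⟧ᶜ = evalᴹ ∘ᴹ ⟨ ⟦ C ⟧ᶜ , ⟦ M ⟧ᴹ ∘ᴹ π₁ᴹ ⟩ᴹ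
  ⟦_⟧ᶜ {τ = τ} (fix C) = fixᴹ (pointed τ) ∘ᴹ ⟦ C ⟧ᶜ
  ⟦ C ⨾ M ⟧ᶜ  = curryᴹ (evalᴹ ∘ᴹ ⟨ ⟦ C ⟧ᶜ ∘ᴹ π₁ᴹ , ⟨ π₁ᴹ ∘ᴹ π₂ᴹ ,
    curryᴹ (evalᴹ ∘ᴹ ⟨ ⟦ M ⟧ᴹ ∘ᴹ π₁ᴹ ∘ᴹ π₁ᴹ ∘ᴹ π₁ᴹ , ⟨ π₂ᴹ , π₂ᴹ ∘ᴹ π₂ᴹ ∘ᴹ π₁ᴹ ⟩ᴹ ⟩ᴹ) ⟩ᴹ ⟩ᴹ)

  ⟦fillₜ⟧ : ∀ (C : TmCtx σ Δ Γ τ) N {ρ η d} → ⟦ N ⟧ ρ η ≈[ ⟦ σ ⟧ᵗ ] d →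
    ⟦ fillₜ C N ⟧ ρ η ≈[ ⟦ τ ⟧ᵗ ] fun ⟦ C ⟧ᶜ ((ρ , η) , d)
  ⟦fillₜ⟧ hole N e = e
  ⟦fillₜ⟧ {σ} (ƛᵥ C) N e v =
    ⟦fillₜ⟧ C (↑ₜ N) (FMCpo.Eq.trans ⟦ σ ⟧ᵗ (equality (⟦renₜ⟧ N (weakenᵛʳ v))) e)
  ⟦fillₜ⟧ (C ·ᵥ E) N {ρ} e = ⟦fillₜ⟧ C N e (⟦ E ⟧ₑ ρ)
  ⟦fillₜ⟧ {σ} (ƛₜ C) N e m =
    ⟦fillₜ⟧ C (⇑ₜ N) (FMCpo.Eq.trans ⟦ σ ⟧ᵗ (equality (⟦renₜ⟧ N (weakenᵗʳ m))) e)
  ⟦fillₜ⟧ (C ·ₜ M) N {ρ} {η} e = ⟦fillₜ⟧ C N e (⟦ M ⟧ ρ η)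
  ⟦fillₜ⟧ {τ = τ} (fix C) N {ρ} {η} {d} e =
    _⟶_.resp (fixᴹ (pointed τ)) {⟦ fillₜ C N ⟧ ρ η} {fun ⟦ C ⟧ᶜ ((ρ , η) , d)} (⟦fillₜ⟧ C N e)
  ⟦fillₜ⟧ (C ⨾ M) N {ρ} {η} {d} e (h , k) = trans (⟦fillₜ⟧ C N e (h , _))
    (Fun.resp (fun ⟦ C ⟧ᶜ ((ρ , η) , d)) ((λ _ → refl) , λ h′ → refl))

  ⟦renᶜ⟧ : ∀ (C : TmCtx σ Δ Γ τ) {s : SRen Δ Δ′} {ξ : TRen Γ Γ′} {ρ ρ′ η η′ d} →
    (ρ , η) ∼⟨ s ∣ ξ ⟩ʳ (ρ′ , η′) →
    fun ⟦ renᶜ s ξ C ⟧ᶜ ((ρ′ , η′) , d) ≈[ ⟦ τ ⟧ᵗ ] fun ⟦ C ⟧ᶜ ((ρ , η) , d)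
  ⟦renᶜ⟧ {σ = σ} hole e = FMCpo.Eq.refl ⟦ σ ⟧ᵗ
  ⟦renᶜ⟧ (ƛᵥ C) e v = ⟦renᶜ⟧ C (liftᵛʳ v e)
  ⟦renᶜ⟧ {τ = τ} (C ·ᵥ E) {d = d} e = FMCpo.Eq.trans ⟦ τ ⟧ᵗ (⟦renᶜ⟧ C e _)
    (Fun.resp (fun ⟦ C ⟧ᶜ (_ , d)) (⟦renₑ⟧ E (svarʳ e)))
  ⟦renᶜ⟧ (ƛₜ C) e m = ⟦renᶜ⟧ C (liftᵗʳ m e)
  ⟦renᶜ⟧ {τ = τ} (C ·ₜ M) {s} {ξ} {ρ} {ρ′} {η} {η′} {d} e = FMCpo.Eq.trans ⟦ τ ⟧ᵗ (⟦renᶜ⟧ C e _)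
    (Fun.resp (fun ⟦ C ⟧ᶜ (_ , d)) {⟦ renₜ s ξ M ⟧ ρ′ η′} {⟦ M ⟧ ρ η} (equality (⟦renₜ⟧ M e)))
  ⟦renᶜ⟧ {τ = τ} (fix C) {s} {ξ} {ρ} {ρ′} {η} {η′} {d} e =
    _⟶_.resp (fixᴹ (pointed τ)) {fun ⟦ renᶜ s ξ C ⟧ᶜ ((ρ′ , η′) , d)} {fun ⟦ C ⟧ᶜ ((ρ , η) , d)} (⟦renᶜ⟧ C e)
  ⟦renᶜ⟧ (C ⨾ M) {d = d} e (h , k) = trans (⟦renᶜ⟧ C e (h , _))
    (Fun.resp (fun ⟦ C ⟧ᶜ (_ , d)) ((λ _ → refl) , λ h′ → equality (⟦renₜ⟧ M e) (h′ , k)))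

  ⊥ᵗ : ∀ τ → ∣ ⟦ τ ⟧ᵗ ∣
  ⊥ᵗ τ = proj₁ (pointed τ)

  -- The grammar places the hole only where bottom determines the result: as the function of an
  -- application, as the first command of a sequence, under an abstraction or under `fix`. A context
  -- with the hole in second position would not be strict, since the first command may already yield
  -- `err`.
  ⟦⟧ᶜ-strict : ∀ (C : TmCtx σ Δ Γ τ) e d → FMCpo._⊑_ ⟦ τ ⟧ᵗ (fun ⟦ C ⟧ᶜ (e , ⊥ᵗ σ)) d
  ⟦⟧ᶜ-strict {τ = τ} hole e d = proj₂ (pointed τ) d
  ⟦⟧ᶜ-strict (ƛᵥ C) (ρ , η) d v = ⟦⟧ᶜ-strict C (v ∷ ρ , η) (d ⟨$⟩ v)
  ⟦⟧ᶜ-strict {τ = τ} (C ·ᵥ E) e d =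
    FMCpo.⊑-trans ⟦ τ ⟧ᵗ (⟦⟧ᶜ-strict C e (⊥ᵗ (val⇒ τ)) _) (proj₂ (pointed τ) d)
  ⟦⟧ᶜ-strict (ƛₜ C) (ρ , η) d m = ⟦⟧ᶜ-strict C (ρ , (η , m)) (d ⟨$⟩ m)
  ⟦⟧ᶜ-strict {τ = τ} (_·ₜ_ {τ = υ} C M) e d =
    FMCpo.⊑-trans ⟦ τ ⟧ᵗ (⟦⟧ᶜ-strict C e (⊥ᵗ (υ ⇒ τ)) _) (proj₂ (pointed τ) d)
  -- The body lies below the bottom function, so it maps `d` below bottom; every `d` is then a
  -- prefixed point.
  ⟦⟧ᶜ-strict {σ = σ} {τ = τ} (fix C) e d = lfp-least {⟦ τ ⟧ᵗ} (pointed τ) (fun ⟦ C ⟧ᶜ (e , ⊥ᵗ σ))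
    (FMCpo.⊑-trans ⟦ τ ⟧ᵗ (⟦⟧ᶜ-strict C e (⊥ᵗ (τ ⇒ τ)) d) (proj₂ (pointed τ) d))
  ⟦⟧ᶜ-strict (C ⨾ M) e d c = FMCpo.⊑-trans Oᶜ (⟦⟧ᶜ-strict C e (⊥ᵗ com) _) bot

  -- γ with the hole standing for d₀ on the left and d₁ on the right; these need
  -- not be denotable by a term.
  Satᶜ : SpecCtx σ Δ Γ → Stack Δ → ∣ ⟦ Γ ⟧ᵍ ∣ → ∣ ⟦ Γ ⟧ᵍ ∣ → 𝓡 → ∣ ⟦ σ ⟧ᵗ ∣ → ∣ ⟦ σ ⟧ᵗ ∣ → Set₁
  Satᶜ (⟪ P ⟫ C ⟪ Q ⟫) ρ η₀ η₁ r d₀ d₁ =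
    Quadruple (eqᴿ P ρ ∗ᴿ r) (fun ⟦ C ⟧ᶜ ((ρ , η₀) , d₀)) (fun ⟦ C ⟧ᶜ ((ρ , η₁) , d₁)) (eqᴿ Q ρ ∗ᴿ r)
  Satᶜ (γ ∧ˢ δ) ρ η₀ η₁ r d₀ d₁ = Satᶜ γ ρ η₀ η₁ r d₀ d₁ × Satᶜ δ ρ η₀ η₁ r d₀ d₁
  Satᶜ (∀ₜ τ γ) ρ η₀ η₁ r d₀ d₁ = ∀ (m n : ∣ ⟦ τ ⟧ᵗ ∣) → Satᶜ γ ρ (η₀ , m) (η₁ , n) r d₀ d₁
  Satᶜ (∀ᵥ γ)   ρ η₀ η₁ r d₀ d₁ = ∀ (v : Val) → Satᶜ γ (v ∷ ρ) η₀ η₁ r d₀ d₁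

  ⟦fillₛ⟧ : ∀ (γ : SpecCtx σ Δ Γ) N {ρ η₀ η₁ r d₀ d₁} →
    ⟦ N ⟧ ρ η₀ ≈[ ⟦ σ ⟧ᵗ ] d₀ → ⟦ N ⟧ ρ η₁ ≈[ ⟦ σ ⟧ᵗ ] d₁ →
    (⟨ ρ , η₀ , η₁ , r ⟩⊨ fillₛ γ N) ⇔ Satᶜ γ ρ η₀ η₁ r d₀ d₁
  ⟦fillₛ⟧ (⟪ P ⟫ C ⟪ Q ⟫) N {ρ} {η₀} {η₁} {r} {d₀} {d₁} e₀ e₁ = Quadruple-cong
    {c₀ = fun ⟦ C ⟧ᶜ ((ρ , η₀) , d₀)} {⟦ fillₜ C N ⟧ ρ η₀} {fun ⟦ C ⟧ᶜ ((ρ , η₁) , d₁)} {⟦ fillₜ C N ⟧ ρ η₁}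
    (≃-refl {eqᴿ P ρ ∗ᴿ r}) (≃-refl {eqᴿ Q ρ ∗ᴿ r}) (⟦fillₜ⟧ C N e₀) (⟦fillₜ⟧ C N e₁)
  ⟦fillₛ⟧ (γ ∧ˢ δ) N e₀ e₁ = ⟦fillₛ⟧ γ N e₀ e₁ ×-⇔ ⟦fillₛ⟧ δ N e₀ e₁
  ⟦fillₛ⟧ {σ} (∀ₜ τ γ) N e₀ e₁ = ∀-⇔ λ m → ∀-⇔ λ n → ⟦fillₛ⟧ γ (⇑ₜ N)
    (FMCpo.Eq.trans ⟦ σ ⟧ᵗ (equality (⟦renₜ⟧ N (weakenᵗʳ m))) e₀)
    (FMCpo.Eq.trans ⟦ σ ⟧ᵗ (equality (⟦renₜ⟧ N (weakenᵗʳ n))) e₁)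
  ⟦fillₛ⟧ {σ} (∀ᵥ γ) N e₀ e₁ = ∀-⇔ λ v → ⟦fillₛ⟧ γ (↑ₜ N)
    (FMCpo.Eq.trans ⟦ σ ⟧ᵗ (equality (⟦renₜ⟧ N (weakenᵛʳ v))) e₀)
    (FMCpo.Eq.trans ⟦ σ ⟧ᵗ (equality (⟦renₜ⟧ N (weakenᵛʳ v))) e₁)

  ⟦renˢᶜ⟧ : ∀ (γ : SpecCtx σ Δ Γ) {s : SRen Δ Δ′} {ξ : TRen Γ Γ′} {ρ ρ′ η₀ η₀′ η₁ η₁′ r d₀ d₁} →
    (ρ , η₀) ∼⟨ s ∣ ξ ⟩ʳ (ρ′ , η₀′) → (ρ , η₁) ∼⟨ s ∣ ξ ⟩ʳ (ρ′ , η₁′) →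
    Satᶜ (renˢᶜ s ξ γ) ρ′ η₀′ η₁′ r d₀ d₁ ⇔ Satᶜ γ ρ η₀ η₁ r d₀ d₁
  ⟦renˢᶜ⟧ (⟪ P ⟫ C ⟪ Q ⟫) {s} {ξ} {ρ} {ρ′} {η₀} {η₀′} {η₁} {η₁′} {r} {d₀} {d₁} e₀ e₁ = Quadruple-cong
    {c₀ = fun ⟦ C ⟧ᶜ ((ρ , η₀) , d₀)} {fun ⟦ renᶜ s ξ C ⟧ᶜ ((ρ′ , η₀′) , d₀)}
    {fun ⟦ C ⟧ᶜ ((ρ , η₁) , d₁)} {fun ⟦ renᶜ s ξ C ⟧ᶜ ((ρ′ , η₁′) , d₁)}
    (∗ᴿ-congʳ r (eqᴿ-cong (⟦renₐ⟧ P (svarʳ e₀)))) (∗ᴿ-congʳ r (eqᴿ-cong (⟦renₐ⟧ Q (svarʳ e₀))))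
    (⟦renᶜ⟧ C e₀) (⟦renᶜ⟧ C e₁)
  ⟦renˢᶜ⟧ (γ ∧ˢ δ) e₀ e₁ = ⟦renˢᶜ⟧ γ e₀ e₁ ×-⇔ ⟦renˢᶜ⟧ δ e₀ e₁
  ⟦renˢᶜ⟧ (∀ₜ τ γ) e₀ e₁ = ∀-⇔ λ m → ∀-⇔ λ n → ⟦renˢᶜ⟧ γ (liftᵗʳ m e₀) (liftᵗʳ n e₁)
  ⟦renˢᶜ⟧ (∀ᵥ γ)   e₀ e₁ = ∀-⇔ λ v → ⟦renˢᶜ⟧ γ (liftᵛʳ v e₀) (liftᵛʳ v e₁)

  Satᶜ-⊥ : ∀ (γ : SpecCtx σ Δ Γ) {ρ η₀ η₁ r} → Satᶜ γ ρ η₀ η₁ r (⊥ᵗ σ) (⊥ᵗ σ)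
  Satᶜ-⊥ (⟪ P ⟫ C ⟪ Q ⟫) {ρ} {η₀} {η₁} _ h₀ h₁ k₀ k₁ _ _ = EqG-resp
    (sym (⊑⊥ (⟦⟧ᶜ-strict C (ρ , η₀) (⊥ᵗ com) (h₀ , k₀)))) (sym (⊑⊥ (⟦⟧ᶜ-strict C (ρ , η₁) (⊥ᵗ com) (h₁ , k₁))))
    (refl , inj₂ refl)
    where
    ⊑⊥ : ∀ {o} → o ⊑ₒ ⊥ₒ → o ≡ ⊥ₒ
    ⊑⊥ bot  = refl
    ⊑⊥ same = refl
  Satᶜ-⊥ (γ ∧ˢ δ) = Satᶜ-⊥ γ , Satᶜ-⊥ δ
  Satᶜ-⊥ (∀ₜ τ γ) m n = Satᶜ-⊥ γ
  Satᶜ-⊥ (∀ᵥ γ)   v = Satᶜ-⊥ γ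

  -- `G` is the set of elements below `normal`, hence closed under lubs; equality of the limits is
  -- uniqueness of lubs.
  EqG-lub : ∀ {c₀ c₁ a₀ a₁} → FMCpo.IsLub Oᶜ c₀ a₀ → FMCpo.IsLub Oᶜ c₁ a₁ →
    (∀ n → Eq Oᶜ G (c₀ n) (c₁ n)) → Eq Oᶜ G a₀ a₁
  EqG-lub {c₀} l₀ l₁ e =
    FMCpo.IsLub-unique Oᶜ l₀ (FMCpo.IsLub-resp Oᶜ (sym ∘ proj₁ ∘ e) refl l₁) ,
    below (proj₂ l₀ normal λ n → above (proj₂ (e n)))
    where
    above : ∀ {o} → G o → o ⊑ₒ normal
    above (inj₁ refl) = same
    above (inj₂ refl) = bot
    below : ∀ {o} → o ⊑ₒ normal → G o
    below bot  = inj₂ refl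
    below same = inj₁ refl

  -- With environment, heap and continuation grouped into the first argument, currying gives the
  -- outcome of a run as a continuous function of the hole alone.
  runᴹ : TmCtx σ Δ Γ com → (Conf (Env Δ Γ) ×ᶜ ⟦ σ ⟧ᵗ) ⟶ Oᶜ
  runᴹ C = evalᴹ ∘ᴹ ⟨ ⟦ C ⟧ᶜ ∘ᴹ ⟨ π₁ᴹ ∘ᴹ π₁ᴹ , π₂ᴹ ⟩ᴹ , π₂ᴹ ∘ᴹ π₁ᴹ ⟩ᴹ

  Satᶜ-lub : ∀ (γ : SpecCtx σ Δ Γ) {ρ η₀ η₁ r} → let open FMCpo ⟦ σ ⟧ᵗ in ∀ (c₀ c₁ : Chain) {d₀ d₁} →
    IsLub (Chain.seq c₀) d₀ → IsLub (Chain.seq c₁) d₁ →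
    (∀ n → Satᶜ γ ρ η₀ η₁ r (Chain.seq c₀ n) (Chain.seq c₁ n)) → Satᶜ γ ρ η₀ η₁ r d₀ d₁
  Satᶜ-lub (⟪ P ⟫ C ⟪ Q ⟫) {ρ} {η₀} {η₁} c₀ c₁ l₀ l₁ f t h₀ h₁ k₀ k₁ p K = EqG-lub
    (Fun.pres (fun (curryᴹ (runᴹ C)) ((ρ , η₀) , (h₀ , k₀))) c₀ l₀)
    (Fun.pres (fun (curryᴹ (runᴹ C)) ((ρ , η₁) , (h₁ , k₁))) c₁ l₁)
    λ n → f n t h₀ h₁ k₀ k₁ p K
  Satᶜ-lub (γ ∧ˢ δ) c₀ c₁ l₀ l₁ f = Satᶜ-lub γ c₀ c₁ l₀ l₁ (proj₁ ∘ f) , Satᶜ-lub δ c₀ c₁ l₀ l₁ (proj₂ ∘ f)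
  Satᶜ-lub (∀ₜ τ γ) c₀ c₁ l₀ l₁ f m n = Satᶜ-lub γ c₀ c₁ l₀ l₁ λ i → f i m n
  Satᶜ-lub (∀ᵥ γ)   c₀ c₁ l₀ l₁ f v = Satᶜ-lub γ c₀ c₁ l₀ l₁ λ i → f i v

  fixpoint-induction-sound : ∀ (γ : SpecCtx τ Δ Γ) (M : Tm Δ Γ (τ ⇒ τ)) →
    Valid (∀ₜ τ (fillₛ (⇑ˢᶜ γ) (ident (here refl)) ⇒ˢ fillₛ (⇑ˢᶜ γ) (⇑ₜ M ·ₜ ident (here refl))) ⇒ˢ fillₛ γ (fix M))
  fixpoint-induction-sound {τ} {Δ} {Γ} γ M ρ η₀ η₁ r s f = Equivalence.from
    (⟦fillₛ⟧ γ (fix M) (FMCpo.Eq.refl ⟦ τ ⟧ᵗ) (FMCpo.Eq.refl ⟦ τ ⟧ᵗ))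
    (Satᶜ-lub γ (iterates {⟦ τ ⟧ᵗ} ⊥ᴰ F₀) (iterates {⟦ τ ⟧ᵗ} ⊥ᴰ F₁)
      (lfp-IsLub {⟦ τ ⟧ᵗ} ⊥ᴰ F₀) (lfp-IsLub {⟦ τ ⟧ᵗ} ⊥ᴰ F₁) approximants)
    where
    ⊥ᴰ : Pointed ⟦ τ ⟧ᵗ
    ⊥ᴰ = pointed τ
    F₀ F₁ : Fun ⟦ τ ⟧ᵗ ⟦ τ ⟧ᵗ
    F₀ = ⟦ M ⟧ ρ η₀
    F₁ = ⟦ M ⟧ ρ η₁
    x : Tm Δ (τ ∷ Γ) τ
    x = ident (here refl)
    -- The bound identifier ranges over arbitrary pairs of elements, so the hypothesis can be
    -- instantiated at the two current iterates. They differ in general, since `M` is interpreted in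
    -- two environments.
    step : ∀ d₀ d₁ → Satᶜ γ ρ η₀ η₁ (r ∗ᴿ s) d₀ d₁ → Satᶜ γ ρ η₀ η₁ (r ∗ᴿ s) (F₀ ⟨$⟩ d₀) (F₁ ⟨$⟩ d₁)
    step d₀ d₁ p =
      Equivalence.to (⟦renˢᶜ⟧ γ (weakenᵗʳ d₀) (weakenᵗʳ d₁))
      (Equivalence.to (⟦fillₛ⟧ (⇑ˢᶜ γ) (⇑ₜ M ·ₜ x)
        (equality (⟦renₜ⟧ M (weakenᵗʳ d₀)) d₀) (equality (⟦renₜ⟧ M (weakenᵗʳ d₁)) d₁))
      (⇒-apply (fillₛ (⇑ˢᶜ γ) x) (fillₛ (⇑ˢᶜ γ) (⇑ₜ M ·ₜ x)) (f d₀ d₁)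
      (Equivalence.from (⟦fillₛ⟧ (⇑ˢᶜ γ) x (FMCpo.Eq.refl ⟦ τ ⟧ᵗ) (FMCpo.Eq.refl ⟦ τ ⟧ᵗ))
      (Equivalence.from (⟦renˢᶜ⟧ γ (weakenᵗʳ d₀) (weakenᵗʳ d₁)) p))))
    approximants : ∀ n → Satᶜ γ ρ η₀ η₁ (r ∗ᴿ s) (iterate {⟦ τ ⟧ᵗ} ⊥ᴰ F₀ n) (iterate {⟦ τ ⟧ᵗ} ⊥ᴰ F₁ n)
    approximants zero    = Satᶜ-⊥ γ
    approximants (suc n) = step _ _ (approximants n)

  -- The rules

  ⊗-triple-≃ : ∀ (P Q : Asn Δ) ρ r → eqᴿ P ρ ∗ᴿ (r ∗ᴿ eqᴿ Q ρ) ≃ eqᴿ (P ∗ Q) ρ ∗ᴿ r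
  ⊗-triple-≃ P Q ρ r =
    ≃-trans (x∙yz≈xz∙y (eqᴿ P ρ) r (eqᴿ Q ρ)) (∗ᴿ-congʳ r (≃-sym (eqᴿ-∗ P Q)))

  ⊗-triple-⇔ : ∀ {P P′ Q : Asn Δ} {M : Tm Δ Γ com} {ρ η₀ η₁ r} →
    (⟨ ρ , η₀ , η₁ , r ⟩⊨ (⟪ P ⟫ M ⟪ P′ ⟫) ⊗ Q) ⇔ (⟨ ρ , η₀ , η₁ , r ⟩⊨ ⟪ P ∗ Q ⟫ M ⟪ P′ ∗ Q ⟫)
  ⊗-triple-⇔ {P = P} {P′} {Q} {M} {ρ} {η₀} {η₁} {r} =
    Quadruple-cong {c₀ = ⟦ M ⟧ ρ η₀} {⟦ M ⟧ ρ η₀} {⟦ M ⟧ ρ η₁} {⟦ M ⟧ ρ η₁}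
      (⊗-triple-≃ P Q ρ r) (⊗-triple-≃ P′ Q ρ r) (λ _ → refl) (λ _ → refl)

  -- Unfolding `⊗` adjoins the outer assertion first, so commutativity has to restore the order.
  ⊗-⊗-≃ : ∀ (P Q : Asn Δ) ρ r → (r ∗ᴿ eqᴿ Q ρ) ∗ᴿ eqᴿ P ρ ≃ r ∗ᴿ eqᴿ (P ∗ Q) ρ
  ⊗-⊗-≃ P Q ρ r =
    ≃-trans (xy∙z≈x∙zy r (eqᴿ Q ρ) (eqᴿ P ρ)) (∗ᴿ-congˡ r (≃-sym (eqᴿ-∗ P Q)))

  ⊗-↑-≃ : ∀ (P : Asn Δ) ρ v r → r ∗ᴿ eqᴿ P ρ ≃ r ∗ᴿ eqᴿ (↑ₐ P) (v ∷ ρ)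
  ⊗-↑-≃ P ρ v r = ∗ᴿ-congˡ r (≃-sym (eqᴿ-↑ P ρ v))

  ↑ₛ-⇔ : ∀ (φ : Spec Δ Γ) ρ η₀ η₁ r v → (⟨ v ∷ ρ , η₀ , η₁ , r ⟩⊨ ↑ₛ φ) ⇔ (⟨ ρ , η₀ , η₁ , r ⟩⊨ φ)
  ↑ₛ-⇔ {Γ = Γ} φ ρ η₀ η₁ r v =
    ⟦renₛ⟧ φ (weakenᵛʳ {Γ = Γ} {ρ} {η₀} v) (weakenᵛʳ {Γ = Γ} {ρ} {η₁} v) (≃-refl {r})

  ⇑ₛ-⇔ : ∀ (φ : Spec Δ Γ) ρ η₀ η₁ r (m n : ∣ ⟦ τ ⟧ᵗ ∣) →
    (⟨ ρ , (η₀ , m) , (η₁ , n) , r ⟩⊨ ⇑ₛ φ) ⇔ (⟨ ρ , η₀ , η₁ , r ⟩⊨ φ)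
  ⇑ₛ-⇔ {Γ = Γ} {τ} φ ρ η₀ η₁ r m n =
    ⟦renₛ⟧ φ (weakenᵗʳ {Γ = Γ} {τ} {ρ} {η₀} m) (weakenᵗʳ {Γ = Γ} {τ} {ρ} {η₁} n) (≃-refl {r})

  [/i]-⇔ : ∀ (φ : Spec (suc Δ) Γ) E ρ η₀ η₁ r {v} → ⟦ E ⟧ₑ ρ ≡ v →
    (⟨ ρ , η₀ , η₁ , r ⟩⊨ φ [ E /i]) ⇔ (⟨ v ∷ ρ , η₀ , η₁ , r ⟩⊨ φ)
  [/i]-⇔ {Γ = Γ} φ E ρ η₀ η₁ r e =
    ⟦subₛ⟧ φ (sub₀ᵛ-∼ {Γ = Γ} E {ρ} {η₀} e) (sub₀ᵛ-∼ {Γ = Γ} E {ρ} {η₁} e) (≃-refl {r})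

  [/x]-⇔ : ∀ (φ : Spec Δ (τ ∷ Γ)) M ρ η₀ η₁ r {m n} →
    ⟦ M ⟧ ρ η₀ ≈[ ⟦ τ ⟧ᵗ ] m → ⟦ M ⟧ ρ η₁ ≈[ ⟦ τ ⟧ᵗ ] n →
    (⟨ ρ , η₀ , η₁ , r ⟩⊨ φ [ M /x]) ⇔ (⟨ ρ , (η₀ , m) , (η₁ , n) , r ⟩⊨ φ)
  [/x]-⇔ φ M ρ η₀ η₁ r {m} {n} e₀ e₁ =
    ⟦subₛ⟧ φ (sub₀ᵗ-∼ M {ρ} {η₀} {m} e₀) (sub₀ᵗ-∼ M {ρ} {η₁} {n} e₁) (≃-refl {r})

  [/x]-⇔-refl : ∀ (φ : Spec Δ (τ ∷ Γ)) M ρ η₀ η₁ r →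
    (⟨ ρ , η₀ , η₁ , r ⟩⊨ φ [ M /x]) ⇔ (⟨ ρ , (η₀ , ⟦ M ⟧ ρ η₀) , (η₁ , ⟦ M ⟧ ρ η₁) , r ⟩⊨ φ)
  [/x]-⇔-refl {τ = τ} φ M ρ η₀ η₁ r =
    [/x]-⇔ φ M ρ η₀ η₁ r (FMCpo.Eq.refl ⟦ τ ⟧ᵗ) (FMCpo.Eq.refl ⟦ τ ⟧ᵗ)

  sound : ∀ {premises} {φ : Spec Δ Γ} → Rule premises φ → All ValidJ premises → Valid φ
  sound (⇒-mp {φ} {ψ}) (p ∷ f ∷ []) ρ η₀ η₁ r = ⇒-apply φ ψ (f ρ η₀ η₁ r) (p ρ η₀ η₁ r)
  sound (⇒-K {φ}) _ ρ η₀ η₁ r s p t q = sat-mono φ (≼-∗ (r ∗ᴿ s) t) p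
  -- `f` was obtained before `t` extended the world; monotonicity carries it to where `g` holds.
  sound (⇒-S {φ} {ψ} {χ}) _ ρ η₀ η₁ r s f t g u p =
    ⇒-apply ψ χ (sat-mono (φ ⇒ˢ ψ ⇒ˢ χ) {r = r ∗ᴿ s} (≼-∗ (r ∗ᴿ s) t) f u p) (g u p)
  sound (∧-i {φ}) _ ρ η₀ η₁ r s p t q = sat-mono φ (≼-∗ (r ∗ᴿ s) t) p , q
  sound ∧-e₁ _ ρ η₀ η₁ r s = proj₁
  sound ∧-e₂ _ ρ η₀ η₁ r s = proj₂
  sound ∨-i₁ _ ρ η₀ η₁ r s = inj₁
  sound ∨-i₂ _ ρ η₀ η₁ r s = inj₂
  sound (∨-e {φ} {ψ} {χ}) _ ρ η₀ η₁ r s f t g u (inj₁ p) = sat-mono (φ ⇒ˢ χ) {r = r ∗ᴿ s} (≼-∗ (r ∗ᴿ s) t) f u p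
  sound (∨-e {φ} {ψ} {χ}) _ ρ η₀ η₁ r s f t g u (inj₂ q) = g u q
  sound (∀ᵥ-i {φ}) (f ∷ []) ρ η₀ η₁ r s p v = f (v ∷ ρ) η₀ η₁ r s (Equivalence.from (↑ₛ-⇔ φ ρ η₀ η₁ (r ∗ᴿ s) v) p)
  sound (∀ᵥ-e {φ} E) _ ρ η₀ η₁ r s f = Equivalence.from ([/i]-⇔ φ E ρ η₀ η₁ (r ∗ᴿ s) refl) (f (⟦ E ⟧ₑ ρ))
  sound (∃ᵥ-i {φ} E) _ ρ η₀ η₁ r s p = ⟦ E ⟧ₑ ρ , Equivalence.to ([/i]-⇔ φ E ρ η₀ η₁ (r ∗ᴿ s) refl) p
  sound (∃ᵥ-e {φ} {ψ}) (f ∷ []) ρ η₀ η₁ r s (v , p) = Equivalence.to (↑ₛ-⇔ ψ ρ η₀ η₁ (r ∗ᴿ s) v) (f (v ∷ ρ) η₀ η₁ r s p)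
  sound (∀ₜ-i {φ = φ}) (f ∷ []) ρ η₀ η₁ r s p m n =
    f ρ (η₀ , m) (η₁ , n) r s (Equivalence.from (⇑ₛ-⇔ φ ρ η₀ η₁ (r ∗ᴿ s) m n) p)
  sound (∀ₜ-e {φ = φ} M) _ ρ η₀ η₁ r s f =
    Equivalence.from ([/x]-⇔-refl φ M ρ η₀ η₁ (r ∗ᴿ s)) (f (⟦ M ⟧ ρ η₀) (⟦ M ⟧ ρ η₁))
  sound (∃ₜ-i {φ = φ} M) _ ρ η₀ η₁ r s p =
    ⟦ M ⟧ ρ η₀ , ⟦ M ⟧ ρ η₁ , Equivalence.to ([/x]-⇔-refl φ M ρ η₀ η₁ (r ∗ᴿ s)) p
  sound (∃ₜ-e {φ = φ} {ψ}) (f ∷ []) ρ η₀ η₁ r s (m , n , p) =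
    Equivalence.to (⇑ₛ-⇔ ψ ρ η₀ η₁ (r ∗ᴿ s) m n) (f ρ (η₀ , m) (η₁ , n) r s p)
  sound (≐ₑ-refl E) _ ρ η₀ η₁ r = lift refl
  sound (≐ₑ-subst φ {E} {F}) _ ρ η₀ η₁ r s (lift e) t p =
    Equivalence.from ([/i]-⇔ φ F ρ η₀ η₁ (r ∗ᴿ s ∗ᴿ t) (sym e))
      (Equivalence.to ([/i]-⇔ φ E ρ η₀ η₁ (r ∗ᴿ s ∗ᴿ t) refl) p)
  sound (≐ₜ-refl {τ} M) _ ρ η₀ η₁ r = lift (FMCpo.Eq.refl ⟦ τ ⟧ᵗ , FMCpo.Eq.refl ⟦ τ ⟧ᵗ)
  sound (≐ₜ-subst {τ} φ {M} {N}) _ ρ η₀ η₁ r s (lift (e₀ , e₁)) t p =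
    Equivalence.from ([/x]-⇔ φ N ρ η₀ η₁ (r ∗ᴿ s ∗ᴿ t) (FMCpo.Eq.sym ⟦ τ ⟧ᵗ e₀) (FMCpo.Eq.sym ⟦ τ ⟧ᵗ e₁))
      (Equivalence.to ([/x]-⇔-refl φ M ρ η₀ η₁ (r ∗ᴿ s ∗ᴿ t)) p)
  sound (triple-∃ {P} {Q} {M}) _ = triple-∃-sound {P = P} {Q} {M}
  sound (triple-∨ {P} {P′} {Q} {Q′} {M}) _ = triple-∨-sound {P = P} {P′} {Q} {Q′} {M}
  sound (triple-if {P} {Q} {E} {F} {M} {N}) _ = triple-if-sound {P = P} {Q} {E} {F} {M} {N}
  sound (triple-⨾ {P} {P₀} {Q} {M} {N}) _ = triple-⨾-sound {P = P} {P₀} {Q} {M} {N}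
  sound (triple-new {P} {Q} {M}) _ = triple-new-sound {P = P} {Q} {M}
  sound (triple-get {P} {E} {E₁} {Q} {M}) _ = triple-get-sound {P = P} {E} {E₁} {Q} {M}
  sound {Γ = Γ} (triple-free E) _ ρ η₀ η₁ r = triple-free-sound {Γ = Γ} E ρ η₀ η₁ r
  sound {Γ = Γ} (triple-≔ E E₁ F) _ ρ η₀ η₁ r = triple-≔-sound {Γ = Γ} E E₁ F ρ η₀ η₁ r
  sound (consequence {P} {P′} {Q} {Q′} {M} p q) _ = consequence-sound {P = P} {P′} {Q} {Q′} {M} p q
  sound (⊗-i {φ} {P}) _ ρ η₀ η₁ r s = sat-mono φ (≼-∗ (r ∗ᴿ s) (eqᴿ P ρ))
  sound (⊗-triple {P} {P′} {Q} {M}) _ ρ η₀ η₁ r =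
    (λ s → Equivalence.to (⊗-triple-⇔ {P = P} {P′} {Q} {M} {ρ} {η₀} {η₁} {r ∗ᴿ s})) ,
    (λ s → Equivalence.from (⊗-triple-⇔ {P = P} {P′} {Q} {M} {ρ} {η₀} {η₁} {r ∗ᴿ s}))
  sound ⊗-≐ₑ _ ρ η₀ η₁ r = (λ s → id) , (λ s → id)
  sound ⊗-≐ₜ _ ρ η₀ η₁ r = (λ s → id) , (λ s → id)
  sound (⊗-⊗ {φ} {P} {Q}) _ ρ η₀ η₁ r =
    (λ s → sat-resp φ (⊗-⊗-≃ P Q ρ (r ∗ᴿ s))) , (λ s → sat-resp φ (≃-sym (⊗-⊗-≃ P Q ρ (r ∗ᴿ s))))
  -- One side adjoins the invariant before the extension `t` of the implication, the other after it;
  -- exchanging the two is all that is needed.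
  sound (⊗-⇒ {φ} {ψ} {P}) _ ρ η₀ η₁ r =
    (λ s f t p → sat-resp ψ (xy∙z≈xz∙y (r ∗ᴿ s) (eqᴿ P ρ) t)
      (f t (sat-resp φ (xy∙z≈xz∙y (r ∗ᴿ s) t (eqᴿ P ρ)) p))) ,
    (λ s f t p → sat-resp ψ (xy∙z≈xz∙y (r ∗ᴿ s) t (eqᴿ P ρ))
      (f t (sat-resp φ (xy∙z≈xz∙y (r ∗ᴿ s) (eqᴿ P ρ) t) p)))
  sound ⊗-∧ _ ρ η₀ η₁ r = (λ s → id) , (λ s → id)
  sound ⊗-∨ _ ρ η₀ η₁ r = (λ s → id) , (λ s → id)
  sound ⊗-∀ₜ _ ρ η₀ η₁ r = (λ s → id) , (λ s → id)
  sound ⊗-∃ₜ _ ρ η₀ η₁ r = (λ s → id) , (λ s → id)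
  sound (⊗-∀ᵥ {φ} {P}) _ ρ η₀ η₁ r =
    (λ s f v → sat-resp φ (⊗-↑-≃ P ρ v (r ∗ᴿ s)) (f v)) ,
    (λ s f v → sat-resp φ (≃-sym (⊗-↑-≃ P ρ v (r ∗ᴿ s))) (f v))
  sound (⊗-∃ᵥ {φ} {P}) _ ρ η₀ η₁ r =
    (λ s (v , p) → v , sat-resp φ (⊗-↑-≃ P ρ v (r ∗ᴿ s)) p) ,
    (λ s (v , p) → v , sat-resp φ (≃-sym (⊗-↑-≃ P ρ v (r ∗ᴿ s))) p)
  sound (fixpoint-induction γ M) _ = fixpoint-induction-sound γ M

theorem5p2 : (Loc : Set) (Loc↔ℕ : Loc ↔ ℕ) (em : ExcludedMiddle 0ℓ) →
    let open Semantics Loc Loc↔ℕ em in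
    {Δ : ℕ} {Γ : TyEnv} {premises : List Judgement} {φ : Spec Δ Γ} →
    Rule premises φ → All ValidJ premises → Valid φ
theorem5p2 Loc Loc↔ℕ em = Soundness.sound Loc Loc↔ℕ em
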